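{- For any programs $\Pi_1$ and $\Pi_2$ of mini-gringo with counting, if the sentence $\tau^*\Pi_1\leftrightarrow\tau^*\Pi_2$ is provable in the deductive system $\mathit{HT}_{\#}$, then $\Pi_1$ and $\Pi_2$ are strongly equivalent.
   Context: Precomputed terms. Fix a totally ordered set of precomputed terms containing all numerals $\overline n$ (one for each integer $n$, in 1-1 correspondence with the integers), all symbolic constants, and possibly other symbols, such that numerals are contiguous (every precomputed term between two numerals is a numeral) and are ordered as the integers. Programs (mini-gringo with counting). Program terms are built from precomputed terms and variables using unary $|\cdot|$ and binary $+,-,\times,/,\backslash,..$ (interval). An atom is a symbolic constant $p$ optionally followed by a parenthesized tuple of terms; a literal is an atom possibly preceded by one or two occurrences of $\mathit{not}$; a comparison is $t_1\prec t_2$ with $\prec$ one of $=,\neq,<,>,\le,\ge$. An aggregate element is $\mathbf X:\mathbf L$ where $\mathbf X$ is a tuple of distinct variables and $\mathbf L$ is a conjunction of literals and comparisons in which every member of $\mathbf X$ occurs. An aggregate atom is $\mathit{count}\{E\}\ge t$ or $\mathit{count}\{E\}\le t$ with $E$ an aggregate element and $t$ a term not containing $..$. A rule is $\mathit{Head}\leftarrow\mathit{Body}$ where $\mathit{Body}$ is a (possibly empty) conjunction of literals, comparisons and aggregate atoms, and $\mathit{Head}$ is an atom (basic rule), an atom in braces (choice rule), or empty (constraint). A variable of a rule is local if each of its occurrences is inside an aggregate element, global otherwise; a rule is pure if for every aggregate element $\mathbf X:\mathbf L$ in its body all members of $\mathbf X$ are local. A program is a finite set of pure rules. Semantics. A precomputed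 atom is $p(\mathbf t)$ with all members of $\mathbf t$ precomputed terms. The semantics of mini-gringo with counting (Lifschitz 2022) uses a translation $\tau$ mapping each pure rule $R$ to an infinitary propositional formula $\tau R$ built from precomputed atoms (e.g. $q\leftarrow\mathit{count}\{X:p(X)\}\le 5$ becomes $(\bigwedge_{\Delta:|\Delta|>5}\neg\bigwedge_{x\in\Delta}p(x))\to q$, $\Delta$ ranging over finite sets of precomputed terms); $\tau\Pi$ is the conjunction of $\tau R$ over rules $R$ of $\Pi$. Stable models of $\Pi$ are the stable models of $\tau\Pi$ in the sense of Truszczyński (2012). Programs $\Pi_1,\Pi_2$ are strongly equivalent if for every set $\Phi$ of infinitary propositional formulas built from precomputed atoms, $\{\tau\Pi_1\}\cup\Phi$ and $\{\tau\Pi_2\}\cup\Phi$ have the same stable models. Signatures. Formulas are two-sorted, with sort general and its subsort integer; integer variables are written $I,J,K,M,N$ (possibly with indices); program variables are general variables. Signature $\sigma_0$: numerals as integer object constants; other precomputed terms as general object constants; $|\cdot|$ (unary) and $+,-,\times$ (binary) as function constants on the integer sort; for each symbolic constant $p$ and $n\ge0$ an $n$-ary predicate constant $p/n$ with general arguments ($(p/n)(\mathbf t)$ is written $p(\mathbf t)$); binary predicate constants $\neq,<,>,\le,\ge$ with general arguments ($=$ is logical equality). Signature $\sigma_1$ adds, for every pair of disjoint lists $\mathbf X,\mathbf V$ of distinct general variables and every formula $F$ over $\sigma_0$ whose free variables are among $\mathbf X,\mathbf V$, predicate constants $\mathit{Atleast}^{\mathbf X;\mathbf V}_F$ and $\mathit{Atmost}^{\mathbf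 X;\mathbf V}_F$ with $|\mathbf V|+1$ general arguments. Signature $\sigma_2$ adds, for the same $\mathbf X,\mathbf V,F$, predicate constants $\mathit{Start}^{\mathbf X;\mathbf V}_F$ with $|\mathbf X|+|\mathbf V|+1$ arguments, the last of sort integer and the others general. Translation $\tau^*$. For a program term $t$ and a general variable $Z$ not in $t$, the formula $\mathit{val}_t(Z)$ over $\sigma_0$ is defined recursively ($I,J,K$ fresh integer variables): if $t$ is a precomputed term or variable, $Z=t$; if $t=|t_1|$, $\exists I(\mathit{val}_{t_1}(I)\wedge Z=|I|)$; if $t=t_1\,op\,t_2$ with $op\in\{+,-,\times\}$, $\exists IJ(\mathit{val}_{t_1}(I)\wedge\mathit{val}_{t_2}(J)\wedge Z=I\,op\,J)$; if $t=t_1/t_2$, $\exists IJK(\mathit{val}_{t_1}(I)\wedge\mathit{val}_{t_2}(J)\wedge K\times|J|\le|I|<(K+\overline1)\times|J|\wedge((I\times J\ge\overline0\wedge Z=K)\vee(I\times J<\overline0\wedge Z=-K)))$; if $t=t_1\backslash t_2$, the same with $Z=I-K\times J$ and $Z=I+K\times J$ in place of $Z=K$ and $Z=-K$; if $t=t_1..t_2$, $\exists IJK(\mathit{val}_{t_1}(I)\wedge\mathit{val}_{t_2}(J)\wedge I\le K\le J\wedge Z=K)$. For tuples, $\mathit{val}_{\mathbf t}(\mathbf Z)$ is the conjunction of the componentwise formulas. With fresh general variables: $\tau^B(p(\mathbf t))=\exists\mathbf Z(\mathit{val}_{\mathbf t}(\mathbf Z)\wedge p(\mathbf Z))$; $\tau^B(\mathit{not}\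 p(\mathbf t))=\exists\mathbf Z(\mathit{val}_{\mathbf t}(\mathbf Z)\wedge\neg p(\mathbf Z))$; $\tau^B(\mathit{not}\ \mathit{not}\ p(\mathbf t))=\exists\mathbf Z(\mathit{val}_{\mathbf t}(\mathbf Z)\wedge\neg\neg p(\mathbf Z))$; $\tau^B(t_1\prec t_2)=\exists Z_1Z_2(\mathit{val}_{t_1}(Z_1)\wedge\mathit{val}_{t_2}(Z_2)\wedge Z_1\prec Z_2)$; $\tau^B$ of a conjunction is the conjunction of the $\tau^B$ of its members. For a body element $B$: $B^*=\tau^B(B)$ if $B$ is a literal or comparison; if $B$ is $\mathit{count}\{\mathbf X:\mathbf L\}\ge t$ then $B^*=\exists C(\mathit{val}_t(C)\wedge\mathit{Atleast}^{\mathbf X;\mathbf V}_{\exists\mathbf W\tau^B(\mathbf L)}(\mathbf V,C))$, and for $\le$ the same with $\mathit{Atmost}$, where $C$ is a fresh general variable, $\mathbf V$ is the list of global variables occurring in $\mathbf L$, and $\mathbf W$ the list of local variables occurring in $\mathbf L$ not in $\mathbf X$. For a rule $H\leftarrow B_1\wedge\dots\wedge B_n$, $\tau^*$ of the rule is the universal closure of $B_1^*\wedge\dots\wedge B_n^*\wedge\mathit{val}_{\mathbf t}(\mathbf Z)\to p(\mathbf Z)$ if $H$ is $p(\mathbf t)$; of $B_1^*\wedge\dots\wedge B_n^*\wedge\mathit{val}_{\mathbf t}(\mathbf Z)\to p(\mathbf Z)\vee\neg p(\mathbf Z)$ if $H$ is $\{p(\mathbf t)\}$; of $\neg(B_1^*\wedge\dots\wedge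 B_n^*)$ if $H$ is empty ($\mathbf Z$ fresh general variables). $\tau^*\Pi$ is the conjunction of $\tau^*R$ for $R\in\Pi$. System $\mathit{HT}_{\#}$. $F^X_t$ denotes substitution of $t$ for the free occurrences of $X$ in $F$. For equal-length tuples of general variables, $(X_1,\dots,X_m)<(U_1,\dots,U_m)$ abbreviates $\bigvee_{l=1}^m(X_l<U_l\wedge\bigwedge_{k=1}^{l-1}X_k=U_k)$. An interpretation of $\sigma_0$ is standard if its general domain is the set of precomputed terms, its integer domain the set of numerals, every object constant denotes itself, $|\cdot|,+,-,\times$ have their arithmetic meaning, and $\neq,<,>,\le,\ge$ are interpreted by the total order on precomputed terms. $\mathit{Std}$ is the set of sentences over $\sigma_0$ containing no predicate symbol $p/n$ that are satisfied by standard interpretations. $D_0$ consists of, for all $\mathbf X,\mathbf V,F$ as in the definition of $\sigma_2$ and $\mathbf U$ a list of distinct general variables of the length of $\mathbf X$ disjoint from $\mathbf X$ and $\mathbf V$: $\forall\mathbf X\mathbf VN(N\le\overline0\to\mathit{Start}^{\mathbf X;\mathbf V}_F(\mathbf X,\mathbf V,N))$; $\forall\mathbf X\mathbf V(\mathit{Start}^{\mathbf X;\mathbf V}_F(\mathbf X,\mathbf V,\overline1)\leftrightarrow F)$; $\forall\mathbf X\mathbf VN(N>\overline0\to(\mathit{Start}^{\mathbf X;\mathbf V}_F(\mathbf X,\mathbf V,N+\overline1)\leftrightarrow F\wedge\exists\mathbf U(\mathbf X<\mathbf U\wedge\mathit{Start}^{\mathbf X;\mathbf V}_F(\mathbf U,\mathbf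 V,N))))$. $D_1$ consists of $\forall\mathbf VY(\mathit{Atleast}^{\mathbf X;\mathbf V}_F(\mathbf V,Y)\leftrightarrow\exists\mathbf XN(\mathit{Start}^{\mathbf X;\mathbf V}_F(\mathbf X,\mathbf V,N)\wedge N\ge Y))$ and $\forall\mathbf VY(\mathit{Atmost}^{\mathbf X;\mathbf V}_F(\mathbf V,Y)\leftrightarrow\forall\mathbf XN(\mathit{Start}^{\mathbf X;\mathbf V}_F(\mathbf X,\mathbf V,N)\to N\le Y))$ ($Y$ a general variable). $\mathit{Ind}$ is the set of universal closures of $F^N_{\overline0}\wedge\forall N(N\ge\overline0\wedge F\to F^N_{N+\overline1})\to\forall N(N\ge\overline0\to F)$ for formulas $F$ over $\sigma_2$. $\mathit{HT}_{\#}$ is first-order intuitionistic logic with equality for the two-sorted signature $\sigma_2$, extended by all formulas $F\vee(F\to G)\vee\neg G$ and $\exists X(F\to\forall X\,F)$ ($F,G$ over $\sigma_2$, $X$ a variable of either sort), and by the axioms $\mathit{Std}$, $\mathit{Ind}$, $D_0$, $D_1$. -}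

module Defs where

open import Axiom.ExcludedMiddle using (ExcludedMiddle)
open import Data.Bool using (if_then_else_)
open import Data.Empty using (⊥-elim) renaming (⊥ to Empty)
open import Data.Fin using (Fin; inject; toℕ)
import Data.Integer as ℤ
open import Data.Integer using (ℤ; +_; ∣_∣; sign; _◃_)
open import Data.List using (List; []; _∷_; _++_; map; foldr; filter; deduplicate; length; concatMap; tabulate)
import Data.List.Membership.DecPropositional as DecMembership
open import Data.List.Membership.Propositional using (_∈_; _∉_)
open import Data.List.Membership.Propositional.Properties using (∈-++⁻; ∈-++⁺ˡ; ∈-++⁺ʳ; ∈-filter⁻; ∈-filter⁺; ∈-map⁺; ∈-map⁻; ∈-deduplicate⁺)
open import Data.List.Relation.Unary.All using (All; []; _∷_)
import Data.List.Relation.Unary.All as All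
import Data.List.Relation.Unary.All.Properties
open import Data.List.Relation.Unary.Any using (here; there)
open import Data.List.Relation.Unary.Unique.Propositional using (Unique)
import Data.List.Relation.Unary.Unique.DecPropositional.Properties as DecUnique
import Data.Nat as ℕ
open import Data.Nat using (ℕ)
import Data.Nat.DivMod as ℕ
open import Data.Product using (Σ; ∃; _×_; _,_; proj₁; proj₂)
import Data.Sign as Sign
open import Data.Sum using (_⊎_; inj₁; inj₂)
open import Data.Unit using () renaming (⊤ to Unit)
import Data.Vec as Vec
open import Data.Vec using (Vec; []; _∷_; fromList; lookup)
open import Data.Vec.Relation.Binary.Pointwise.Inductive using (Pointwise)
open import Function.Base using (_∘_)
open import Function.Bundles using (_⇔_)
open import Level using (0ℓ) renaming (suc to lsuc)
open import Relation.Binary.Core using (Rel)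
open import Relation.Binary.Definitions using (DecidableEquality)
open import Relation.Binary.PropositionalEquality using (_≡_; _≢_; refl; cong)
open import Relation.Binary.Structures using (IsTotalOrder)
open import Relation.Nullary using (yes; no; does; ¬?)
open import Relation.Unary using (Pred; _⊆_; _∪_; ｛_｝)

data Precomputed (Symbol Other : Set) : Set where
  num   : ℤ → Precomputed Symbol Other
  sym   : Symbol → Precomputed Symbol Other
  other : Other → Precomputed Symbol Other

record PrecomputedTerms : Set₁ where
  field
    Symbol Other : Set
    _≤_          : Rel (Precomputed Symbol Other) 0ℓ
    isTotalOrder : IsTotalOrder _≡_ _≤_
    num-order    : ∀ m n → num m ≤ num n ⇔ m ℤ.≤ n
    contiguous   : ∀ m n t → num m ≤ t → t ≤ num n → ∃ λ k → t ≡ num k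

data OrderRel : Set where
  ne lt gt le ge : OrderRel

data Comparison : Set where
  eq  : Comparison
  ord : OrderRel → Comparison

record Atom (Symbol A : Set) : Set where
  constructor _⟨_⟩
  field
    name    : Symbol
    {arity} : ℕ
    args    : Vec A arity

module Infinitary (A : Set) where

  infixr 5 _⇒_

  data InfFormula : Set₁ where
    atom : A → InfFormula
    ⊥    : InfFormula
    ⋀ ⋁  : {I : Set} → (I → InfFormula) → InfFormula
    _⇒_  : InfFormula → InfFormula → InfFormula

  ⊤ : InfFormula
  ⊤ = ⊥ ⇒ ⊥

  ¬_ : InfFormula → InfFormula
  ¬ F = F ⇒ ⊥

  _∨_ : InfFormula → InfFormula → InfFormula
  F ∨ G = ⋁ {Fin 2} (lookup (F ∷ G ∷ []))

  ⋀ˡ : List InfFormula → InfFormula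
  ⋀ˡ Fs = ⋀ (Data.List.lookup Fs)

  Interpretation : Set₁
  Interpretation = Pred A 0ℓ

  infix 4 _⊨_

  _⊨_ : Interpretation → InfFormula → Set
  I ⊨ atom a  = I a
  I ⊨ ⊥       = Empty
  I ⊨ ⋀ F     = ∀ i → I ⊨ F i
  I ⊨ ⋁ F     = ∃ λ i → I ⊨ F i
  I ⊨ (F ⇒ G) = I ⊨ F → I ⊨ G

  module Stable (em : ExcludedMiddle 0ℓ) where

    reduct : Interpretation → InfFormula → InfFormula
    reduct I (atom a) = if does (em {I a}) then atom a else ⊥
    reduct I ⊥        = ⊥
    reduct I (⋀ F)    = ⋀ (λ i → reduct I (F i))
    reduct I (⋁ F)    = ⋁ (λ i → reduct I (F i))
    reduct I (F ⇒ G)  = if does (em {I ⊨ (F ⇒ G)}) then reduct I F ⇒ reduct I G else ⊥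

    InfTheory : Set₂
    InfTheory = Pred InfFormula (lsuc 0ℓ)

    SatisfiesReduct : InfTheory → Interpretation → Interpretation → Set₁
    SatisfiesReduct Φ I J = ∀ F → Φ F → J ⊨ reduct I F

    IsStableModel : InfTheory → Interpretation → Set₁
    IsStableModel Φ I =
      SatisfiesReduct Φ I I × (∀ J → J ⊆ I → SatisfiesReduct Φ I J → I ⊆ J)

module MiniGringo (𝒯 : PrecomputedTerms) where

  open PrecomputedTerms 𝒯

  P : Set
  P = Precomputed Symbol Other

  ⟦_⟧ᵒ : OrderRel → P → P → Set
  ⟦ ne ⟧ᵒ a b = a ≢ b
  ⟦ lt ⟧ᵒ a b = a ≤ b × a ≢ b
  ⟦ gt ⟧ᵒ a b = b ≤ a × b ≢ a
  ⟦ le ⟧ᵒ a b = a ≤ b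
  ⟦ ge ⟧ᵒ a b = b ≤ a

  ⟦_⟧ᶜ : Comparison → P → P → Set
  ⟦ eq ⟧ᶜ a b    = a ≡ b
  ⟦ ord r ⟧ᶜ a b = ⟦ r ⟧ᵒ a b

  ProgVar : Set
  ProgVar = ℕ

  data Op : Set where
    add sub mul div mod interval : Op

  -- Term ProgVar is the type of program terms, Term Empty that of ground terms.
  data Term (V : Set) : Set where
    pre : P → Term V
    var : V → Term V
    abs : Term V → Term V
    bin : Op → Term V → Term V → Term V

  data Negations : Set where
    none not notnot : Negations

  -- A literal or a comparison.
  data Basic (V : Set) : Set where
    lit : Negations → Atom Symbol (Term V) → Basic V
    cmp : Comparison → Term V → Term V → Basic V

  vars : Term ProgVar → List ProgVar
  vars (pre _)     = []
  vars (var x)     = x ∷ []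
  vars (abs t)     = vars t
  vars (bin _ t u) = vars t ++ vars u

  varsⱽ : ∀ {n} → Vec (Term ProgVar) n → List ProgVar
  varsⱽ []       = []
  varsⱽ (t ∷ ts) = vars t ++ varsⱽ ts

  varsᴮ : Basic ProgVar → List ProgVar
  varsᴮ (lit _ (_ ⟨ ts ⟩)) = varsⱽ ts
  varsᴮ (cmp _ t u)        = vars t ++ vars u

  varsᴸ : List (Basic ProgVar) → List ProgVar
  varsᴸ = concatMap varsᴮ

  IntervalFree : ∀ {V} → Term V → Set
  IntervalFree (pre _)            = Unit
  IntervalFree (var _)            = Unit
  IntervalFree (abs t)            = IntervalFree t
  IntervalFree (bin interval _ _) = Empty
  IntervalFree (bin _ t u)        = IntervalFree t × IntervalFree u

  record AggregateElement : Set where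
    field
      X        : List ProgVar
      L        : List (Basic ProgVar)
      distinct : Unique X
      occur    : All (_∈ varsᴸ L) X

  data Bound : Set where
    atleast atmost : Bound

  record AggregateAtom : Set where
    field
      rel          : Bound
      element      : AggregateElement
      bound        : Term ProgVar
      intervalFree : IntervalFree bound
    open AggregateElement element public

  data BodyElement : Set where
    basic : Basic ProgVar → BodyElement
    count : AggregateAtom → BodyElement

  data Head : Set where
    basic choice : Atom Symbol (Term ProgVar) → Head
    constraint   : Head

  record Rule : Set where
    field
      head : Head
      body : List BodyElement

  varsᴴ : Head → List ProgVar
  varsᴴ (basic (_ ⟨ ts ⟩))  = varsⱽ ts
  varsᴴ (choice (_ ⟨ ts ⟩)) = varsⱽ ts
  varsᴴ constraint          = []

  -- Variables with an occurrence outside aggregate elements; the bound of an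
  -- aggregate atom is outside its aggregate element.
  outerVars : BodyElement → List ProgVar
  outerVars (basic b) = varsᴮ b
  outerVars (count a) = vars (AggregateAtom.bound a)

  globals : Rule → List ProgVar
  globals R = varsᴴ (Rule.head R) ++ concatMap outerVars (Rule.body R)

  -- PureIn G: the members of X are local when G lists the global variables.
  PureIn : List ProgVar → BodyElement → Set
  PureIn G (basic _) = Unit
  PureIn G (count a) = All (_∉ G) (AggregateAtom.X a)

  record PureRule : Set where
    field
      rule : Rule
      pure : All (PureIn (globals rule)) (Rule.body rule)
    open Rule rule public

  Program : Set
  Program = List PureRule

  open DecMembership ℕ._≟_ using (_∈?_; _∉?_)

  -- For an aggregate element X : L of a rule with global variables G, the
  -- lists 𝐕 of global variables in L and 𝐖 of local variables in L not in X.
  𝐕 : List ProgVar → AggregateAtom → List ProgVar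
  𝐕 G a = filter (_∈? G) (deduplicate ℕ._≟_ (varsᴸ (AggregateAtom.L a)))

  𝐖 : List ProgVar → AggregateAtom → List ProgVar
  𝐖 G a = filter (_∉? AggregateAtom.X a)
            (filter (_∉? G) (deduplicate ℕ._≟_ (varsᴸ (AggregateAtom.L a))))

  Assignment : Set
  Assignment = ProgVar → P

  _[_≔_] : Assignment → (xs : List ProgVar) → Vec P (length xs) → Assignment
  (ρ [ []     ≔ []     ]) y = ρ y
  (ρ [ x ∷ xs ≔ c ∷ cs ]) y = if does (y ℕ.≟ x) then c else (ρ [ xs ≔ cs ]) y

  inst : Assignment → Term ProgVar → Term Empty
  inst ρ (pre c)      = pre c
  inst ρ (var x)      = pre (ρ x)
  inst ρ (abs t)      = abs (inst ρ t)
  inst ρ (bin op t u) = bin op (inst ρ t) (inst ρ u)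

  instᴮ : Assignment → Basic ProgVar → Basic Empty
  instᴮ ρ (lit s (p ⟨ ts ⟩)) = lit s (p ⟨ Vec.map (inst ρ) ts ⟩)
  instᴮ ρ (cmp r t u)        = cmp r (inst ρ t) (inst ρ u)

  -- The quotient m / n rounded towards zero.
  round : (m n : ℤ) .{{_ : ℤ.NonZero n}} → ℤ
  round m n = (sign m Sign.* sign n) ◃ (∣ m ∣ ℕ./ ∣ n ∣)

  OpValue : Op → ℤ → ℤ → P → Set
  OpValue add      m n r = r ≡ num (m ℤ.+ n)
  OpValue sub      m n r = r ≡ num (m ℤ.- n)
  OpValue mul      m n r = r ≡ num (m ℤ.* n)
  OpValue div      m n r = Σ (ℤ.NonZero n) λ nz → r ≡ num (round m n {{nz}})
  OpValue mod      m n r = Σ (ℤ.NonZero n) λ nz → r ≡ num (m ℤ.- n ℤ.* round m n {{nz}})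
  OpValue interval m n r = ∃ λ k → m ℤ.≤ k × k ℤ.≤ n × r ≡ num k

  [_] : Term Empty → Pred P 0ℓ
  [ pre c ] r      = r ≡ c
  [ abs t ] r      = ∃ λ n → [ t ] (num n) × r ≡ num (+ ∣ n ∣)
  [ bin op t u ] r = ∃ λ m → ∃ λ n → [ t ] (num m) × [ u ] (num n) × OpValue op m n r

  [_]ⱽ : ∀ {n} → Vec (Term Empty) n → Pred (Vec P n) 0ℓ
  [ ts ]ⱽ rs = Pointwise (λ t r → [ t ] r) ts rs

  FiniteSet : Set → Set
  FiniteSet A = Σ (List A) Unique

  -- The translation τ consults em only to decide whether a ground comparison
  -- holds, the reduct to decide whether its argument is satisfied.
  module Semantics (em : ExcludedMiddle 0ℓ) where

    open Infinitary (Atom Symbol P)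
    open Stable em

    negated : Negations → InfFormula → InfFormula
    negated none   F = F
    negated not    F = ¬ F
    negated notnot F = ¬ (¬ F)

    τ-basic : Basic Empty → InfFormula
    τ-basic (lit s (p ⟨ ts ⟩)) = ⋁ {∃ [ ts ]ⱽ} λ (r , _) → negated s (atom (p ⟨ r ⟩))
    τ-basic (cmp c t u)        =
      if does (em {∃ λ r → ∃ λ s → [ t ] r × [ u ] s × ⟦ c ⟧ᶜ r s}) then ⊤ else ⊥

    τ-conj : List (Basic Empty) → InfFormula
    τ-conj L = ⋀ˡ (map τ-basic L)

    module _ (G : List ProgVar) (ρ : Assignment) where

      module _ (a : AggregateAtom) where
        open AggregateAtom a

        Tuple : Set
        Tuple = Vec P (length X)

        holdsFor : Tuple → InfFormula
        holdsFor x = ⋁ {Vec P (length (𝐖 G a))} λ w →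
          τ-conj (map (instᴮ ((ρ [ X ≔ x ]) [ 𝐖 G a ≔ w ])) L)

        holdsForAll : FiniteSet Tuple → InfFormula
        holdsForAll (Δ , _) = ⋀ {∃ (_∈ Δ)} λ (x , _) → holdsFor x

        size : FiniteSet Tuple → P
        size (Δ , _) = num (+ length Δ)

        τ-count : Bound → P → InfFormula
        τ-count atleast c = ⋁ {∃ λ Δ → ⟦ ge ⟧ᵒ (size Δ) c} λ (Δ , _) → holdsForAll Δ
        τ-count atmost  c = ⋀ {∃ λ Δ → ⟦ gt ⟧ᵒ (size Δ) c} λ (Δ , _) → ¬ holdsForAll Δ

      -- As the bound is interval-free, it has at most one value c; the atom
      -- is false if there is none.
      τ-element : BodyElement → InfFormula
      τ-element (basic b) = τ-basic (instᴮ ρ b)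
      τ-element (count a) = ⋁ {∃ [ inst ρ (AggregateAtom.bound a) ]} λ (c , _) →
        τ-count a (AggregateAtom.rel a) c

      τ-body : List BodyElement → InfFormula
      τ-body Bs = ⋀ˡ (map τ-element Bs)

    τ-instance : Rule → Assignment → InfFormula
    τ-instance R ρ = go (Rule.head R)
      where
      Body : InfFormula
      Body = τ-body (globals R) ρ (Rule.body R)

      go : Head → InfFormula
      go (basic (p ⟨ ts ⟩))  = Body ⇒ ⋀ {∃ [ Vec.map (inst ρ) ts ]ⱽ} λ (r , _) → atom (p ⟨ r ⟩)
      go (choice (p ⟨ ts ⟩)) = Body ⇒ ⋀ {∃ [ Vec.map (inst ρ) ts ]ⱽ} λ (r , _) →
                                 atom (p ⟨ r ⟩) ∨ (¬ atom (p ⟨ r ⟩))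
      go constraint          = ¬ Body

    -- τ-instance R ρ depends only on the values of ρ at the global variables of R.
    τᴿ : Rule → InfFormula
    τᴿ R = ⋀ (τ-instance R)

    τ : Program → InfFormula
    τ Π = ⋀ˡ (map (τᴿ ∘ PureRule.rule) Π)

    StronglyEquivalent : Program → Program → Set₂
    StronglyEquivalent Π₁ Π₂ = ∀ (Φ : InfTheory) I →
      IsStableModel (｛ τ Π₁ ｝ ∪ Φ) I ⇔ IsStableModel (｛ τ Π₂ ｝ ∪ Φ) I

  data Sort : Set where
    gen int : Sort

  -- prog x are the program variables; the variables aux i occur in no
  -- program and serve as fresh general variables.
  data Var : Sort → Set where
    prog : ProgVar → Var gen
    aux  : ℕ → Var gen
    ivar : ℕ → Var int

  AnyVar : Set
  AnyVar = ∃ Var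

  anyVar : ∀ {s} → Var s → AnyVar
  anyVar {s} x = s , x

  _≟ⱽ_ : DecidableEquality AnyVar
  (_ , prog x) ≟ⱽ (_ , prog y) with x ℕ.≟ y
  ... | yes refl = yes refl
  ... | no x≢y   = no λ { refl → x≢y refl }
  (_ , aux x) ≟ⱽ (_ , aux y) with x ℕ.≟ y
  ... | yes refl = yes refl
  ... | no x≢y   = no λ { refl → x≢y refl }
  (_ , ivar x) ≟ⱽ (_ , ivar y) with x ℕ.≟ y
  ... | yes refl = yes refl
  ... | no x≢y   = no λ { refl → x≢y refl }
  (_ , prog _) ≟ⱽ (_ , aux _)  = no λ ()
  (_ , prog _) ≟ⱽ (_ , ivar _)  = no λ ()
  (_ , aux _)  ≟ⱽ (_ , prog _) = no λ ()
  (_ , aux _)  ≟ⱽ (_ , ivar _)  = no λ ()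
  (_ , ivar _)  ≟ⱽ (_ , prog _) = no λ ()
  (_ , ivar _)  ≟ⱽ (_ , aux _)  = no λ ()

  infixl 9  _+ᵗ_ _-ᵗ_
  infixl 10 _×ᵗ_

  data Tm : Sort → Set where
    var            : ∀ {s} → Var s → Tm s
    numeral        : ℤ → Tm int
    sym            : Symbol → Tm gen
    other          : Other → Tm gen
    ∣_∣ᵗ           : Tm int → Tm int
    _+ᵗ_ _-ᵗ_ _×ᵗ_ : Tm int → Tm int → Tm int
    ↑_             : Tm int → Tm gen

  asGen : ∀ {s} → Tm s → Tm gen
  asGen {gen} t = t
  asGen {int} t = ↑ t

  fvᵗ : ∀ {s} → Tm s → List AnyVar
  fvᵗ (var x)     = (_ , x) ∷ []
  fvᵗ (numeral _) = []
  fvᵗ (sym _)     = []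
  fvᵗ (other _)   = []
  fvᵗ ∣ t ∣ᵗ      = fvᵗ t
  fvᵗ (t +ᵗ u)    = fvᵗ t ++ fvᵗ u
  fvᵗ (t -ᵗ u)    = fvᵗ t ++ fvᵗ u
  fvᵗ (t ×ᵗ u)    = fvᵗ t ++ fvᵗ u
  fvᵗ (↑ t)       = fvᵗ t

  fvⱽ : ∀ {s n} → Vec (Tm s) n → List AnyVar
  fvⱽ []       = []
  fvⱽ (t ∷ ts) = fvᵗ t ++ fvⱽ ts

  _[_≔_]ᵗ : ∀ {s s′} → Tm s′ → Var s → Tm s → Tm s′
  var y [ x ≔ t ]ᵗ with (_ , y) ≟ⱽ (_ , x)
  ... | yes refl = t
  ... | no _     = var y
  numeral n [ x ≔ t ]ᵗ = numeral n
  sym c [ x ≔ t ]ᵗ     = sym c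
  other c [ x ≔ t ]ᵗ   = other c
  ∣ u ∣ᵗ [ x ≔ t ]ᵗ    = ∣ u [ x ≔ t ]ᵗ ∣ᵗ
  (u +ᵗ v) [ x ≔ t ]ᵗ  = (u [ x ≔ t ]ᵗ) +ᵗ (v [ x ≔ t ]ᵗ)
  (u -ᵗ v) [ x ≔ t ]ᵗ  = (u [ x ≔ t ]ᵗ) -ᵗ (v [ x ≔ t ]ᵗ)
  (u ×ᵗ v) [ x ≔ t ]ᵗ  = (u [ x ≔ t ]ᵗ) ×ᵗ (v [ x ≔ t ]ᵗ)
  (↑ u) [ x ≔ t ]ᵗ     = ↑ (u [ x ≔ t ]ᵗ)

  -- The signatures considered differ in their predicate constants only. A
  -- predicate constant takes general arguments followed by integer ones.
  record Signature : Set₁ where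
    field
      PredConst : Set
      gens ints : PredConst → ℕ

  open Signature

  infixr 5 _⇒_
  infixr 6 _∨_
  infixr 7 _∧_
  infix  8 _≐_

  data Formula (σ : Signature) : Set where
    atom        : (p : PredConst σ) → Vec (Tm gen) (gens σ p) → Vec (Tm int) (ints σ p) → Formula σ
    _≐_         : Tm gen → Tm gen → Formula σ
    ⊥           : Formula σ
    _∧_ _∨_ _⇒_ : Formula σ → Formula σ → Formula σ
    all ex      : ∀ {s} → Var s → Formula σ → Formula σ

  module _ {σ : Signature} where

    infix 4 _⇔ᶠ_

    ⊤ : Formula σ
    ⊤ = ⊥ ⇒ ⊥

    ¬ᶠ_ : Formula σ → Formula σ
    ¬ᶠ F = F ⇒ ⊥

    _⇔ᶠ_ : Formula σ → Formula σ → Formula σ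
    F ⇔ᶠ G = (F ⇒ G) ∧ (G ⇒ F)

    ⋀ ⋁ : List (Formula σ) → Formula σ
    ⋀ = foldr _∧_ ⊤
    ⋁ = foldr _∨_ ⊥

    all* ex* : ∀ {s} → List (Var s) → Formula σ → Formula σ
    all* xs F = foldr all F xs
    ex*  xs F = foldr ex F xs

    fv : Formula σ → List AnyVar
    fv (atom _ ts us) = fvⱽ ts ++ fvⱽ us
    fv (t ≐ u)        = fvᵗ t ++ fvᵗ u
    fv ⊥              = []
    fv (F ∧ G)        = fv F ++ fv G
    fv (F ∨ G)        = fv F ++ fv G
    fv (F ⇒ G)        = fv F ++ fv G
    fv (all x F)      = filter (λ y → ¬? (y ≟ⱽ (_ , x))) (fv F)
    fv (ex x F)       = filter (λ y → ¬? (y ≟ⱽ (_ , x))) (fv F)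

    Sentence : Formula σ → Set
    Sentence F = fv F ≡ []

    closure : Formula σ → Formula σ
    closure F = foldr (λ (_ , x) → all x) F (deduplicate _≟ⱽ_ (fv F))

    -- Replaces the free occurrences of x, without renaming bound variables.
    _[_≔_]ᶠ : ∀ {s} → Formula σ → Var s → Tm s → Formula σ
    atom p ts us [ x ≔ t ]ᶠ = atom p (Vec.map (_[ x ≔ t ]ᵗ) ts) (Vec.map (_[ x ≔ t ]ᵗ) us)
    (u ≐ v) [ x ≔ t ]ᶠ      = (u [ x ≔ t ]ᵗ) ≐ (v [ x ≔ t ]ᵗ)
    ⊥ [ x ≔ t ]ᶠ            = ⊥
    (F ∧ G) [ x ≔ t ]ᶠ      = (F [ x ≔ t ]ᶠ) ∧ (G [ x ≔ t ]ᶠ)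
    (F ∨ G) [ x ≔ t ]ᶠ      = (F [ x ≔ t ]ᶠ) ∨ (G [ x ≔ t ]ᶠ)
    (F ⇒ G) [ x ≔ t ]ᶠ      = (F [ x ≔ t ]ᶠ) ⇒ (G [ x ≔ t ]ᶠ)
    all y F [ x ≔ t ]ᶠ      = all y (if does ((_ , y) ≟ⱽ (_ , x)) then F else F [ x ≔ t ]ᶠ)
    ex y F [ x ≔ t ]ᶠ       = ex y (if does ((_ , y) ≟ⱽ (_ , x)) then F else F [ x ≔ t ]ᶠ)

    -- The term t is free for x in the formula: no variable of t is captured
    -- when t replaces the free occurrences of x.
    FreeFor : ∀ {s} → Tm s → Var s → Formula σ → Set
    FreeFor t x (atom _ _ _) = Unit
    FreeFor t x (_ ≐ _)      = Unit
    FreeFor t x ⊥            = Unit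
    FreeFor t x (F ∧ G)      = FreeFor t x F × FreeFor t x G
    FreeFor t x (F ∨ G)      = FreeFor t x F × FreeFor t x G
    FreeFor t x (F ⇒ G)      = FreeFor t x F × FreeFor t x G
    FreeFor t x (all y F)    = (_ , x) ∉ fv (all y F) ⊎ ((_ , y) ∉ fvᵗ t × FreeFor t x F)
    FreeFor t x (ex y F)     = (_ , x) ∉ fv (ex y F) ⊎ ((_ , y) ∉ fvᵗ t × FreeFor t x F)

  data Pred₀ : Set where
    _/_ : Symbol → ℕ → Pred₀
    ord : OrderRel → Pred₀

  σ₀ : Signature
  σ₀ .PredConst      = Pred₀
  σ₀ .gens (_ / n)   = n
  σ₀ .gens (ord _)   = 2
  σ₀ .ints _         = 0

  -- The indices X; V and F of the predicate constants Atleast, Atmost, Start.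
  -- The proofs are irrelevant, so that X, V, F determine the constant.
  record CountIndex : Set where
    field
      X V       : List (Var gen)
      F         : Formula σ₀
      .distinct : Unique (X ++ V)
      .scoped   : All (_∈ map anyVar (X ++ V)) (fv F)

  open CountIndex using (X; V; F)

  data Pred₂ : Set where
    base                 : Pred₀ → Pred₂
    Atleast Atmost Start : CountIndex → Pred₂

  -- The formulas over σ₁ are those in which Start does not occur.
  σ₂ : Signature
  σ₂ .PredConst        = Pred₂
  σ₂ .gens (base p)    = gens σ₀ p
  σ₂ .gens (Atleast c) = length (V c) ℕ.+ 1
  σ₂ .gens (Atmost c)  = length (V c) ℕ.+ 1
  σ₂ .gens (Start c)   = length (X c) ℕ.+ length (V c)
  σ₂ .ints (base p)    = ints σ₀ p
  σ₂ .ints (Atleast c) = 0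
  σ₂ .ints (Atmost c)  = 0
  σ₂ .ints (Start c)   = 1

  ⌈_⌉ : Formula σ₀ → Formula σ₂
  ⌈ atom p ts us ⌉ = atom (base p) ts us
  ⌈ t ≐ u ⌉        = t ≐ u
  ⌈ ⊥ ⌉            = ⊥
  ⌈ F ∧ G ⌉        = ⌈ F ⌉ ∧ ⌈ G ⌉
  ⌈ F ∨ G ⌉        = ⌈ F ⌉ ∨ ⌈ G ⌉
  ⌈ F ⇒ G ⌉        = ⌈ F ⌉ ⇒ ⌈ G ⌉
  ⌈ all x F ⌉      = all x ⌈ F ⌉
  ⌈ ex x F ⌉       = ex x ⌈ F ⌉

  rel : OrderRel → Tm gen → Tm gen → Formula σ₀
  rel r t u = atom (ord r) (t ∷ u ∷ []) []

  compare : Comparison → Tm gen → Tm gen → Formula σ₀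
  compare eq      t u = t ≐ u
  compare (ord r) t u = rel r t u

  constant : P → Tm gen
  constant (num n)   = ↑ numeral n
  constant (sym c)   = sym c
  constant (other c) = other c

  quotient : (I J K : Tm int) → Formula σ₀
  quotient I J K = rel le (↑ (K ×ᵗ ∣ J ∣ᵗ)) (↑ ∣ I ∣ᵗ)
                 ∧ rel lt (↑ ∣ I ∣ᵗ) (↑ ((K +ᵗ numeral (+ 1)) ×ᵗ ∣ J ∣ᵗ))

  bySign : (Z : Tm gen) (I J A B : Tm int) → Formula σ₀
  bySign Z I J A B = (rel ge (↑ (I ×ᵗ J)) (↑ numeral (+ 0)) ∧ Z ≐ ↑ A)
                   ∨ (rel lt (↑ (I ×ᵗ J)) (↑ numeral (+ 0)) ∧ Z ≐ ↑ B)

  -- As the signature has no unary minus, -K is expressed by 0 - K.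
  val-op : Op → (Z : Tm gen) (I J K : Tm int) → Formula σ₀
  val-op add      Z I J K = Z ≐ ↑ (I +ᵗ J)
  val-op sub      Z I J K = Z ≐ ↑ (I -ᵗ J)
  val-op mul      Z I J K = Z ≐ ↑ (I ×ᵗ J)
  val-op div      Z I J K = quotient I J K ∧ bySign Z I J K (numeral (+ 0) -ᵗ K)
  val-op mod      Z I J K = quotient I J K ∧ bySign Z I J (I -ᵗ K ×ᵗ J) (I +ᵗ K ×ᵗ J)
  val-op interval Z I J K = (rel le (↑ I) (↑ K) ∧ rel le (↑ K) (↑ J)) ∧ Z ≐ ↑ K

  -- K is quantified only for the operations whose val-op mentions it.
  opVars : Op → (i j k : Var int) → List (Var int)
  opVars add      i j k = i ∷ j ∷ []
  opVars sub      i j k = i ∷ j ∷ []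
  opVars mul      i j k = i ∷ j ∷ []
  opVars div      i j k = i ∷ j ∷ k ∷ []
  opVars mod      i j k = i ∷ j ∷ k ∷ []
  opVars interval i j k = i ∷ j ∷ k ∷ []

  -- val n t Z binds only integer variables with indices n and higher; it is
  -- applied to terms Z in which these do not occur.
  val : ℕ → Term ProgVar → Tm gen → Formula σ₀
  val n (pre c) Z = Z ≐ constant c
  val n (var x) Z = Z ≐ var (prog x)
  val n (abs t) Z = ex i (val (1 ℕ.+ n) t (↑ var i) ∧ Z ≐ ↑ ∣ var i ∣ᵗ)
    where i = ivar n
  val n (bin op t u) Z =
    ex* (opVars op i j k)
      (val (3 ℕ.+ n) t (↑ var i) ∧ val (3 ℕ.+ n) u (↑ var j) ∧ val-op op Z (var i) (var j) (var k))
    where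
    i = ivar n
    j = ivar (1 ℕ.+ n)
    k = ivar (2 ℕ.+ n)

  valⱽ : ∀ {n} → Vec (Term ProgVar) n → Vec (Tm gen) n → Formula σ₀
  valⱽ []       []       = ⊤
  valⱽ (t ∷ ts) (Z ∷ Zs) = val 0 t Z ∧ valⱽ ts Zs

  auxs : ∀ n → Vec (Var gen) n
  auxs n = Vec.tabulate (λ i → aux (toℕ i))

  negatedᶠ : ∀ {σ} → Negations → Formula σ → Formula σ
  negatedᶠ none   F = F
  negatedᶠ not    F = ¬ᶠ F
  negatedᶠ notnot F = ¬ᶠ (¬ᶠ F)

  τᴮ : Basic ProgVar → Formula σ₀
  τᴮ (lit s (_⟨_⟩ p {n} ts)) =
    ex* (Vec.toList (auxs n))
      (valⱽ ts (Vec.map var (auxs n)) ∧ negatedᶠ s (atom (p / n) (Vec.map var (auxs n)) []))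
  τᴮ (cmp c t u) =
    ex (aux 0) (ex (aux 1)
      (val 0 t (var (aux 0)) ∧ val 0 u (var (aux 1)) ∧ compare c (var (aux 0)) (var (aux 1))))

  τᴸ : List (Basic ProgVar) → Formula σ₀
  τᴸ L = ⋀ (map τᴮ L)

  subscript : List ProgVar → AggregateAtom → Formula σ₀
  subscript G a = ex* (map prog (𝐖 G a)) (τᴸ (AggregateAtom.L a))

  progs : List ProgVar → List AnyVar
  progs = map (λ x → gen , prog x)

  module Scoping where

    module A = Data.List.Relation.Unary.All.Properties

    module _ {Q : Pred AnyVar 0ℓ} where

      bind : ∀ {s} (x : Var s) (F : Formula σ₀) → All (λ y → y ≡ (_ , x) ⊎ Q y) (fv F) → All Q (fv (ex x F))
      bind x F h = All.tabulate λ {y} y∈ →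
        let (y∈F , y≢x) = ∈-filter⁻ (λ y → ¬? (y ≟ⱽ (_ , x))) {xs = fv F} y∈ in
        drop y≢x (All.lookup h y∈F)
        where
        drop : ∀ {y} → (y ≢ (_ , x)) → y ≡ (_ , x) ⊎ Q y → Q y
        drop n (inj₁ e) = ⊥-elim (n e)
        drop n (inj₂ q) = q

    binds : ∀ {Q : Pred AnyVar 0ℓ} {s} (xs : List (Var s)) (F : Formula σ₀) →
            All (λ y → y ∈ map anyVar xs ⊎ Q y) (fv F) → All Q (fv (ex* xs F))
    binds []           F h = All.map (λ { (inj₂ q) → q }) h
    binds {Q} (x ∷ xs) F h = bind x (ex* xs F) (binds xs F (All.map shift h))
      where
      shift : ∀ {y} → y ∈ map anyVar (x ∷ xs) ⊎ Q y →
              y ∈ map anyVar xs ⊎ (y ≡ (_ , x) ⊎ Q y)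
      shift (inj₁ (here e))  = inj₂ (inj₁ e)
      shift (inj₁ (there m)) = inj₁ m
      shift (inj₂ q)         = inj₂ (inj₂ q)

    module _ {Q : Pred AnyVar 0ℓ} where

      fv-constant : ∀ c → All Q (fvᵗ (constant c))
      fv-constant (num _)   = []
      fv-constant (sym _)   = []
      fv-constant (other _) = []

      fv-compare : ∀ c {t u} → All Q (fvᵗ t) → All Q (fvᵗ u) → All Q (fv (compare c t u))
      fv-compare eq      p q = A.++⁺ p q
      fv-compare (ord r) {t} {u} p q = A.++⁺ {xs = fvᵗ t ++ fvᵗ u ++ []} (A.++⁺ p (A.++⁺ q [])) []

    fv-op : ∀ {Q : Pred AnyVar 0ℓ} op {Z} {i j k : Var int} →
            (∀ {y} → y ∈ map anyVar (opVars op i j k) → Q y) → All Q (fvᵗ Z) →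
            All Q (fv (val-op op Z (var i) (var j) (var k)))
    fv-op add q z = A.++⁺ z (q (here refl) ∷ q (there (here refl)) ∷ [])
    fv-op sub q z = A.++⁺ z (q (here refl) ∷ q (there (here refl)) ∷ [])
    fv-op mul q z = A.++⁺ z (q (here refl) ∷ q (there (here refl)) ∷ [])
    fv-op div q z =
      k ∷ j ∷ i ∷ i ∷ k ∷ j ∷ i ∷ j ∷ A.++⁺ (A.++⁺ z (k ∷ [])) (i ∷ j ∷ A.++⁺ z (k ∷ []))
      where
      i = q (here refl)
      j = q (there (here refl))
      k = q (there (there (here refl)))
    fv-op mod q z =
      k ∷ j ∷ i ∷ i ∷ k ∷ j ∷ i ∷ j ∷
      A.++⁺ (A.++⁺ z (i ∷ k ∷ j ∷ [])) (i ∷ j ∷ A.++⁺ z (i ∷ k ∷ j ∷ []))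
      where
      i = q (here refl)
      j = q (there (here refl))
      k = q (there (there (here refl)))
    fv-op interval q z = i ∷ k ∷ k ∷ j ∷ A.++⁺ z (k ∷ [])
      where
      i = q (here refl)
      j = q (there (here refl))
      k = q (there (there (here refl)))

    i∈ : ∀ op {i j k : Var int} → (int , i) ∈ map anyVar (opVars op i j k)
    i∈ add      = here refl
    i∈ sub      = here refl
    i∈ mul      = here refl
    i∈ div      = here refl
    i∈ mod      = here refl
    i∈ interval = here refl

    j∈ : ∀ op {i j k : Var int} → (int , j) ∈ map anyVar (opVars op i j k)
    j∈ add      = there (here refl)
    j∈ sub      = there (here refl)
    j∈ mul      = there (here refl)
    j∈ div      = there (here refl)
    j∈ mod      = there (here refl)
    j∈ interval = there (here refl)

    fv-val : ∀ {Q : Pred AnyVar 0ℓ} n t {Z} → All Q (fvᵗ Z) → (∀ {x} → x ∈ vars t → Q (gen , prog x)) →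
             All Q (fv (val n t Z))
    fv-val n (pre c) z q = A.++⁺ z (fv-constant c)
    fv-val n (var x) z q = A.++⁺ z (q (here refl) ∷ [])
    fv-val n (abs t) {Z} z q =
      bind (ivar n) (val (1 ℕ.+ n) t (↑ var (ivar n)) ∧ Z ≐ ↑ ∣ var (ivar n) ∣ᵗ)
        (A.++⁺ (fv-val (1 ℕ.+ n) t (inj₁ refl ∷ []) (inj₂ ∘ q))
               (A.++⁺ (All.map inj₂ z) (inj₁ refl ∷ [])))
    fv-val n (bin op t u) {Z} z q =
      binds (opVars op i j k)
        (val (3 ℕ.+ n) t (↑ var i) ∧ val (3 ℕ.+ n) u (↑ var j) ∧ val-op op Z (var i) (var j) (var k))
        (A.++⁺ (fv-val (3 ℕ.+ n) t (inj₁ (i∈ op) ∷ []) (inj₂ ∘ q ∘ ∈-++⁺ˡ))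
        (A.++⁺ (fv-val (3 ℕ.+ n) u (inj₁ (j∈ op) ∷ []) (inj₂ ∘ q ∘ ∈-++⁺ʳ (vars t)))
               (fv-op op inj₁ (All.map inj₂ z))))
      where
      i = ivar n
      j = ivar (1 ℕ.+ n)
      k = ivar (2 ℕ.+ n)

    fv-valⱽ : ∀ {Q : Pred AnyVar 0ℓ} {n} (ts : Vec (Term ProgVar) n) {Zs : Vec (Tm gen) n} →
              All Q (fvⱽ Zs) → (∀ {x} → x ∈ varsⱽ ts → Q (gen , prog x)) → All Q (fv (valⱽ ts Zs))
    fv-valⱽ []       {[]}     z q = []
    fv-valⱽ (t ∷ ts) {Z ∷ Zs} z q =
      A.++⁺ (fv-val 0 t (A.++⁻ˡ (fvᵗ Z) z) (q ∘ ∈-++⁺ˡ))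
            (fv-valⱽ ts (A.++⁻ʳ (fvᵗ Z) z) (q ∘ ∈-++⁺ʳ (vars t)))

    fv-vars : ∀ {n} (xs : Vec (Var gen) n) → fvⱽ (Vec.map var xs) ≡ map anyVar (Vec.toList xs)
    fv-vars []       = refl
    fv-vars (x ∷ xs) = cong (_ ∷_) (fv-vars xs)

    fv-negated : ∀ {Q : Pred AnyVar 0ℓ} s {F : Formula σ₀} → All Q (fv F) → All Q (fv (negatedᶠ s F))
    fv-negated none   h = h
    fv-negated not    h = A.++⁺ h []
    fv-negated notnot h = A.++⁺ (A.++⁺ h []) []

    fv-τᴮ : ∀ {Q : Pred AnyVar 0ℓ} B → (∀ {x} → x ∈ varsᴮ B → Q (gen , prog x)) → All Q (fv (τᴮ B))
    fv-τᴮ {Q} (lit s (_⟨_⟩ p {n} ts)) q =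
      binds (Vec.toList (auxs n)) _
        (A.++⁺ (fv-valⱽ ts zs (inj₂ ∘ q)) (fv-negated s (A.++⁺ zs [])))
      where
      zs : All (λ y → y ∈ map anyVar (Vec.toList (auxs n)) ⊎ Q y) (fvⱽ (Vec.map var (auxs n)))
      zs rewrite fv-vars (auxs n) = All.tabulate inj₁
    fv-τᴮ (cmp c t u) q =
      bind (aux 0) (ex (aux 1) H)
        (bind (aux 1) H
          (A.++⁺ (fv-val 0 t (inj₂ (inj₁ refl) ∷ []) (inj₂ ∘ inj₂ ∘ q ∘ ∈-++⁺ˡ))
          (A.++⁺ (fv-val 0 u (inj₁ refl ∷ []) (inj₂ ∘ inj₂ ∘ q ∘ ∈-++⁺ʳ (vars t)))
                 (fv-compare c (inj₂ (inj₁ refl) ∷ []) (inj₁ refl ∷ [])))))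
      where
      H = val 0 t (var (aux 0)) ∧ val 0 u (var (aux 1)) ∧ compare c (var (aux 0)) (var (aux 1))

    fv-τᴸ : ∀ {Q : Pred AnyVar 0ℓ} L → (∀ {x} → x ∈ varsᴸ L → Q (gen , prog x)) → All Q (fv (τᴸ L))
    fv-τᴸ []      q = []
    fv-τᴸ (B ∷ L) q = A.++⁺ (fv-τᴮ B (q ∘ ∈-++⁺ˡ)) (fv-τᴸ L (q ∘ ∈-++⁺ʳ (varsᴮ B)))

    module _ (G : List ProgVar) (a : AggregateAtom) where
      open AggregateAtom a renaming (X to Xs)

      split : ∀ {x} → x ∈ varsᴸ L → x ∈ 𝐖 G a ⊎ x ∈ Xs ++ 𝐕 G a
      split {x} x∈ with x ∈? G
      ... | yes x∈G = inj₂ (∈-++⁺ʳ Xs (∈-filter⁺ (_∈? G) (∈-deduplicate⁺ ℕ._≟_ x∈) x∈G))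
      ... | no x∉G with x ∈? Xs
      ...   | yes x∈X = inj₂ (∈-++⁺ˡ x∈X)
      ...   | no x∉X  = inj₁ (∈-filter⁺ (_∉? Xs) (∈-filter⁺ (_∉? G) (∈-deduplicate⁺ ℕ._≟_ x∈) x∉G) x∉X)

      pairs : ∀ xs → progs xs ≡ map anyVar (map prog xs)
      pairs []       = refl
      pairs (x ∷ xs) = cong (_ ∷_) (pairs xs)

      subscript-scoped : All (_∈ map anyVar (map prog Xs ++ map prog (𝐕 G a))) (fv (subscript G a))
      subscript-scoped = binds (map prog (𝐖 G a)) (τᴸ L) (fv-τᴸ L λ x∈ → place (split x∈))
        where
        place : ∀ {x} → x ∈ 𝐖 G a ⊎ x ∈ Xs ++ 𝐕 G a →
                (gen , prog x) ∈ map anyVar (map prog (𝐖 G a)) ⊎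
                (gen , prog x) ∈ map anyVar (map prog Xs ++ map prog (𝐕 G a))
        place (inj₁ x∈W) = inj₁ (∈-map⁺ _ (∈-map⁺ _ x∈W))
        place (inj₂ x∈) with ∈-++⁻ Xs x∈
        ... | inj₁ x∈X = inj₂ (∈-map⁺ _ (∈-++⁺ˡ (∈-map⁺ _ x∈X)))
        ... | inj₂ x∈V = inj₂ (∈-map⁺ _ (∈-++⁺ʳ (map prog Xs) (∈-map⁺ _ x∈V)))

      subscript-distinct : All (_∉ G) Xs → Unique (map prog Xs ++ map prog (𝐕 G a))
      subscript-distinct pure =
        ++⁺ (map⁺ prog-injective distinct)
            (map⁺ prog-injective (filter⁺ (_∈? G) (deduplicate-! (varsᴸ L))))
            disjoint
        where
        open DecUnique ℕ._≟_

        prog-injective : ∀ {x y} → prog x ≡ prog y → x ≡ y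
        prog-injective refl = refl

        disjoint : ∀ {y} → y ∈ map prog Xs × y ∈ map prog (𝐕 G a) → Empty
        disjoint (y∈X , y∈V) with ∈-map⁻ prog y∈X | ∈-map⁻ prog y∈V
        ... | x , x∈X , refl | .x , x∈V , refl =
          All.lookup pure x∈X (proj₂ (∈-filter⁻ (_∈? G) {xs = deduplicate ℕ._≟_ (varsᴸ L)} x∈V))

  countIndex : (G : List ProgVar) (a : AggregateAtom) → PureIn G (count a) → CountIndex
  countIndex G a pure = record
    { X        = map prog (AggregateAtom.X a)
    ; V        = map prog (𝐕 G a)
    ; F        = subscript G a
    ; distinct = Scoping.subscript-distinct G a pure
    ; scoped   = Scoping.subscript-scoped G a
    }

  vars↑ : (xs : List (Var gen)) → Vec (Tm gen) (length xs)
  vars↑ xs = Vec.map var (fromList xs)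

  boundPred : Bound → CountIndex → Tm gen → Formula σ₂
  boundPred atleast c Y = atom (Atleast c) (vars↑ (V c) Vec.++ Y ∷ []) []
  boundPred atmost  c Y = atom (Atmost c) (vars↑ (V c) Vec.++ Y ∷ []) []

  τ*-element : (G : List ProgVar) (B : BodyElement) → PureIn G B → Formula σ₂
  τ*-element G (basic b) _    = ⌈ τᴮ b ⌉
  τ*-element G (count a) pure =
    ex (aux 0) (⌈ val 0 (AggregateAtom.bound a) (var (aux 0)) ⌉
                ∧ boundPred (AggregateAtom.rel a) (countIndex G a pure) (var (aux 0)))

  τ*-body : (G : List ProgVar) (Bs : List BodyElement) → All (PureIn G) Bs → Formula σ₂
  τ*-body G []       []       = ⊤
  τ*-body G (B ∷ Bs) (p ∷ ps) = τ*-element G B p ∧ τ*-body G Bs ps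

  τ*-rule : PureRule → Formula σ₂
  τ*-rule R = closure (go (PureRule.head R))
    where
    Body : Formula σ₂
    Body = τ*-body (globals (PureRule.rule R)) (PureRule.body R) (PureRule.pure R)

    go : Head → Formula σ₂
    go (basic (_⟨_⟩ p {n} ts))  = Body ∧ ⌈ valⱽ ts Z ⌉ ⇒ atom (base (p / n)) Z []
      where Z = Vec.map var (auxs n)
    go (choice (_⟨_⟩ p {n} ts)) =
      Body ∧ ⌈ valⱽ ts Z ⌉ ⇒ atom (base (p / n)) Z [] ∨ (¬ᶠ atom (base (p / n)) Z [])
      where Z = Vec.map var (auxs n)
    go constraint              = ¬ᶠ Body

  τ* : Program → Formula σ₂
  τ* Π = ⋀ (map τ*-rule Π)

  Dom : Sort → Set
  Dom gen = P
  Dom int = ℤ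

  Env : Set
  Env = (x : AnyVar) → Dom (proj₁ x)

  _[_↦_] : ∀ {s} → Env → Var s → Dom s → Env
  (ρ [ x ↦ d ]) y with y ≟ⱽ (_ , x)
  ... | yes refl = d
  ... | no _     = ρ y

  ⟦_⟧ : ∀ {s} → Tm s → Env → Dom s
  ⟦ var x ⟧ ρ     = ρ (_ , x)
  ⟦ numeral n ⟧ ρ = n
  ⟦ sym c ⟧ ρ     = sym c
  ⟦ other c ⟧ ρ   = other c
  ⟦ ∣ t ∣ᵗ ⟧ ρ    = + ∣ ⟦ t ⟧ ρ ∣
  ⟦ t +ᵗ u ⟧ ρ    = ⟦ t ⟧ ρ ℤ.+ ⟦ u ⟧ ρ
  ⟦ t -ᵗ u ⟧ ρ    = ⟦ t ⟧ ρ ℤ.- ⟦ u ⟧ ρ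
  ⟦ t ×ᵗ u ⟧ ρ    = ⟦ t ⟧ ρ ℤ.* ⟦ u ⟧ ρ
  ⟦ ↑ t ⟧ ρ       = num (⟦ t ⟧ ρ)

  -- A standard interpretation is determined by its set 𝓘 of true precomputed
  -- atoms, i.e. by the extents of the predicate constants p/n.
  Sat : Pred (Atom Symbol P) 0ℓ → Env → Formula σ₀ → Set
  Sat 𝓘 ρ (atom (p / _) ts [])          = 𝓘 (p ⟨ Vec.map (λ t → ⟦ t ⟧ ρ) ts ⟩)
  Sat 𝓘 ρ (atom (ord r) (t ∷ u ∷ []) []) = ⟦ r ⟧ᵒ (⟦ t ⟧ ρ) (⟦ u ⟧ ρ)
  Sat 𝓘 ρ (t ≐ u)                       = ⟦ t ⟧ ρ ≡ ⟦ u ⟧ ρ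
  Sat 𝓘 ρ ⊥                             = Empty
  Sat 𝓘 ρ (F ∧ G)                       = Sat 𝓘 ρ F × Sat 𝓘 ρ G
  Sat 𝓘 ρ (F ∨ G)                       = Sat 𝓘 ρ F ⊎ Sat 𝓘 ρ G
  Sat 𝓘 ρ (F ⇒ G)                       = Sat 𝓘 ρ F → Sat 𝓘 ρ G
  Sat 𝓘 ρ (all {s} x F)                 = (d : Dom s) → Sat 𝓘 (ρ [ x ↦ d ]) F
  Sat 𝓘 ρ (ex {s} x F)                  = Σ (Dom s) λ d → Sat 𝓘 (ρ [ x ↦ d ]) F

  NoPredicateSymbol : Formula σ₀ → Set
  NoPredicateSymbol (atom (_ / _) _ _)   = Empty
  NoPredicateSymbol (atom (ord _) _ _)   = Unit
  NoPredicateSymbol (_ ≐ _)              = Unit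
  NoPredicateSymbol ⊥                    = Unit
  NoPredicateSymbol (F ∧ G)              = NoPredicateSymbol F × NoPredicateSymbol G
  NoPredicateSymbol (F ∨ G)              = NoPredicateSymbol F × NoPredicateSymbol G
  NoPredicateSymbol (F ⇒ G)              = NoPredicateSymbol F × NoPredicateSymbol G
  NoPredicateSymbol (all _ F)            = NoPredicateSymbol F
  NoPredicateSymbol (ex _ F)             = NoPredicateSymbol F

  Std : Formula σ₀ → Set₁
  Std F = Sentence F × NoPredicateSymbol F × (∀ 𝓘 ρ → Sat 𝓘 ρ F)

  _<ˡᵉˣ_ : ∀ {m} → Vec (Var gen) m → Vec (Var gen) m → Formula σ₂
  _<ˡᵉˣ_ {m} xs us = ⋁ (tabulate {n = m} λ l →
    ⌈ rel lt (var (lookup xs l)) (var (lookup us l)) ⌉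
    ∧ ⋀ (tabulate {n = toℕ l} λ k → var (lookup xs (inject k)) ≐ var (lookup us (inject k))))

  start : (c : CountIndex) → Vec (Var gen) (length (X c)) → Tm int → Formula σ₂
  start c xs n = atom (Start c) (Vec.map var xs Vec.++ vars↑ (V c)) (n ∷ [])

  relᵢ : OrderRel → Tm int → Tm int → Formula σ₂
  relᵢ r t u = ⌈ rel r (↑ t) (↑ u) ⌉

  data D₀ (c : CountIndex) : Formula σ₂ → Set where
    start≤0 : (N : Var int) →
      D₀ c (all* (X c ++ V c) (all N
             (relᵢ le (var N) (numeral (+ 0)) ⇒ start c (fromList (X c)) (var N))))
    start1 :
      D₀ c (all* (X c ++ V c)
             (start c (fromList (X c)) (numeral (+ 1)) ⇔ᶠ ⌈ F c ⌉))
    start+1 : (N : Var int) (U : Vec (Var gen) (length (X c))) →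
      Unique (Vec.toList U) → All (_∉ X c ++ V c) (Vec.toList U) →
      D₀ c (all* (X c ++ V c) (all N
             (relᵢ gt (var N) (numeral (+ 0)) ⇒
               (start c (fromList (X c)) (var N +ᵗ numeral (+ 1)) ⇔ᶠ
                ⌈ F c ⌉ ∧ ex* (Vec.toList U) (fromList (X c) <ˡᵉˣ U ∧ start c U (var N))))))

  data D₁ (c : CountIndex) : Formula σ₂ → Set where
    atleast-def : (N : Var int) (Y : Var gen) → Y ∉ X c ++ V c →
      D₁ c (all* (V c) (all Y
             (boundPred atleast c (var Y) ⇔ᶠ
              ex* (X c) (ex N (start c (fromList (X c)) (var N) ∧ ⌈ rel ge (↑ var N) (var Y) ⌉)))))
    atmost-def : (N : Var int) (Y : Var gen) → Y ∉ X c ++ V c →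
      D₁ c (all* (V c) (all Y
             (boundPred atmost c (var Y) ⇔ᶠ
              all* (X c) (all N (start c (fromList (X c)) (var N) ⇒ ⌈ rel le (↑ var N) (var Y) ⌉)))))

  -- In the induction schema the substitution of N + 1 for N captures no variable.
  data Axiom : Formula σ₂ → Set₁ where
    hosoi : ∀ F G → Axiom (F ∨ (F ⇒ G) ∨ (¬ᶠ G))
    sqht  : ∀ {s} (x : Var s) F → Axiom (ex x (F ⇒ all x F))
    std   : ∀ F → Std F → Axiom ⌈ F ⌉
    ind   : ∀ (N : Var int) F → Axiom (closure
              ((F [ N ≔ numeral (+ 0) ]ᶠ)
               ∧ all N (relᵢ ge (var N) (numeral (+ 0)) ∧ F ⇒ (F [ N ≔ var N +ᵗ numeral (+ 1) ]ᶠ))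
               ⇒ all N (relᵢ ge (var N) (numeral (+ 0)) ⇒ F)))
    d₀    : ∀ c F → D₀ c F → Axiom F
    d₁    : ∀ c F → D₁ c F → Axiom F

  infix 3 _⊢_

  data _⊢_ (Γ : List (Formula σ₂)) : Formula σ₂ → Set₁ where
    axiom   : ∀ {F} → Axiom F → Γ ⊢ F
    assume  : ∀ {F} → F ∈ Γ → Γ ⊢ F
    ⊥-E     : ∀ {F} → Γ ⊢ ⊥ → Γ ⊢ F
    ∧-I     : ∀ {F G} → Γ ⊢ F → Γ ⊢ G → Γ ⊢ F ∧ G
    ∧-E₁    : ∀ {F G} → Γ ⊢ F ∧ G → Γ ⊢ F
    ∧-E₂    : ∀ {F G} → Γ ⊢ F ∧ G → Γ ⊢ G
    ∨-I₁    : ∀ {F G} → Γ ⊢ F → Γ ⊢ F ∨ G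
    ∨-I₂    : ∀ {F G} → Γ ⊢ G → Γ ⊢ F ∨ G
    ∨-E     : ∀ {F G H} → Γ ⊢ F ∨ G → F ∷ Γ ⊢ H → G ∷ Γ ⊢ H → Γ ⊢ H
    ⇒-I     : ∀ {F G} → F ∷ Γ ⊢ G → Γ ⊢ F ⇒ G
    ⇒-E     : ∀ {F G} → Γ ⊢ F ⇒ G → Γ ⊢ F → Γ ⊢ G
    all-I   : ∀ {s} {x : Var s} {F} → All (λ H → (s , x) ∉ fv H) Γ → Γ ⊢ F → Γ ⊢ all x F
    all-E   : ∀ {s} {x : Var s} {F} (t : Tm s) → FreeFor t x F → Γ ⊢ all x F → Γ ⊢ F [ x ≔ t ]ᶠ
    ex-I    : ∀ {s} {x : Var s} {F} (t : Tm s) → FreeFor t x F → Γ ⊢ F [ x ≔ t ]ᶠ → Γ ⊢ ex x F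
    ex-E    : ∀ {s} {x : Var s} {F G} → All (λ H → (s , x) ∉ fv H) Γ → (s , x) ∉ fv G →
              Γ ⊢ ex x F → F ∷ Γ ⊢ G → Γ ⊢ G
    ≐-refl  : ∀ {t} → Γ ⊢ t ≐ t
    ≐-subst : ∀ {s} {x : Var s} {F} (t u : Tm s) → FreeFor t x F → FreeFor u x F →
              Γ ⊢ asGen t ≐ asGen u → Γ ⊢ F [ x ≔ t ]ᶠ → Γ ⊢ F [ x ≔ u ]ᶠ

  HT#⊢_ : Formula σ₂ → Set₁
  HT#⊢ F = [] ⊢ F

{-# OPTIONS --safe #-}
module Submission where

-- Soundness for here-and-there models: given H ⊆ T, read formulas over σ₂ in the Kripke
-- model with worlds here ≼ there, constant standard domains and the atoms H and T, taking
-- Start(x, v, N) to mean that there is an ascending chain of N tuples with first member x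
-- that satisfy F. This validates every axiom of HT#. A finite set of tuples
-- can be arranged in an ascending chain, so τ* Π is forced exactly when the infinitary
-- formula τ Π holds in (H, T), that is, at here, when H satisfies the reduct of τ Π by T.
-- Hence provably equivalent τ* Π₁ and τ* Π₂ have τ Π₁ and τ Π₂ with equivalent reducts.

open import Axiom.ExcludedMiddle using (ExcludedMiddle)
open import Data.Bool using (if_then_else_)
open import Data.Empty using () renaming (⊥ to Empty; ⊥-elim to Empty-elim)
open import Data.Fin using (Fin; zero; suc; toℕ; inject)
open import Data.Fin.Properties using (toℕ-injective)
open import Data.Integer as ℤ using (ℤ; +_; -[1+_]; sign; _◃_)
import Data.Integer.Properties as ℤ
open import Data.List using (List; []; _∷_; _++_; foldr; deduplicate)
import Data.List as List
open import Data.List.Membership.Propositional using (_∈_; _∉_)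
open import Data.List.Membership.Propositional.Properties using (∈-++⁺ˡ; ∈-++⁺ʳ; ∈-++⁻; ∈-filter⁺; ∈-filter⁻; ∈-map⁺; ∈-map⁻; ∈-deduplicate⁺)
import Data.List.Properties as List
open import Data.List.Relation.Binary.Permutation.Propositional using (_↭_; ↭-refl; ↭-sym; ↭-trans; prep; swap)
open import Data.List.Relation.Binary.Permutation.Propositional.Properties using (All-resp-↭; ↭-length)
open import Data.List.Relation.Unary.All as All using (All; []; _∷_)
import Data.List.Relation.Unary.All.Properties as All
open import Data.List.Relation.Unary.AllPairs as AllPairs using (AllPairs; []; _∷_)
open import Data.List.Relation.Unary.Any using (here; there)
open import Data.List.Relation.Unary.Unique.Propositional using (Unique)
import Data.List.Relation.Unary.Unique.Propositional.Properties as Unique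
open import Data.Nat as ℕ using (ℕ; zero; suc)
import Data.Nat.DivMod as ℕ
import Data.Nat.Properties as ℕ
open import Data.Product using (Σ; ∃; _×_; _,_; proj₁; proj₂)
open import Data.Product.Function.NonDependent.Propositional using (_×-⇔_)
import Data.Sign as Sign
open import Data.Sum using (_⊎_; inj₁; inj₂)
open import Data.Sum.Function.Propositional using (_⊎-⇔_)
open import Data.Unit using () renaming (⊤ to Unit)
open import Data.Vec as Vec using (Vec; []; _∷_)
open import Data.Vec.Properties using (cast-is-id; toList-cast; tabulate-∘; tabulate-cong; tabulate∘lookup; lookup-map; map-∘; map-++; toList-map; toList∘fromList; toList-injective; length-toList; ++-injectiveˡ; ++-injectiveʳ; take++drop≡id)
open import Data.Vec.Relation.Binary.Lex.Strict as Lex using (Lex-<; base; this; next)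
open import Data.Vec.Relation.Binary.Pointwise.Inductive using (Pointwise; []; _∷_; Pointwise-≡⇒≡; ≡⇒Pointwise-≡)
open import Function.Base using (_∘_; id)
open import Function.Bundles using (_⇔_; mk⇔; Equivalence)
open import Function.Construct.Identity using (⇔-id)
open import Function.Construct.Symmetry using (⇔-sym)
open import Level using (0ℓ)
open import Relation.Binary.Construct.NonStrictToStrict using (<-isStrictTotalOrder₁)
open import Relation.Binary.Definitions using (tri<; tri≈; tri>)
open import Relation.Binary.PropositionalEquality as ≡ using (_≡_; _≢_; refl; cong; cong₂; subst)
open import Relation.Binary.Structures using (IsStrictTotalOrder; IsTotalOrder)
open import Relation.Nullary using (recompute; decidable-stable; does; Dec; yes; no; ¬_; ¬?; contradiction)
open import Relation.Nullary.Decidable using (dec-true; dec-false)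
open import Relation.Unary using (Pred; _⊆_; _∪_; ｛_｝)
open import Defs

open Equivalence using (to; from)

-- The tuples satisfying a formula may be infinitely many, and there may be more of them at `there`
-- than at `here`, so the model assigns no cardinality. The existence of a chain of given length
-- survives the passage to a later world and obeys the recursion of `D₀` clause by clause.
--
-- The interpretation of `σ₂` is not circular: the index `F` of a count constant is a formula over
-- `σ₀`, which has no count constants. Forcing is therefore defined for an arbitrary signature and
-- used twice, over `σ₀` to say when a tuple satisfies `F`, and then over `σ₂`.
--
-- Much of the remaining work is variable bookkeeping. Environments are functions and substitution
-- renames nothing, so statements about them speak of pointwise agreement on or off a list of
-- variables. Excluded middle decides equality of precomputed terms, the two intermediate axiom
-- schemas, and the case distinctions in the reduct.

module _ {A : Set} {B C : A → Set} where

  Π-⇔ : (∀ a → B a ⇔ C a) → (∀ a → B a) ⇔ (∀ a → C a)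
  Π-⇔ e = mk⇔ (λ f a → to (e a) (f a)) (λ f a → from (e a) (f a))

  ∃-⇔ : (∀ a → B a ⇔ C a) → ∃ B ⇔ ∃ C
  ∃-⇔ e = mk⇔ (λ (a , b) → a , to (e a) b) (λ (a , c) → a , from (e a) c)

infixr 3 _∘⇔_

_∘⇔_ : {A B C : Set} → B ⇔ C → A ⇔ B → A ⇔ C
f ∘⇔ e = mk⇔ (to f ∘ to e) (from e ∘ from f)

≡⇒⇔ : {A B : Set} → A ≡ B → A ⇔ B
≡⇒⇔ refl = ⇔-id _

→-⇔ : {A B C D : Set} → A ⇔ B → C ⇔ D → (A → C) ⇔ (B → D)
→-⇔ e f = mk⇔ (λ g → to f ∘ g ∘ from e) (λ g → from f ∘ g ∘ to e)

module _ {A : Set} {ys : List A} where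

  unique-++⁻ˡ : ∀ xs → Unique (xs ++ ys) → Unique xs
  unique-++⁻ˡ []       _        = []
  unique-++⁻ˡ (x ∷ xs) (x∉ ∷ u) = All.++⁻ˡ xs x∉ ∷ unique-++⁻ˡ xs u

  unique-++⇒disjoint : ∀ xs → Unique (xs ++ ys) → ∀ {x} → x ∈ xs → x ∉ ys
  unique-++⇒disjoint (x ∷ xs) (x∉ ∷ _) (here refl) x∈ys = All.lookup (All.++⁻ʳ xs x∉) x∈ys refl
  unique-++⇒disjoint (x ∷ xs) (_ ∷ u)  (there x∈)  x∈ys = unique-++⇒disjoint xs u x∈ x∈ys

-- The two-world frame

data World : Set where
  here there : World

data _≼_ : World → World → Set where
  ≼-refl     : ∀ {w} → w ≼ w
  here≼there : here ≼ there

≼-trans : ∀ {u v w} → u ≼ v → v ≼ w → u ≼ w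
≼-trans ≼-refl     q      = q
≼-trans here≼there ≼-refl = here≼there

≼-there : ∀ w → w ≼ there
≼-there here  = here≼there
≼-there there = ≼-refl

-- Environments and substitution in terms

module Environments (𝒯 : PrecomputedTerms) where

  open MiniGringo 𝒯

  AgreeOn AgreeOff : List AnyVar → Env → Env → Set
  AgreeOn  xs ρ ρ′ = ∀ {y} → y ∈ xs → ρ y ≡ ρ′ y
  AgreeOff xs ρ ρ′ = ∀ y → y ∉ xs → ρ y ≡ ρ′ y

  module _ {s} (ρ : Env) (x : Var s) (d : Dom s) where

    update-same : (ρ [ x ↦ d ]) (s , x) ≡ d
    update-same with (s , x) ≟ⱽ (s , x)
    ... | yes refl = refl
    ... | no x≢x   = contradiction refl x≢x

    update-other : ∀ {y} → y ≢ (s , x) → (ρ [ x ↦ d ]) y ≡ ρ y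
    update-other {y} y≢x with y ≟ⱽ (s , x)
    ... | yes refl = contradiction refl y≢x
    ... | no _     = refl

  update-cong : ∀ {s} (x : Var s) {d} (ρ ρ′ : Env) y → (y ≢ (s , x) → ρ y ≡ ρ′ y) →
                (ρ [ x ↦ d ]) y ≡ (ρ′ [ x ↦ d ]) y
  update-cong {s} x ρ ρ′ y e with y ≟ⱽ (s , x)
  ... | yes refl = refl
  ... | no y≢x   = e y≢x

  update-id : ∀ {s} {x : Var s} {ρ ρ′ : Env} {y} → (y ≢ (s , x) → ρ y ≡ ρ′ y) →
              (ρ [ x ↦ ρ′ (s , x) ]) y ≡ ρ′ y
  update-id {s} {x} {y = y} e with y ≟ⱽ (s , x)
  ... | yes refl = refl
  ... | no y≢x   = e y≢x

  ⟦⟧-cong : ∀ {s} (t : Tm s) {ρ ρ′} → AgreeOn (fvᵗ t) ρ ρ′ → ⟦ t ⟧ ρ ≡ ⟦ t ⟧ ρ′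
  ⟦⟧-cong (var x)     e = e (here refl)
  ⟦⟧-cong (numeral _) e = refl
  ⟦⟧-cong (sym _)     e = refl
  ⟦⟧-cong (other _)   e = refl
  ⟦⟧-cong ∣ t ∣ᵗ      e = cong (λ n → + ℤ.∣ n ∣) (⟦⟧-cong t e)
  ⟦⟧-cong (t +ᵗ u)    e = cong₂ ℤ._+_ (⟦⟧-cong t (e ∘ ∈-++⁺ˡ)) (⟦⟧-cong u (e ∘ ∈-++⁺ʳ (fvᵗ t)))
  ⟦⟧-cong (t -ᵗ u)    e = cong₂ ℤ._-_ (⟦⟧-cong t (e ∘ ∈-++⁺ˡ)) (⟦⟧-cong u (e ∘ ∈-++⁺ʳ (fvᵗ t)))
  ⟦⟧-cong (t ×ᵗ u)    e = cong₂ ℤ._*_ (⟦⟧-cong t (e ∘ ∈-++⁺ˡ)) (⟦⟧-cong u (e ∘ ∈-++⁺ʳ (fvᵗ t)))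
  ⟦⟧-cong (↑ t)       e = cong num (⟦⟧-cong t e)

  ⟦_⟧ⱽ : ∀ {s n} → Vec (Tm s) n → Env → Vec (Dom s) n
  ⟦ ts ⟧ⱽ ρ = Vec.map (λ t → ⟦ t ⟧ ρ) ts

  ⟦⟧ⱽ-cong : ∀ {s n} (ts : Vec (Tm s) n) {ρ ρ′} → AgreeOn (fvⱽ ts) ρ ρ′ → ⟦ ts ⟧ⱽ ρ ≡ ⟦ ts ⟧ⱽ ρ′
  ⟦⟧ⱽ-cong []       e = refl
  ⟦⟧ⱽ-cong (t ∷ ts) e = cong₂ _∷_ (⟦⟧-cong t (e ∘ ∈-++⁺ˡ)) (⟦⟧ⱽ-cong ts (e ∘ ∈-++⁺ʳ (fvᵗ t)))

  -- A relation rather than the single environment `ρ [ x ↦ ⟦ t ⟧ ρ ]`: under a quantifier the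
  -- updates have to be interchanged, and the results agree only pointwise. The relation is
  -- preserved there, and it also fits the induction step, where `t` is `N + 1` and both
  -- environments are updates at `N`.
  record Resets {s} (t : Tm s) (x : Var s) (ρ ρ′ : Env) : Set where
    field
      at  : ρ′ (s , x) ≡ ⟦ t ⟧ ρ
      off : ∀ {y} → y ≢ (s , x) → ρ y ≡ ρ′ y

  open Resets

  resets : ∀ {s} (t : Tm s) (x : Var s) ρ → Resets t x ρ (ρ [ x ↦ ⟦ t ⟧ ρ ])
  resets t x ρ .at      = update-same ρ x _
  resets t x ρ .off y≢x = ≡.sym (update-other ρ x _ y≢x)

  module _ {s} {t : Tm s} {x : Var s} where

    ⟦⟧-subst : ∀ {s′} (u : Tm s′) {ρ ρ′} → Resets t x ρ ρ′ → ⟦ u [ x ≔ t ]ᵗ ⟧ ρ ≡ ⟦ u ⟧ ρ′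
    ⟦⟧-subst (var y) r with (_ , y) ≟ⱽ (_ , x)
    ... | yes refl = ≡.sym (r .at)
    ... | no y≢x   = r .off y≢x
    ⟦⟧-subst (numeral _) r = refl
    ⟦⟧-subst (sym _)     r = refl
    ⟦⟧-subst (other _)   r = refl
    ⟦⟧-subst ∣ u ∣ᵗ      r = cong (λ n → + ℤ.∣ n ∣) (⟦⟧-subst u r)
    ⟦⟧-subst (u +ᵗ v)    r = cong₂ ℤ._+_ (⟦⟧-subst u r) (⟦⟧-subst v r)
    ⟦⟧-subst (u -ᵗ v)    r = cong₂ ℤ._-_ (⟦⟧-subst u r) (⟦⟧-subst v r)
    ⟦⟧-subst (u ×ᵗ v)    r = cong₂ ℤ._*_ (⟦⟧-subst u r) (⟦⟧-subst v r)
    ⟦⟧-subst (↑ u)       r = cong num (⟦⟧-subst u r)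

    ⟦⟧ⱽ-subst : ∀ {s′ n} (us : Vec (Tm s′) n) {ρ ρ′} → Resets t x ρ ρ′ →
                ⟦ Vec.map (_[ x ≔ t ]ᵗ) us ⟧ⱽ ρ ≡ ⟦ us ⟧ⱽ ρ′
    ⟦⟧ⱽ-subst []       r = refl
    ⟦⟧ⱽ-subst (u ∷ us) r = cong₂ _∷_ (⟦⟧-subst u r) (⟦⟧ⱽ-subst us r)

    -- The passage under a quantifier on `y`. Absence of `y` from `t` is the no-capture condition:
    -- the new value of `y` must not alter the value of `t`.
    resets-update : ∀ {s′} {y : Var s′} {d ρ ρ′} → (s , x) ≢ (s′ , y) → (s′ , y) ∉ fvᵗ t →
                    Resets t x ρ ρ′ → Resets t x (ρ [ y ↦ d ]) (ρ′ [ y ↦ d ])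
    resets-update {y = y} {d} {ρ} {ρ′} x≢y y∉t r .at =
      ≡.trans (update-other ρ′ y d x≢y) (≡.trans (r .at)
        (⟦⟧-cong t λ z∈ → ≡.sym (update-other ρ y d λ { refl → y∉t z∈ })))
    resets-update {y = y} {d} {ρ} {ρ′} x≢y y∉t r .off {z} z≢x = update-cong y ρ ρ′ z λ _ → r .off z≢x

  update-on : ∀ {σ} (F : Formula σ) {s} {x : Var s} {ρ ρ′} {d : Dom s} →
              AgreeOn (fv (all x F)) ρ ρ′ → AgreeOn (fv F) (ρ [ x ↦ d ]) (ρ′ [ x ↦ d ])
  update-on F {x = x} {ρ} {ρ′} e {y} y∈F = update-cong x ρ ρ′ y λ y≢x →
    e (∈-filter⁺ (λ y → ¬? (y ≟ⱽ (_ , x))) y∈F y≢x)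

  values : List (Var gen) → Env → List P
  values xs ρ = List.map (λ x → ρ (gen , x)) xs

  values-cong : ∀ xs ρ ρ′ → (∀ {x} → x ∈ xs → ρ (gen , x) ≡ ρ′ (gen , x)) → values xs ρ ≡ values xs ρ′
  values-cong []       ρ ρ′ e = refl
  values-cong (x ∷ xs) ρ ρ′ e = cong₂ _∷_ (e (here refl)) (values-cong xs ρ ρ′ (e ∘ there))

  values-injective : ∀ xs ρ ρ′ → values xs ρ ≡ values xs ρ′ → AgreeOn (List.map anyVar xs) ρ ρ′
  values-injective (x ∷ xs) ρ ρ′ e (here refl) = List.∷-injectiveˡ e
  values-injective (x ∷ xs) ρ ρ′ e (there y∈)  = values-injective xs ρ ρ′ (List.∷-injectiveʳ e) y∈

  record Extension (xs : List (Var gen)) (ds : List P) (ρ : Env) : Set where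
    field
      env   : Env
      off   : AgreeOff (List.map anyVar xs) ρ env
      value : values xs env ≡ ds

  gen∈⁻ : ∀ {x : Var gen} {xs} → (gen , x) ∈ List.map anyVar xs → x ∈ xs
  gen∈⁻ x∈ with ∈-map⁻ anyVar x∈
  ... | _ , x∈xs , refl = x∈xs

  extend : ∀ {xs} → Unique xs → (ds : List P) → List.length ds ≡ List.length xs → ∀ ρ → Extension xs ds ρ
  extend {[]} _ [] _ ρ = record { env = ρ ; off = λ _ _ → refl ; value = refl }
  extend {x ∷ xs} (x∉xs ∷ u) (d ∷ ds) l ρ = record
    { env   = E.env [ x ↦ d ]
    ; off   = λ y y∉ → ≡.trans (E.off y (y∉ ∘ there)) (≡.sym (update-other E.env x d λ { refl → y∉ (here refl) }))
    ; value = cong₂ _∷_ (update-same E.env x d)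
        (≡.trans (values-cong xs (E.env [ x ↦ d ]) E.env λ y∈ → update-other E.env x d λ { refl → All.lookup x∉xs y∈ refl }) E.value)
    }
    where module E = Extension (extend u ds (cong ℕ.pred l) ρ)

  -- Kripke forcing over an arbitrary signature

  module Forcing {σ : Signature}
    (𝓜 : World → (p : Signature.PredConst σ) → Vec P (Signature.gens σ p) → Vec ℤ (Signature.ints σ p) → Set)
    (𝓜-mono : ∀ {v w} → v ≼ w → ∀ p {as is} → 𝓜 v p as is → 𝓜 w p as is) where

    -- The domains are the same at both worlds, so `all` needs no quantification over later worlds;
    -- `Force-mono` recovers persistence.
    Force : World → Env → Formula σ → Set
    Force w ρ (atom p ts us) = 𝓜 w p (⟦ ts ⟧ⱽ ρ) (⟦ us ⟧ⱽ ρ)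
    Force w ρ (t ≐ u)        = ⟦ t ⟧ ρ ≡ ⟦ u ⟧ ρ
    Force w ρ ⊥              = Empty
    Force w ρ (F ∧ G)        = Force w ρ F × Force w ρ G
    Force w ρ (F ∨ G)        = Force w ρ F ⊎ Force w ρ G
    Force w ρ (F ⇒ G)        = ∀ v → w ≼ v → Force v ρ F → Force v ρ G
    Force w ρ (all {s} x F)  = (d : Dom s) → Force w (ρ [ x ↦ d ]) F
    Force w ρ (ex {s} x F)   = Σ (Dom s) λ d → Force w (ρ [ x ↦ d ]) F

    Force-mono : ∀ {v w} → v ≼ w → ∀ F {ρ} → Force v ρ F → Force w ρ F
    Force-mono v≼w (atom p _ _) h        = 𝓜-mono v≼w p h
    Force-mono v≼w (_ ≐ _)      h        = h
    Force-mono v≼w (F ∧ G)      (f , g)  = Force-mono v≼w F f , Force-mono v≼w G g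
    Force-mono v≼w (F ∨ G)      (inj₁ f) = inj₁ (Force-mono v≼w F f)
    Force-mono v≼w (F ∨ G)      (inj₂ g) = inj₂ (Force-mono v≼w G g)
    Force-mono v≼w (F ⇒ G)      h        = λ u w≼u → h u (≼-trans v≼w w≼u)
    Force-mono v≼w (all x F)    h        = λ d → Force-mono v≼w F (h d)
    Force-mono v≼w (ex x F)     (d , h)  = d , Force-mono v≼w F h

    Force-cong : ∀ {w} F {ρ ρ′} → AgreeOn (fv F) ρ ρ′ → Force w ρ F ⇔ Force w ρ′ F
    Force-cong (atom p ts us) e
      rewrite ⟦⟧ⱽ-cong ts (e ∘ ∈-++⁺ˡ) | ⟦⟧ⱽ-cong us (e ∘ ∈-++⁺ʳ (fvⱽ ts)) = ⇔-id _
    Force-cong (t ≐ u) e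
      rewrite ⟦⟧-cong t (e ∘ ∈-++⁺ˡ) | ⟦⟧-cong u (e ∘ ∈-++⁺ʳ (fvᵗ t)) = ⇔-id _
    Force-cong ⊥         e = ⇔-id _
    Force-cong (F ∧ G)   e = Force-cong F (e ∘ ∈-++⁺ˡ) ×-⇔ Force-cong G (e ∘ ∈-++⁺ʳ (fv F))
    Force-cong (F ∨ G)   e = Force-cong F (e ∘ ∈-++⁺ˡ) ⊎-⇔ Force-cong G (e ∘ ∈-++⁺ʳ (fv F))
    Force-cong (F ⇒ G)   e = Π-⇔ λ v → Π-⇔ λ _ →
      →-⇔ (Force-cong F (e ∘ ∈-++⁺ˡ)) (Force-cong G (e ∘ ∈-++⁺ʳ (fv F)))
    Force-cong (all x F) e = Π-⇔ λ d → Force-cong F (update-on F e)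
    Force-cong (ex x F)  e = ∃-⇔ λ d → Force-cong F (update-on F e)

    module _ {s} {t : Tm s} {x : Var s} where

      -- When the quantifier binds `x` itself, substitution stops there, and the update overwrites
      -- the only place where `ρ` and `ρ′` differ.
      Force-subst-bound : ∀ {w s′} {y : Var s′} (F : Formula σ) {ρ ρ′} {d : Dom s′} →
        (s′ , y) ≡ (s , x) → Resets t x ρ ρ′ → Force w (ρ [ y ↦ d ]) F ⇔ Force w (ρ′ [ y ↦ d ]) F
      Force-subst-bound {y = y} F {ρ} {ρ′} refl r = Force-cong F λ {z} _ → update-cong y ρ ρ′ z λ z≢x → r .off z≢x

      Nonfree : Formula σ → Set
      Nonfree F = (s , x) ∉ fv F

      nonfree-body : ∀ {s′} {y : Var s′} F → (s′ , y) ≢ (s , x) → Nonfree (all y F) → Nonfree F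
      nonfree-body {y = y} F y≢x x∉ x∈F =
        x∉ (∈-filter⁺ (λ z → ¬? (z ≟ⱽ (_ , y))) x∈F (y≢x ∘ ≡.sym))

      ∉-resets : ∀ {xs} {ρ ρ′} → (s , x) ∉ xs → Resets t x ρ ρ′ → AgreeOn xs ρ ρ′
      ∉-resets x∉ r y∈ = r .off λ { refl → x∉ y∈ }

      subst-nonfreeᵗ : ∀ {s′} (u : Tm s′) → (s , x) ∉ fvᵗ u → u [ x ≔ t ]ᵗ ≡ u
      subst-nonfreeᵗ (var y) x∉ with (_ , y) ≟ⱽ (_ , x)
      ... | yes refl = contradiction (here refl) x∉
      ... | no _     = refl
      subst-nonfreeᵗ (numeral _) x∉ = refl
      subst-nonfreeᵗ (sym _)     x∉ = refl
      subst-nonfreeᵗ (other _)   x∉ = refl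
      subst-nonfreeᵗ ∣ u ∣ᵗ      x∉ = cong ∣_∣ᵗ (subst-nonfreeᵗ u x∉)
      subst-nonfreeᵗ (u +ᵗ v)    x∉ = cong₂ _+ᵗ_ (subst-nonfreeᵗ u (x∉ ∘ ∈-++⁺ˡ)) (subst-nonfreeᵗ v (x∉ ∘ ∈-++⁺ʳ (fvᵗ u)))
      subst-nonfreeᵗ (u -ᵗ v)    x∉ = cong₂ _-ᵗ_ (subst-nonfreeᵗ u (x∉ ∘ ∈-++⁺ˡ)) (subst-nonfreeᵗ v (x∉ ∘ ∈-++⁺ʳ (fvᵗ u)))
      subst-nonfreeᵗ (u ×ᵗ v)    x∉ = cong₂ _×ᵗ_ (subst-nonfreeᵗ u (x∉ ∘ ∈-++⁺ˡ)) (subst-nonfreeᵗ v (x∉ ∘ ∈-++⁺ʳ (fvᵗ u)))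
      subst-nonfreeᵗ (↑ u)       x∉ = cong ↑_ (subst-nonfreeᵗ u x∉)

      subst-nonfreeⱽ : ∀ {s′ n} (us : Vec (Tm s′) n) → (s , x) ∉ fvⱽ us → Vec.map (_[ x ≔ t ]ᵗ) us ≡ us
      subst-nonfreeⱽ []       x∉ = refl
      subst-nonfreeⱽ (u ∷ us) x∉ =
        cong₂ _∷_ (subst-nonfreeᵗ u (x∉ ∘ ∈-++⁺ˡ)) (subst-nonfreeⱽ us (x∉ ∘ ∈-++⁺ʳ (fvᵗ u)))

      -- `FreeFor` admits a quantifier on a variable of `t` as long as `x` is not free below it.
      -- Substitution still descends into such a body, about which `FreeFor` then says nothing, so
      -- the body is shown to be left unchanged.
      subst-nonfree : ∀ F → Nonfree F → F [ x ≔ t ]ᶠ ≡ F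
      subst-nonfree (atom p ts us) x∉ =
        cong₂ (atom p) (subst-nonfreeⱽ ts (x∉ ∘ ∈-++⁺ˡ)) (subst-nonfreeⱽ us (x∉ ∘ ∈-++⁺ʳ (fvⱽ ts)))
      subst-nonfree (u ≐ v) x∉ = cong₂ _≐_ (subst-nonfreeᵗ u (x∉ ∘ ∈-++⁺ˡ)) (subst-nonfreeᵗ v (x∉ ∘ ∈-++⁺ʳ (fvᵗ u)))
      subst-nonfree ⊥       x∉ = refl
      subst-nonfree (F ∧ G) x∉ = cong₂ _∧_ (subst-nonfree F (x∉ ∘ ∈-++⁺ˡ)) (subst-nonfree G (x∉ ∘ ∈-++⁺ʳ (fv F)))
      subst-nonfree (F ∨ G) x∉ = cong₂ _∨_ (subst-nonfree F (x∉ ∘ ∈-++⁺ˡ)) (subst-nonfree G (x∉ ∘ ∈-++⁺ʳ (fv F)))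
      subst-nonfree (F ⇒ G) x∉ = cong₂ _⇒_ (subst-nonfree F (x∉ ∘ ∈-++⁺ˡ)) (subst-nonfree G (x∉ ∘ ∈-++⁺ʳ (fv F)))
      subst-nonfree (all y F) x∉ with (_ , y) ≟ⱽ (_ , x)
      ... | yes _  = refl
      ... | no y≢x = cong (all y) (subst-nonfree F (nonfree-body F y≢x x∉))
      subst-nonfree (ex y F) x∉ with (_ , y) ≟ⱽ (_ , x)
      ... | yes _  = refl
      ... | no y≢x = cong (ex y) (subst-nonfree F (nonfree-body F y≢x x∉))

      Force-subst : ∀ {w} F {ρ ρ′} → FreeFor t x F → Resets t x ρ ρ′ →
                    Force w ρ (F [ x ≔ t ]ᶠ) ⇔ Force w ρ′ F
      Force-subst-body : ∀ {w s′} {y : Var s′} F {ρ ρ′} {d : Dom s′} → (s′ , y) ≢ (s , x) →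
        Nonfree (all y F) ⊎ ((s′ , y) ∉ fvᵗ t × FreeFor t x F) → Resets t x ρ ρ′ →
        Force w (ρ [ y ↦ d ]) (F [ x ≔ t ]ᶠ) ⇔ Force w (ρ′ [ y ↦ d ]) F

      Force-subst (atom p ts us) f r
        rewrite ⟦⟧ⱽ-subst ts r | ⟦⟧ⱽ-subst us r = ⇔-id _
      Force-subst (u ≐ v) f r rewrite ⟦⟧-subst u r | ⟦⟧-subst v r = ⇔-id _
      Force-subst ⊥       f r = ⇔-id _
      Force-subst (F ∧ G) (f , g) r = Force-subst F f r ×-⇔ Force-subst G g r
      Force-subst (F ∨ G) (f , g) r = Force-subst F f r ⊎-⇔ Force-subst G g r
      Force-subst (F ⇒ G) (f , g) r = Π-⇔ λ v → Π-⇔ λ _ → →-⇔ (Force-subst F f r) (Force-subst G g r)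
      Force-subst (all y F) f r with (_ , y) ≟ⱽ (_ , x)
      ... | yes y≡x = Π-⇔ λ d → Force-subst-bound F y≡x r
      ... | no y≢x  = Π-⇔ λ d → Force-subst-body F y≢x f r
      Force-subst (ex y F) f r with (_ , y) ≟ⱽ (_ , x)
      ... | yes y≡x = ∃-⇔ λ d → Force-subst-bound F y≡x r
      ... | no y≢x  = ∃-⇔ λ d → Force-subst-body F y≢x f r

      Force-subst-body {y = y} F {ρ} {ρ′} y≢x (inj₁ x∉) r
        rewrite subst-nonfree F (nonfree-body F y≢x x∉) =
        Force-cong F λ {z} z∈ → update-cong y ρ ρ′ z λ _ → ∉-resets (nonfree-body F y≢x x∉) r z∈
      Force-subst-body F y≢x (inj₂ (y∉t , f)) r =
        Force-subst F f (resets-update (y≢x ∘ ≡.sym) y∉t r)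

    Force-weaken : ∀ {w s} {x : Var s} {d} F {ρ} → (s , x) ∉ fv F → Force w ρ F ⇔ Force w (ρ [ x ↦ d ]) F
    Force-weaken {x = x} {d} F {ρ} x∉ = Force-cong F λ y∈ → ≡.sym (update-other ρ x d λ { refl → x∉ y∈ })

    allAny : List AnyVar → Formula σ → Formula σ
    allAny xs F = foldr (λ (_ , x) → all x) F xs

    off-tail : ∀ {s} {x : Var s} {xs} {ρ ρ′ : Env} → AgreeOff ((s , x) ∷ xs) ρ ρ′ →
               AgreeOff xs (ρ [ x ↦ ρ′ (s , x) ]) ρ′
    off-tail e y y∉ = update-id λ y≢x → e y λ { (here y≡x) → y≢x y≡x ; (there y∈) → y∉ y∈ }

    off-cons : ∀ {s} {x : Var s} {d xs} {ρ ρ′ : Env} → AgreeOff xs (ρ [ x ↦ d ]) ρ′ →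
               AgreeOff ((s , x) ∷ xs) ρ ρ′
    off-cons {x = x} {d} {ρ = ρ} e y y∉ =
      ≡.trans (≡.sym (update-other ρ x d (y∉ ∘ here))) (e y (y∉ ∘ there))

    Force-allAny : ∀ {w} xs F {ρ} → Force w ρ (allAny xs F) ⇔ (∀ ρ′ → AgreeOff xs ρ ρ′ → Force w ρ′ F)
    Force-allAny []       F {ρ} = mk⇔ (λ h ρ′ e → to (Force-cong F λ {y} _ → e y λ ()) h) (λ h → h ρ λ _ _ → refl)
    Force-allAny ((s , x) ∷ xs) F = mk⇔
      (λ h ρ′ e → to (Force-allAny xs F) (h (ρ′ (s , x))) ρ′ (off-tail e))
      (λ h d → from (Force-allAny xs F) λ ρ′ e → h ρ′ (off-cons e))

    all*-allAny : ∀ {s} (xs : List (Var s)) F → all* xs F ≡ allAny (List.map anyVar xs) F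
    all*-allAny []       F = refl
    all*-allAny (x ∷ xs) F = cong (all x) (all*-allAny xs F)

    Force-all* : ∀ {w s} (xs : List (Var s)) F {ρ} →
      Force w ρ (all* xs F) ⇔ (∀ ρ′ → AgreeOff (List.map anyVar xs) ρ ρ′ → Force w ρ′ F)
    Force-all* xs F rewrite all*-allAny xs F = Force-allAny (List.map anyVar xs) F

    Force-ex* : ∀ {w s} (xs : List (Var s)) F {ρ} →
      Force w ρ (ex* xs F) ⇔ (∃ λ ρ′ → AgreeOff (List.map anyVar xs) ρ ρ′ × Force w ρ′ F)
    Force-ex* []       F {ρ} = mk⇔ (λ h → ρ , (λ _ _ → refl) , h) λ (ρ′ , e , h) → from (Force-cong F λ {y} _ → e y λ ()) h
    Force-ex* {s = s} (x ∷ xs) F = mk⇔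
      (λ (d , h) → let (ρ′ , e , f) = to (Force-ex* xs F) h in ρ′ , off-cons e , f)
      (λ (ρ′ , e , f) → ρ′ (s , x) , from (Force-ex* xs F) (ρ′ , off-tail e , f))

    -- `Force-allAny` reaches only environments that agree with `ρ` off the free variables. For an
    -- arbitrary `ρ′`, the environment `mix ρ′` is one of these, and `F` cannot tell it from `ρ′`.
    Force-closure : ∀ {w} F {ρ} → Force w ρ (closure F) ⇔ (∀ ρ′ → Force w ρ′ F)
    Force-closure F {ρ} = mk⇔
      (λ h ρ′ → to (Force-cong F (agree ρ′)) (to (Force-allAny xs F) h (mix ρ′) (mixOff ρ′)))
      (λ h → from (Force-allAny xs F) λ ρ′ _ → h ρ′)
      where
      open import Data.List.Membership.DecPropositional _≟ⱽ_ using (_∈?_)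

      xs : List AnyVar
      xs = deduplicate _≟ⱽ_ (fv F)

      mix : Env → Env
      mix ρ′ y with y ∈? xs
      ... | yes _ = ρ′ y
      ... | no _  = ρ y

      mixOff : ∀ ρ′ → AgreeOff xs ρ (mix ρ′)
      mixOff ρ′ y y∉ with y ∈? xs
      ... | yes y∈ = contradiction y∈ y∉
      ... | no _   = refl

      agree : ∀ ρ′ → AgreeOn (fv F) (mix ρ′) ρ′
      agree ρ′ {y} y∈ with y ∈? xs
      ... | yes _ = refl
      ... | no y∉ = contradiction (∈-deduplicate⁺ _≟ⱽ_ y∈) y∉

-- The lexicographic order on tuples, and ascending chains

module TupleOrder (em : ExcludedMiddle 0ℓ) (𝒯 : PrecomputedTerms) where

  open PrecomputedTerms 𝒯 using (isTotalOrder)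
  open MiniGringo 𝒯

  infix 4 _<ⱽ_

  _<ⱽ_ : ∀ {n} → Vec P n → Vec P n → Set
  _<ⱽ_ = Lex-< _≡_ ⟦ lt ⟧ᵒ

  -- Precomputed terms come without decidable equality; `em` provides what turns the given total
  -- order into a trichotomous strict one.
  <ⱽ-isStrictTotalOrder : ∀ {n} → IsStrictTotalOrder (Pointwise _≡_) (_<ⱽ_ {n})
  <ⱽ-isStrictTotalOrder =
    Lex.<-isStrictTotalOrder (<-isStrictTotalOrder₁ _≡_ _ (λ _ _ → em) isTotalOrder)

  module _ {n : ℕ} where
    open IsStrictTotalOrder (<ⱽ-isStrictTotalOrder {n}) public
      using () renaming (trans to <ⱽ-trans; compare to <ⱽ-compare)

    <ⱽ⇒≢ : {xs ys : Vec P n} → xs <ⱽ ys → xs ≢ ys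
    <ⱽ⇒≢ xs<ys xs≡ys =
      IsStrictTotalOrder.irrefl <ⱽ-isStrictTotalOrder (≡⇒Pointwise-≡ xs≡ys) xs<ys

    insert : ∀ x {Δ} → AllPairs _<ⱽ_ Δ → x ∉ Δ → ∃ λ Δ′ → AllPairs (_<ⱽ_ {n}) Δ′ × Δ′ ↭ x ∷ Δ
    insert x {[]}    _ _ = x ∷ [] , [] ∷ [] , ↭-refl
    insert x {y ∷ Δ} (y<Δ ∷ s) x∉ with <ⱽ-compare x y
    ... | tri< x<y _ _ = x ∷ y ∷ Δ , (x<y ∷ All.map (<ⱽ-trans x<y) y<Δ) ∷ y<Δ ∷ s , ↭-refl
    ... | tri≈ _ x≋y _ = contradiction (here (Pointwise-≡⇒≡ x≋y)) x∉
    ... | tri> _ _ y<x =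
      let (Δ′ , s′ , p) = insert x s (x∉ ∘ there) in
      y ∷ Δ′ , All-resp-↭ (↭-sym p) (y<x ∷ y<Δ) ∷ s′ , ↭-trans (prep y p) (swap y x ↭-refl)

    -- Insertion sort. Distinctness of the members makes the result strictly ascending; the
    -- permutation is kept because it preserves the length and any property shared by all members.
    sort : ∀ {Δ} → Unique Δ → ∃ λ Δ′ → AllPairs (_<ⱽ_ {n}) Δ′ × Δ′ ↭ Δ
    sort []              = [] , [] , ↭-refl
    sort {x ∷ Δ} (x∉ ∷ u) =
      let (Δ₁ , s₁ , p₁) = sort u
          (Δ₂ , s₂ , p₂) = insert x s₁ λ x∈ → All.lookup (All-resp-↭ (↭-sym p₁) x∉) x∈ refl
      in Δ₂ , s₂ , ↭-trans p₂ (prep x p₁)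

  module _ {n : ℕ} (Q : Vec P n → Set) where

    -- A chain x = x₀ < ⋯ < x_k of k + 1 tuples.
    Ascending : Vec P n → ℕ → Set
    Ascending x zero    = Q x
    Ascending x (suc k) = Q x × ∃ λ u → x <ⱽ u × Ascending u k

    -- The meaning of Start(x, N) for N of either sign.
    Chain : Vec P n → ℤ → Set
    Chain x (+ zero)  = Unit
    Chain x (+ suc k) = Ascending x k
    Chain x -[1+ _ ]  = Unit

    -- A chain compares neighbours only; transitivity extends this to all pairs, and hence the
    -- members of a chain are distinct.
    ascending⇒sorted : ∀ {x} k → Ascending x k →
      ∃ λ Δ → List.length Δ ≡ k × AllPairs _<ⱽ_ (x ∷ Δ) × All Q (x ∷ Δ)
    ascending⇒sorted zero    q                 = [] , refl , [] ∷ [] , q ∷ []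
    ascending⇒sorted (suc k) (q , u , x<u , a) with ascending⇒sorted k a
    ... | Δ , refl , u<Δ ∷ s , qs =
      u ∷ Δ , refl , (x<u ∷ All.map (<ⱽ-trans x<u) u<Δ) ∷ u<Δ ∷ s , q ∷ qs

    sorted⇒ascending : ∀ {x} Δ → AllPairs _<ⱽ_ (x ∷ Δ) → All Q (x ∷ Δ) → Ascending x (List.length Δ)
    sorted⇒ascending []      _                  (q ∷ _)  = q
    sorted⇒ascending (u ∷ Δ) ((x<u ∷ _) ∷ s) (q ∷ qs) = q , u , x<u , sorted⇒ascending Δ s qs

    chain⇒set : ∀ {x} k → Chain x (+ k) → ∃ λ Δ → Unique Δ × List.length Δ ≡ k × All Q Δ
    chain⇒set zero    _ = [] , [] , refl , []
    chain⇒set {x} (suc k) a =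
      let (Δ , l , s , qs) = ascending⇒sorted k a in
      x ∷ Δ , AllPairs.map <ⱽ⇒≢ s , cong suc l , qs

    set⇒chain : ∀ {Δ} → Unique Δ → All Q Δ → ∃ λ x → Chain x (+ List.length Δ)
    set⇒chain u qs with sort u
    ... | Δ′ , s , p rewrite ≡.sym (↭-length p) with Δ′ | s | All-resp-↭ (↭-sym p) qs
    -- A chain of length 0 asks nothing of its first tuple, so any tuple serves.
    ...   | []     | _  | _   = Vec.replicate n (num (+ 0)) , _
    ...   | x ∷ Δ″ | s′ | qs′ = x , sorted⇒ascending Δ″ s′ qs′

  module _ {n : ℕ} {Q R : Vec P n → Set} (Q⇒R : ∀ {x} → Q x → R x) where

    ascending-map : ∀ {x} k → Ascending Q x k → Ascending R x k
    ascending-map zero    q                 = Q⇒R q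
    ascending-map (suc k) (q , u , x<u , a) = Q⇒R q , u , x<u , ascending-map k a

    chain-map : ∀ {x} k → Chain Q x k → Chain R x k
    chain-map (+ zero)  _ = _
    chain-map (+ suc k) a = ascending-map k a
    chain-map -[1+ _ ]  _ = _

  -- The value of the formula `<ˡᵉˣ`, a disjunction over the position of the first difference, as
  -- opposed to the recursive order `_<ⱽ_`.
  Lexicographic : ∀ {n} → Vec P n → Vec P n → Set
  Lexicographic {n} xs us = Σ (Fin n) λ l → ⟦ lt ⟧ᵒ (Vec.lookup xs l) (Vec.lookup us l) ×
    (∀ (k : Fin (toℕ l)) → Vec.lookup xs (inject k) ≡ Vec.lookup us (inject k))

  lexicographic⇔<ⱽ : ∀ {n} (xs us : Vec P n) → Lexicographic xs us ⇔ xs <ⱽ us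
  lexicographic⇔<ⱽ [] [] = mk⇔ (λ { (() , _) }) (λ { (base ()) })
  lexicographic⇔<ⱽ (x ∷ xs) (u ∷ us) = mk⇔
    (λ { (zero , x<u , _) → this x<u refl
       ; (suc l , x<u , e) → next (e zero) (to (lexicographic⇔<ⱽ xs us) (l , x<u , e ∘ suc)) })
    (λ { (this x<u _) → zero , x<u , λ ()
       ; (next x≡u xs<us) → let (l , x<u , e) = from (lexicographic⇔<ⱽ xs us) xs<us in
           suc l , x<u , λ { zero → x≡u ; (suc k) → e k } })

-- The here-and-there model of the count constants

module Model (em : ExcludedMiddle 0ℓ) (𝒯 : PrecomputedTerms)
  (Ext : World → Pred (Atom (PrecomputedTerms.Symbol 𝒯) (MiniGringo.P 𝒯)) 0ℓ)
  (Ext-mono : ∀ {v w} → v ≼ w → Ext v ⊆ Ext w) where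

  open PrecomputedTerms 𝒯
  open MiniGringo 𝒯
  open Environments 𝒯 public
  open TupleOrder em 𝒯 public
  open CountIndex using (X; V; F)

  𝓜₀ : World → (p : Pred₀) → Vec P (Signature.gens σ₀ p) → Vec ℤ 0 → Set
  𝓜₀ w (p / _) as           [] = Ext w (p ⟨ as ⟩)
  𝓜₀ w (ord r) (a ∷ b ∷ []) [] = ⟦ r ⟧ᵒ a b

  𝓜₀-mono : ∀ {v w} → v ≼ w → ∀ p {as is} → 𝓜₀ v p as is → 𝓜₀ w p as is
  𝓜₀-mono v≼w (p / _) {is = []}                h = Ext-mono v≼w h
  𝓜₀-mono v≼w (ord r) {as = _ ∷ _ ∷ []} {[]} h = h

  module K₀ = Forcing {σ₀} 𝓜₀ 𝓜₀-mono
  open K₀ public using () renaming (Force to Force₀)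

  module _ (w : World) (c : CountIndex) (v : Vec P (List.length (V c))) where

    -- That `F` holds of `x` and `v` at `w`. The environment is left open, since the free variables
    -- of `F` are among `X` and `V` and any environment with these values gives the same answer
    -- (`instance⇔Force`). Values are compared as lists, which later relates tuples whose lengths
    -- are only propositionally equal.
    Instance : Vec P (List.length (X c)) → Set
    Instance x = Σ Env λ ρ →
      values (X c) ρ ≡ Vec.toList x × values (V c) ρ ≡ Vec.toList v × Force₀ w ρ (F c)

    StartHolds : Vec P (List.length (X c)) → ℤ → Set
    StartHolds = Chain Instance

  -- These are the right-hand sides of `D₁`. Like the implication there, `AtmostHolds` looks at all
  -- later worlds: `F` may acquire instances at `there`, and an upper bound checked at `here` alone
  -- would not persist.
  AtleastHolds AtmostHolds : World → (c : CountIndex) → Vec P (List.length (V c)) → P → Set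
  AtleastHolds w c v y = ∃ λ x → ∃ λ n → StartHolds w c v x n × y ≤ num n
  AtmostHolds  w c v y = ∀ x n u → w ≼ u → StartHolds u c v x n → num n ≤ y

  instance-mono : ∀ {u w} → u ≼ w → ∀ c {v x} → Instance u c v x → Instance w c v x
  instance-mono u≼w c (ρ , eˣ , eᵛ , f) = ρ , eˣ , eᵛ , K₀.Force-mono u≼w (F c) f

  𝓜₂ : World → (p : Pred₂) → Vec P (Signature.gens σ₂ p) → Vec ℤ (Signature.ints σ₂ p) → Set
  𝓜₂ w (base p)    as is       = 𝓜₀ w p as is
  𝓜₂ w (Atleast c) as []       = AtleastHolds w c (Vec.take _ as) (Vec.head (Vec.drop (List.length (V c)) as))
  𝓜₂ w (Atmost c)  as []       = AtmostHolds w c (Vec.take _ as) (Vec.head (Vec.drop (List.length (V c)) as))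
  𝓜₂ w (Start c)   as (n ∷ []) = StartHolds w c (Vec.drop (List.length (X c)) as) (Vec.take _ as) n

  𝓜₂-mono : ∀ {v w} → v ≼ w → ∀ p {as is} → 𝓜₂ v p as is → 𝓜₂ w p as is
  𝓜₂-mono v≼w (base p)             h               = 𝓜₀-mono v≼w p h
  𝓜₂-mono v≼w (Atleast c) {is = []} (x , n , h , y) = x , n , chain-map (instance-mono v≼w c) n h , y
  𝓜₂-mono v≼w (Atmost c)  {is = []} h               = λ x n u w≼u → h x n u (≼-trans v≼w w≼u)
  𝓜₂-mono v≼w (Start c)   {is = n ∷ []} h           = chain-map (instance-mono v≼w c) n h

  module K₂ = Forcing {σ₂} 𝓜₂ 𝓜₂-mono
  open K₂ public

  Force-⌈⌉ : ∀ {w} F {ρ} → Force w ρ ⌈ F ⌉ ⇔ Force₀ w ρ F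
  Force-⌈⌉ (atom _ _ _) = ⇔-id _
  Force-⌈⌉ (_ ≐ _)      = ⇔-id _
  Force-⌈⌉ ⊥            = ⇔-id _
  Force-⌈⌉ (F ∧ G)      = Force-⌈⌉ F ×-⇔ Force-⌈⌉ G
  Force-⌈⌉ (F ∨ G)      = Force-⌈⌉ F ⊎-⇔ Force-⌈⌉ G
  Force-⌈⌉ (F ⇒ G)      = Π-⇔ λ v → Π-⇔ λ _ → →-⇔ (Force-⌈⌉ F) (Force-⌈⌉ G)
  Force-⌈⌉ (all x F)    = Π-⇔ λ d → Force-⌈⌉ F
  Force-⌈⌉ (ex x F)     = ∃-⇔ λ d → Force-⌈⌉ F

  module _ {𝓘 : Pred (Atom Symbol P) 0ℓ} where

    -- Without the symbols `p/n` a formula has the same value at both worlds, so Kripke implication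
    -- collapses to ordinary implication.
    Force₀-Sat : ∀ {w} F {ρ} → NoPredicateSymbol F → Force₀ w ρ F ⇔ Sat 𝓘 ρ F
    Force₀-Sat (atom (ord r) (_ ∷ _ ∷ []) []) _ = ⇔-id _
    Force₀-Sat (_ ≐ _)   _       = ⇔-id _
    Force₀-Sat ⊥         _       = ⇔-id _
    Force₀-Sat (F ∧ G)   (p , q) = Force₀-Sat F p ×-⇔ Force₀-Sat G q
    Force₀-Sat (F ∨ G)   (p , q) = Force₀-Sat F p ⊎-⇔ Force₀-Sat G q
    Force₀-Sat (F ⇒ G)   (p , q) = mk⇔
      (λ h f → to (Force₀-Sat G q) (h _ ≼-refl (from (Force₀-Sat F p) f)))
      (λ h v _ f → from (Force₀-Sat G q) (h (to (Force₀-Sat F p) f)))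
    Force₀-Sat (all x F) p       = Π-⇔ λ d → Force₀-Sat F p
    Force₀-Sat (ex x F)  p       = ∃-⇔ λ d → Force₀-Sat F p

  valuesⱽ : ∀ {n} → Vec (Var gen) n → Env → Vec P n
  valuesⱽ xs ρ = Vec.map (λ x → ρ (gen , x)) xs

  valuesˡ : (xs : List (Var gen)) → Env → Vec P (List.length xs)
  valuesˡ xs = valuesⱽ (Vec.fromList xs)

  toList-valuesⱽ : ∀ {n} (xs : Vec (Var gen) n) ρ → Vec.toList (valuesⱽ xs ρ) ≡ values (Vec.toList xs) ρ
  toList-valuesⱽ xs ρ = toList-map _ xs

  toList-valuesˡ : ∀ xs ρ → Vec.toList (valuesˡ xs ρ) ≡ values xs ρ
  toList-valuesˡ xs ρ =
    ≡.trans (toList-valuesⱽ (Vec.fromList xs) ρ) (cong (λ ys → values ys ρ) (toList∘fromList xs))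

  valuesˡ-cong : ∀ xs ρ ρ′ → (∀ {x} → x ∈ xs → ρ (gen , x) ≡ ρ′ (gen , x)) →
                 valuesˡ xs ρ ≡ valuesˡ xs ρ′
  valuesˡ-cong []       ρ ρ′ e = refl
  valuesˡ-cong (x ∷ xs) ρ ρ′ e = cong₂ _∷_ (e (here refl)) (valuesˡ-cong xs ρ ρ′ (e ∘ there))

  toList-cancel : ∀ {n} {as bs : Vec P n} → Vec.toList as ≡ Vec.toList bs → as ≡ bs
  toList-cancel {as = as} {bs} e = ≡.trans (≡.sym (cast-is-id refl as)) (toList-injective refl as bs e)

  extendⱽ : ∀ {n} {xs : Vec (Var gen) n} → Unique (Vec.toList xs) → ∀ (ds : Vec P n) ρ →
            ∃ λ ρ′ → AgreeOff (List.map anyVar (Vec.toList xs)) ρ ρ′ × valuesⱽ xs ρ′ ≡ ds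
  extendⱽ {xs = xs} u ds ρ = env , off ,
    toList-cancel (≡.trans (toList-valuesⱽ xs env) value)
    where
    open Extension (extend u (Vec.toList ds) (≡.trans (length-toList ds) (≡.sym (length-toList xs))) ρ)

  extendˡ : ∀ {xs} → Unique xs → ∀ (ds : Vec P (List.length xs)) ρ →
            ∃ λ ρ′ → AgreeOff (List.map anyVar xs) ρ ρ′ × valuesˡ xs ρ′ ≡ ds
  extendˡ {xs} u ds ρ = env , off ,
    toList-cancel (≡.trans (toList-valuesˡ xs env) value)
    where open Extension (extend u (Vec.toList ds) (length-toList ds) ρ)

  module _ {A : Set} {m n} (as : Vec A m) (bs : Vec A n) where

    take-++ : Vec.take m (as Vec.++ bs) ≡ as
    take-++ = ++-injectiveˡ _ as (take++drop≡id m (as Vec.++ bs))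

    drop-++ : Vec.drop m (as Vec.++ bs) ≡ bs
    drop-++ = ++-injectiveʳ _ as (take++drop≡id m (as Vec.++ bs))

  eval-vars : ∀ {n} (xs : Vec (Var gen) n) ρ → ⟦ Vec.map var xs ⟧ⱽ ρ ≡ valuesⱽ xs ρ
  eval-vars xs ρ = ≡.sym (map-∘ _ _ xs)

  eval-++ : ∀ {m n} (xs : Vec (Var gen) m) (ts : Vec (Tm gen) n) ρ →
            ⟦ Vec.map var xs Vec.++ ts ⟧ⱽ ρ ≡ valuesⱽ xs ρ Vec.++ ⟦ ts ⟧ⱽ ρ
  eval-++ xs ts ρ = ≡.trans (map-++ _ (Vec.map var xs) ts) (cong (Vec._++ _) (eval-vars xs ρ))

  Force-start : ∀ w ρ c xs n →
    Force w ρ (start c xs n) ≡ StartHolds w c (valuesˡ (V c) ρ) (valuesⱽ xs ρ) (⟦ n ⟧ ρ)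
  Force-start w ρ c xs n
    rewrite eval-++ xs (vars↑ (V c)) ρ | eval-vars (Vec.fromList (V c)) ρ
          | take-++ (valuesⱽ xs ρ) (valuesˡ (V c) ρ)
          | drop-++ (valuesⱽ xs ρ) (valuesˡ (V c) ρ) = refl

  BoundHolds : Bound → World → (c : CountIndex) → Vec P (List.length (V c)) → P → Set
  BoundHolds atleast = AtleastHolds
  BoundHolds atmost  = AtmostHolds

  Force-boundPred : ∀ {w} b c Y {ρ} →
    Force w ρ (boundPred b c Y) ≡ BoundHolds b w c (valuesˡ (V c) ρ) (⟦ Y ⟧ ρ)
  Force-boundPred atleast c Y {ρ}
    rewrite eval-++ (Vec.fromList (V c)) (Y ∷ []) ρ
          | take-++ (valuesˡ (V c) ρ) (⟦ Y ⟧ ρ ∷ [])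
          | drop-++ (valuesˡ (V c) ρ) (⟦ Y ⟧ ρ ∷ []) = refl
  Force-boundPred atmost c Y {ρ}
    rewrite eval-++ (Vec.fromList (V c)) (Y ∷ []) ρ
          | take-++ (valuesˡ (V c) ρ) (⟦ Y ⟧ ρ ∷ [])
          | drop-++ (valuesˡ (V c) ρ) (⟦ Y ⟧ ρ ∷ []) = refl

  -- The proof fields of `CountIndex` are irrelevant; `recompute` restores them because `em` decides
  -- the propositions.
  scoped : ∀ c → All (_∈ List.map anyVar (X c ++ V c)) (fv (F c))
  scoped record { scoped = s } = recompute em s

  distinct : ∀ c → Unique (X c ++ V c)
  distinct record { distinct = u } = recompute em u

  X-unique : ∀ c → Unique (X c)
  X-unique c = unique-++⁻ˡ (X c) (distinct c)

  V-X-disjoint : ∀ c {x} → x ∈ V c → x ∉ X c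
  V-X-disjoint c x∈V x∈X = unique-++⇒disjoint (X c) (distinct c) x∈X x∈V

  instance⇔Force : ∀ {w} c {ρ} → Instance w c (valuesˡ (V c) ρ) (valuesˡ (X c) ρ) ⇔ Force₀ w ρ (F c)
  instance⇔Force c {ρ} = mk⇔
    (λ (ρ′ , eˣ , eᵛ , f) → to (K₀.Force-cong (F c) (agree ρ′ eˣ eᵛ)) f)
    (λ f → ρ , ≡.sym (toList-valuesˡ (X c) ρ) , ≡.sym (toList-valuesˡ (V c) ρ) , f)
    where
    agree : ∀ ρ′ → values (X c) ρ′ ≡ Vec.toList (valuesˡ (X c) ρ) →
            values (V c) ρ′ ≡ Vec.toList (valuesˡ (V c) ρ) → AgreeOn (fv (F c)) ρ′ ρ
    agree ρ′ eˣ eᵛ {y} y∈ = values-injective (X c ++ V c) ρ′ ρ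
      (begin
        values (X c ++ V c) ρ′                ≡⟨ List.map-++ _ (X c) (V c) ⟩
        values (X c) ρ′ ++ values (V c) ρ′    ≡⟨ cong₂ _++_ (≡.trans eˣ (toList-valuesˡ (X c) ρ)) (≡.trans eᵛ (toList-valuesˡ (V c) ρ)) ⟩
        values (X c) ρ ++ values (V c) ρ      ≡⟨ List.map-++ _ (X c) (V c) ⟨
        values (X c ++ V c) ρ                 ∎)
      (All.lookup (scoped c) y∈)
      where open ≡.≡-Reasoning

  Force-⋁ : ∀ {w ρ n} (f : Fin n → Formula σ₂) →
            Force w ρ (⋁ (List.tabulate f)) ⇔ (∃ λ i → Force w ρ (f i))
  Force-⋁ {n = zero}  f = mk⇔ (λ ()) (λ { (() , _) })
  Force-⋁ {n = suc n} f = mk⇔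
    (λ { (inj₁ h) → zero , h ; (inj₂ h) → let (i , h′) = to (Force-⋁ (f ∘ suc)) h in suc i , h′ })
    (λ { (zero , h) → inj₁ h ; (suc i , h) → inj₂ (from (Force-⋁ (f ∘ suc)) (i , h)) })

  Force-⋀ : ∀ {w ρ n} (f : Fin n → Formula σ₂) →
            Force w ρ (⋀ (List.tabulate f)) ⇔ (∀ i → Force w ρ (f i))
  Force-⋀ {n = zero}  f = mk⇔ (λ _ ()) (λ _ _ _ ())
  Force-⋀ {n = suc n} f = mk⇔
    (λ { (h , hs) zero → h ; (h , hs) (suc i) → to (Force-⋀ (f ∘ suc)) hs i })
    (λ h → h zero , from (Force-⋀ (f ∘ suc)) (h ∘ suc))

  Force-<ˡᵉˣ : ∀ {w ρ n} (xs us : Vec (Var gen) n) →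
               Force w ρ (xs <ˡᵉˣ us) ⇔ valuesⱽ xs ρ <ⱽ valuesⱽ us ρ
  Force-<ˡᵉˣ {w} {ρ} xs us = lexicographic⇔<ⱽ _ _ ∘⇔ (∃-⇔ λ l →
      ≡⇒⇔ (cong₂ ⟦ lt ⟧ᵒ (look xs l) (look us l)) ×-⇔
      (Π-⇔ λ k → ≡⇒⇔ (cong₂ _≡_ (look xs (inject k)) (look us (inject k)))) ∘⇔ Force-⋀ _)
    ∘⇔ Force-⋁ _
    where
    look : ∀ {n} (ys : Vec (Var gen) n) i → ρ (gen , Vec.lookup ys i) ≡ Vec.lookup (valuesⱽ ys ρ) i
    look ys i = ≡.sym (lookup-map i _ ys)

  Force-⇔ᶠ : ∀ {w ρ} F G → (∀ v → w ≼ v → Force v ρ F ⇔ Force v ρ G) → Force w ρ (F ⇔ᶠ G)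
  Force-⇔ᶠ F G e = (λ v w≼v → to (e v w≼v)) , (λ v w≼v → from (e v w≼v))

  num-injective : ∀ {m n : ℤ} → _≡_ {A = P} (num m) (num n) → m ≡ n
  num-injective refl = refl

  num-≤⁻ : ∀ {m n} → num m ≤ num n → m ℤ.≤ n
  num-≤⁻ = to (num-order _ _)

  num-≤⁺ : ∀ {m n} → m ℤ.≤ n → num m ≤ num n
  num-≤⁺ = from (num-order _ _)

  num-< : ∀ {m n} → ⟦ lt ⟧ᵒ (num m) (num n) ⇔ m ℤ.< n
  num-< = mk⇔ (λ (m≤n , m≢n) → ℤ.≤∧≢⇒< (num-≤⁻ m≤n) (m≢n ∘ cong num))
              (λ m<n → num-≤⁺ (ℤ.<⇒≤ m<n) , ℤ.<⇒≢ m<n ∘ num-injective)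

  -- Soundness of the axioms

  module _ {n : ℕ} {Q : Vec P n → Set} where

    chain-≤0 : ∀ {x k} → k ℤ.≤ + 0 → Chain Q x k
    chain-≤0 {k = + zero}   _ = _
    chain-≤0 {k = + suc _} (ℤ.+≤+ ())
    chain-≤0 {k = -[1+ _ ]} _ = _

    -- For positive `k` this is the second clause of `Ascending`. At `k = 0` it could fail: the
    -- right side would demand a tuple above `x`, while a chain of length 1 asks only for `Q x`.
    chain-+1 : ∀ {x k} → + 0 ℤ.< k → Chain Q x (k ℤ.+ + 1) ⇔ (Q x × ∃ λ u → x <ⱽ u × Chain Q u k)
    chain-+1 {k = + suc k} _ rewrite ℕ.+-comm k 1 = ⇔-id _
    chain-+1 {k = + zero} (ℤ.+<+ ())

  gen-update : ∀ ρ (N : Var int) n {x : Var gen} → (ρ [ N ↦ n ]) (gen , x) ≡ ρ (gen , x)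
  gen-update ρ N n = update-other ρ N n λ ()

  D₀-sound : ∀ {c F} → D₀ c F → ∀ w ρ → Force w ρ F
  D₀-sound {c} (start≤0 N) w ρ = from (Force-all* (X c ++ V c) _) λ ρ′ _ n v _ n≤0 →
    from (≡⇒⇔ (Force-start v (ρ′ [ N ↦ n ]) c (Vec.fromList (X c)) (var N))) (chain-≤0 (num-≤⁻ n≤0))
  D₀-sound {c} start1 w ρ = from (Force-all* (X c ++ V c) _) λ ρ′ _ →
    Force-⇔ᶠ (start c (Vec.fromList (X c)) (numeral (+ 1))) ⌈ F c ⌉ λ v _ →
      ⇔-sym (Force-⌈⌉ (F c)) ∘⇔ instance⇔Force c {ρ′} ∘⇔
      ≡⇒⇔ (Force-start v ρ′ c (Vec.fromList (X c)) (numeral (+ 1)))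
  D₀-sound {c} (start+1 N U U-unique U-fresh) w ρ = from (Force-all* (X c ++ V c) _) λ ρ₁ _ n v _ n>0 →
    let ρ₂ = ρ₁ [ N ↦ n ] in
    Force-⇔ᶠ (start c (Vec.fromList (X c)) (var N +ᵗ numeral (+ 1))) (⌈ F c ⌉ ∧ ex* (Vec.toList U) _) λ u _ →
      (⇔-sym (Force-⌈⌉ (F c)) ∘⇔ instance⇔Force c {ρ₂} ×-⇔ tail u ρ₂)
      ∘⇔ chain-+1 (to num-< n>0)
      ∘⇔ ≡⇒⇔ (Force-start u ρ₂ c (Vec.fromList (X c)) (var N +ᵗ numeral (+ 1)))
    where
    fresh : ∀ {x} → x ∈ X c ++ V c → (gen , x) ∉ List.map anyVar (Vec.toList U)
    fresh x∈ x∈U = All.lookup U-fresh (gen∈⁻ x∈U) x∈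

    N-fresh : (int , N) ∉ List.map anyVar (Vec.toList U)
    N-fresh N∈ with ∈-map⁻ anyVar N∈
    ... | _ , _ , ()

    StartBy : World → Env → Env → Set
    StartBy u ρ₂ ρ₃ = valuesˡ (X c) ρ₂ <ⱽ valuesⱽ U ρ₃ ×
      StartHolds u c (valuesˡ (V c) ρ₂) (valuesⱽ U ρ₃) (ρ₂ (int , N))

    startBy : ∀ u ρ₂ ρ₃ → AgreeOff (List.map anyVar (Vec.toList U)) ρ₂ ρ₃ →
              StartBy u ρ₂ ρ₃ ⇔ Force u ρ₃ (Vec.fromList (X c) <ˡᵉˣ U ∧ start c U (var N))
    startBy u ρ₂ ρ₃ off
      rewrite valuesˡ-cong (X c) ρ₂ ρ₃ (λ x∈ → off _ (fresh (∈-++⁺ˡ x∈)))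
            | valuesˡ-cong (V c) ρ₂ ρ₃ (λ x∈ → off _ (fresh (∈-++⁺ʳ (X c) x∈)))
            | off (int , N) N-fresh
      = ⇔-sym (Force-<ˡᵉˣ (Vec.fromList (X c)) U) ×-⇔ ⇔-sym (≡⇒⇔ (Force-start u ρ₃ c U (var N)))

    tail : ∀ u ρ₂ →
      (∃ λ x → valuesˡ (X c) ρ₂ <ⱽ x × StartHolds u c (valuesˡ (V c) ρ₂) x (ρ₂ (int , N))) ⇔
      Force u ρ₂ (ex* (Vec.toList U) (Vec.fromList (X c) <ˡᵉˣ U ∧ start c U (var N)))
    tail u ρ₂ = ⇔-sym (Force-ex* (Vec.toList U) _) ∘⇔ mk⇔
      -- Distinctness of `U` lets an environment give these variables the members of `x`; their
      -- freshness keeps the values of `X`, `V` and `N`.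
      (λ (x , h) → let (ρ₃ , off , e) = extendⱽ U-unique x ρ₂ in
        ρ₃ , off , to (startBy u ρ₂ ρ₃ off) (subst (λ y → valuesˡ (X c) ρ₂ <ⱽ y ×
          StartHolds u c (valuesˡ (V c) ρ₂) y (ρ₂ (int , N))) (≡.sym e) h))
      (λ (ρ₃ , off , h) → valuesⱽ U ρ₃ , from (startBy u ρ₂ ρ₃ off) h)

  module _ (c : CountIndex) {ρ ρ′ : Env} (off : AgreeOff (List.map anyVar (X c)) ρ ρ′) where

    -- `ρ′` revalues only `X`, and `V` is disjoint from `X`, so the parameters can still be read
    -- from `ρ`; updating the integer variable `N` affects neither list.
    Force-start-under : ∀ {w} (N : Var int) n →
      Force w (ρ′ [ N ↦ n ]) (start c (Vec.fromList (X c)) (var N)) ≡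
      StartHolds w c (valuesˡ (V c) ρ) (valuesˡ (X c) ρ′) n
    Force-start-under {w} N n
      rewrite Force-start w (ρ′ [ N ↦ n ]) c (Vec.fromList (X c)) (var N)
            | update-same ρ′ N n
            | valuesˡ-cong (X c) (ρ′ [ N ↦ n ]) ρ′ (λ _ → gen-update ρ′ N n)
            | valuesˡ-cong (V c) (ρ′ [ N ↦ n ]) ρ (λ x∈ → ≡.trans (gen-update ρ′ N n)
                (≡.sym (off _ (V-X-disjoint c x∈ ∘ gen∈⁻)))) = refl

    bound-under : ∀ (N : Var int) n {Y : Var gen} → Y ∉ X c ++ V c →
      (ρ′ [ N ↦ n ]) (int , N) ≡ n × (ρ′ [ N ↦ n ]) (gen , Y) ≡ ρ (gen , Y)
    bound-under N n Y∉ = update-same ρ′ N n ,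
      ≡.trans (gen-update ρ′ N n) (≡.sym (off _ (Y∉ ∘ ∈-++⁺ˡ ∘ gen∈⁻)))

  D₁-sound : ∀ {c F} → D₁ c F → ∀ w ρ → Force w ρ F
  D₁-sound {c} (atleast-def N Y Y∉) w ρ = from (Force-all* (V c) _) λ ρ₁ _ d →
    let ρ = ρ₁ [ Y ↦ d ] in
    Force-⇔ᶠ (boundPred atleast c (var Y)) (ex* (X c) _) λ u _ →
      ⇔-sym (Force-ex* (X c) _) ∘⇔ mk⇔
        (λ (x , n , h , y≤n) → let (ρ′ , off , e) = extendˡ (X-unique c) x ρ
                                   (eᴺ , eʸ)      = bound-under c off N n Y∉ in
          ρ′ , off , n ,
          from (≡⇒⇔ (Force-start-under c off N n)) (subst (λ x → StartHolds u c _ x n) (≡.sym e) h) ,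
          ≡.subst₂ _≤_ (≡.sym eʸ) (cong num (≡.sym eᴺ)) y≤n)
        (λ (ρ′ , off , n , h , y≤n) → let (eᴺ , eʸ) = bound-under c off N n Y∉ in
          valuesˡ (X c) ρ′ , n , to (≡⇒⇔ (Force-start-under c off N n)) h ,
          ≡.subst₂ _≤_ eʸ (cong num eᴺ) y≤n)
      ∘⇔ ≡⇒⇔ (Force-boundPred atleast c (var Y))
  D₁-sound {c} (atmost-def N Y Y∉) w ρ = from (Force-all* (V c) _) λ ρ₁ _ d →
    let ρ = ρ₁ [ Y ↦ d ] in
    Force-⇔ᶠ (boundPred atmost c (var Y)) (all* (X c) _) λ u _ →
      ⇔-sym (Force-all* (X c) _) ∘⇔ mk⇔
        (λ h ρ′ off n v u≼v s → let (eᴺ , eʸ) = bound-under c off N n Y∉ in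
          ≡.subst₂ _≤_ (cong num (≡.sym eᴺ)) (≡.sym eʸ)
            (h (valuesˡ (X c) ρ′) n v u≼v (to (≡⇒⇔ (Force-start-under c off N n)) s)))
        (λ h x n v u≼v s → let (ρ′ , off , e) = extendˡ (X-unique c) x ρ
                               (eᴺ , eʸ)      = bound-under c off N n Y∉ in
          ≡.subst₂ _≤_ (cong num eᴺ) eʸ (h ρ′ off n v u≼v
            (from (≡⇒⇔ (Force-start-under c off N n)) (subst (λ x → StartHolds v c _ x n) (≡.sym e) s))))
      ∘⇔ ≡⇒⇔ (Force-boundPred atmost c (var Y))

  -- A term with no variable but `x` is never captured: a quantifier on `x` leaves no free `x` to
  -- replace, and any other binds a variable foreign to the term. This covers `0` and `N + 1` in the
  -- induction schema.
  freeFor : ∀ {s} {x : Var s} {t : Tm s} → (∀ {y} → y ∈ fvᵗ t → y ≡ (s , x)) →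
            (F : Formula σ₂) → FreeFor t x F
  freeFor h (atom _ _ _) = _
  freeFor h (_ ≐ _)      = _
  freeFor h ⊥            = _
  freeFor h (F ∧ G)      = freeFor h F , freeFor h G
  freeFor h (F ∨ G)      = freeFor h F , freeFor h G
  freeFor h (F ⇒ G)      = freeFor h F , freeFor h G
  freeFor {s} {x} h (all y F) with (_ , y) ≟ⱽ (s , x)
  ... | yes refl = inj₁ λ x∈ → proj₂ (∈-filter⁻ (λ z → ¬? (z ≟ⱽ (_ , x))) {xs = fv F} x∈) refl
  ... | no y≢x   = inj₂ (y≢x ∘ h , freeFor h F)
  freeFor {s} {x} h (ex y F) with (_ , y) ≟ⱽ (s , x)
  ... | yes refl = inj₁ λ x∈ → proj₂ (∈-filter⁻ (λ z → ¬? (z ≟ⱽ (_ , x))) {xs = fv F} x∈) refl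
  ... | no y≢x   = inj₂ (y≢x ∘ h , freeFor h F)

  -- In the standard domain the nonnegative integers are exactly the `+ k`, so induction on the
  -- natural number `k` validates the schema for every `F`. It runs at the later world `u` where the
  -- conclusion is asked for; persistence brings the base case there.
  induction-sound : ∀ {v} (N : Var int) F ρ → Force v ρ (F [ N ≔ numeral (+ 0) ]ᶠ) →
    Force v ρ (all N (relᵢ ge (var N) (numeral (+ 0)) ∧ F ⇒ (F [ N ≔ var N +ᵗ numeral (+ 1) ]ᶠ))) →
    Force v ρ (all N (relᵢ ge (var N) (numeral (+ 0)) ⇒ F))
  induction-sound {v} N F ρ f₀ f₊ d u v≼u 0≤d =
    go d (num-≤⁻ (subst (λ n → num (+ 0) ≤ num n) (update-same ρ N d) 0≤d))
    where
    resets-suc : ∀ k → Resets (var N +ᵗ numeral (+ 1)) N (ρ [ N ↦ + k ]) (ρ [ N ↦ + suc k ])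
    resets-suc k .Resets.at = ≡.trans (update-same ρ N (+ suc k))
      (≡.trans (cong +_ (≡.sym (ℕ.+-comm k 1))) (cong (ℤ._+ + 1) (≡.sym (update-same ρ N (+ k)))))
    resets-suc k .Resets.off y≢N =
      ≡.trans (update-other ρ N (+ k) y≢N) (≡.sym (update-other ρ N (+ suc k) y≢N))

    goℕ : ∀ k → Force u (ρ [ N ↦ + k ]) F
    goℕ zero = to (Force-subst F (freeFor (λ ()) F) (resets (numeral (+ 0)) N ρ)) (Force-mono v≼u (F [ N ≔ numeral (+ 0) ]ᶠ) f₀)
    goℕ (suc k) = to (Force-subst F (freeFor (λ { (here refl) → refl }) F) (resets-suc k))
      (f₊ (+ k) u v≼u (num-≤⁺ (subst (+ 0 ℤ.≤_) (≡.sym (update-same ρ N (+ k))) (ℤ.+≤+ ℕ.z≤n)) , goℕ k))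

    go : ∀ d → + 0 ℤ.≤ d → Force u (ρ [ N ↦ d ]) F
    go (+ k) _ = goℕ k

  -- If `G` fails at `there`, it fails everywhere. Otherwise, if `F` fails at `w`, the implication
  -- `F ⇒ G` is vacuous at `w`, and the only world strictly later is `there`, where `G` holds.
  hosoi-sound : ∀ w F G ρ → Force w ρ (F ∨ (F ⇒ G) ∨ (¬ᶠ G))
  hosoi-sound w F G ρ with em {Force w ρ F} | em {Force there ρ G}
  ... | yes f | _      = inj₁ f
  ... | no _  | no ¬g  = inj₂ (inj₂ λ v _ g → ¬g (Force-mono (≼-there v) G g))
  ... | no ¬f | yes g  = inj₂ (inj₁ λ { v ≼-refl f → contradiction f ¬f ; _ here≼there _ → g })

  default : ∀ s → Dom s
  default gen = num (+ 0)
  default int = + 0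

  Force-rebind : ∀ {w s} {x : Var s} F {ρ d e} → Force w (ρ [ x ↦ e ]) F → Force w ((ρ [ x ↦ d ]) [ x ↦ e ]) F
  Force-rebind {x = x} F {ρ} {d} = to (Force-cong F λ {y} _ →
    update-cong x ρ (ρ [ x ↦ d ]) y λ y≢x → ≡.sym (update-other ρ x d y≢x))

  -- The witness is an element at which `F` fails at `there`, hence at every world; if there is
  -- none, one at which `F` fails at `w`, where the implication is vacuous while `all x F` holds at
  -- `there`.
  sqht-sound : ∀ w {s} (x : Var s) F ρ → Force w ρ (ex x (F ⇒ all x F))
  sqht-sound w {s} x F ρ with em {∃ λ d → ¬ Force there (ρ [ x ↦ d ]) F} | em {∃ λ d → ¬ Force w (ρ [ x ↦ d ]) F}
  ... | yes (d , ¬f) | _ = d , λ v _ f → contradiction (Force-mono (≼-there v) F f) ¬f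
  ... | no ∄there | yes (d , ¬f) = d , λ
    { v ≼-refl f → contradiction f ¬f
    ; _ here≼there _ e → Force-rebind F (decidable-stable em λ ¬f′ → ∄there (e , ¬f′)) }
  -- Now `all x F` already holds at `w`, and any element of the nonempty domain will do.
  ... | no _ | no ∄w = default s , λ v w≼v _ e →
    Force-rebind F (Force-mono w≼v F (decidable-stable em λ ¬f → ∄w (e , ¬f)))

  axiom-sound : ∀ {F} → Axiom F → ∀ w ρ → Force w ρ F
  axiom-sound (hosoi F G) w ρ = hosoi-sound w F G ρ
  axiom-sound (sqht x F)  w ρ = sqht-sound w x F ρ
  axiom-sound (std F (_ , noPred , valid)) w ρ =
    from (Force-⌈⌉ F) (from (Force₀-Sat F noPred) (valid (Ext w) ρ))
  axiom-sound (ind N F)   w ρ = from (Force-closure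
      ((F [ N ≔ numeral (+ 0) ]ᶠ)
       ∧ all N (relᵢ ge (var N) (numeral (+ 0)) ∧ F ⇒ (F [ N ≔ var N +ᵗ numeral (+ 1) ]ᶠ))
       ⇒ all N (relᵢ ge (var N) (numeral (+ 0)) ⇒ F)))
    λ ρ′ v _ (f₀ , f₊) → induction-sound N F ρ′ f₀ f₊
  axiom-sound (d₀ c F d)  w ρ = D₀-sound d w ρ
  axiom-sound (d₁ c F d)  w ρ = D₁-sound d w ρ

  -- Soundness of the deductive system

  asGen-injective : ∀ {s} (t u : Tm s) {ρ} → ⟦ asGen t ⟧ ρ ≡ ⟦ asGen u ⟧ ρ → ⟦ t ⟧ ρ ≡ ⟦ u ⟧ ρ
  asGen-injective {gen} t u e = e
  asGen-injective {int} t u e = num-injective e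

  weaken-context : ∀ {Γ w s} {x : Var s} {d ρ} → All (λ H → (s , x) ∉ fv H) Γ →
                   All (Force w ρ) Γ → All (Force w (ρ [ x ↦ d ])) Γ
  weaken-context []       []       = []
  weaken-context {H ∷ _} {ρ = ρ} (n ∷ ns) (h ∷ hs) = to (Force-weaken H {ρ} n) h ∷ weaken-context ns hs

  soundness : ∀ {Γ F} → Γ ⊢ F → ∀ w ρ → All (Force w ρ) Γ → Force w ρ F
  soundness (axiom a)      w ρ γ = axiom-sound a w ρ
  soundness (assume F∈)    w ρ γ = All.lookup γ F∈
  soundness (⊥-E p)        w ρ γ = Empty-elim (soundness p w ρ γ)
  soundness (∧-I p q)      w ρ γ = soundness p w ρ γ , soundness q w ρ γ
  soundness (∧-E₁ p)       w ρ γ = proj₁ (soundness p w ρ γ)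
  soundness (∧-E₂ p)       w ρ γ = proj₂ (soundness p w ρ γ)
  soundness (∨-I₁ p)       w ρ γ = inj₁ (soundness p w ρ γ)
  soundness (∨-I₂ p)       w ρ γ = inj₂ (soundness p w ρ γ)
  soundness (∨-E p q r)    w ρ γ with soundness p w ρ γ
  ... | inj₁ f = soundness q w ρ (f ∷ γ)
  ... | inj₂ g = soundness r w ρ (g ∷ γ)
  soundness (⇒-I p)        w ρ γ = λ v w≼v f → soundness p v ρ (f ∷ All.map (λ {H} → Force-mono w≼v H) γ)
  soundness (⇒-E p q)      w ρ γ = soundness p w ρ γ w ≼-refl (soundness q w ρ γ)
  soundness (all-I n p)    w ρ γ = λ d → soundness p w _ (weaken-context n γ)
  soundness (all-E {x = x} {F} t f p) w ρ γ =
    from (Force-subst F f (resets t x ρ)) (soundness p w ρ γ (⟦ t ⟧ ρ))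
  soundness (ex-I {x = x} {F} t f p) w ρ γ =
    ⟦ t ⟧ ρ , to (Force-subst F f (resets t x ρ)) (soundness p w ρ γ)
  soundness (ex-E {G = G} n x∉G p q) w ρ γ with soundness p w ρ γ
  ... | d , f = from (Force-weaken G x∉G) (soundness q w _ (f ∷ weaken-context n γ))
  soundness ≐-refl w ρ γ = refl
  soundness (≐-subst {x = x} {F} t u f g p q) w ρ γ =
    from (Force-subst F g (resets u x ρ))
      (subst (λ d → Force w (ρ [ x ↦ d ]) F) (asGen-injective t u (soundness p w ρ γ))
        (to (Force-subst F f (resets t x ρ)) (soundness q w ρ γ)))

-- Integer division

module Arithmetic where

  Quotient : (m n k : ℤ) → Set
  Quotient m n k = k ℤ.* + ℤ.∣ n ∣ ℤ.≤ + ℤ.∣ m ∣ × + ℤ.∣ m ∣ ℤ.< (k ℤ.+ + 1) ℤ.* + ℤ.∣ n ∣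

  -- The inequalities rule out division by zero by themselves: for `n = 0` the second would read
  -- `∣ m ∣ < 0`.
  quotient⇔ : ∀ m n k → Quotient m n k ⇔ Σ (ℤ.NonZero n) λ nz → k ≡ + (ℕ._/_ ℤ.∣ m ∣ ℤ.∣ n ∣ {{nz}})
  quotient⇔ m n k = mk⇔ (fwd k) λ { (nz , refl) → bwd nz }
    where
    a b : ℕ
    a = ℤ.∣ m ∣
    b = ℤ.∣ n ∣

    toℕ-≤ : ∀ i → + i ℤ.* + b ℤ.≤ + a → i ℕ.* b ℕ.≤ a
    toℕ-≤ i h = ℤ.drop‿+≤+ (subst (ℤ._≤ + a) (≡.sym (ℤ.pos-* i b)) h)

    toℕ-< : ∀ i → + a ℤ.< (+ i ℤ.+ + 1) ℤ.* + b → a ℕ.< suc i ℕ.* b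
    toℕ-< i h = subst (λ j → a ℕ.< j ℕ.* b) (ℕ.+-comm i 1)
      (ℤ.drop‿+<+ (subst (+ a ℤ.<_) (≡.sym (ℤ.pos-* (i ℕ.+ 1) b)) h))

    fwd : ∀ k → Quotient m n k → Σ (ℤ.NonZero n) λ nz → k ≡ + (ℕ._/_ a b {{nz}})
    fwd (+ i) (lo , hi) = nz , cong +_ (ℕ.≤-antisym
        (subst (ℕ._≤ a ℕ./ b) (ℕ.m*n/n≡m i b) (ℕ./-monoˡ-≤ b (toℕ-≤ i lo)))
        (ℕ.s≤s⁻¹ (ℕ.m<n*o⇒m/o<n {a} {suc i} {b} (toℕ-< i hi))))
      where
      instance
        nz : ℕ.NonZero b
        nz = ℕ.≢-nonZero λ b≡0 → ℕ.n≮0 (subst (a ℕ.<_) (≡.trans (cong (suc i ℕ.*_) b≡0) (ℕ.*-zeroʳ (suc i))) (toℕ-< i hi))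
    -- For negative `k` the number `k + 1` is at most 0, so the upper bound on `∣ m ∣` would be
    -- nonpositive.
    fwd -[1+ i ] (lo , hi) = contradiction (ℤ.<-≤-trans hi (≤0 i b)) λ { (ℤ.+<+ ()) }
      where
      ≤0 : ∀ i b → (-[1+ i ] ℤ.+ + 1) ℤ.* + b ℤ.≤ + 0
      ≤0 zero    b       = ℤ.≤-refl
      ≤0 (suc i) zero    = subst (ℤ._≤ + 0) (≡.sym (ℤ.*-zeroʳ -[1+ i ])) ℤ.≤-refl
      ≤0 (suc i) (suc b) = ℤ.-≤+

    bwd : (nz : ℕ.NonZero b) → Quotient m n (+ (ℕ._/_ a b {{nz}}))
    bwd nz = subst (ℤ._≤ + a) (ℤ.pos-* q b) (ℤ.+≤+ (ℕ.m/n*n≤m a b)) ,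
      subst (+ a ℤ.<_) (ℤ.pos-* (q ℕ.+ 1) b) (ℤ.+<+ a<)
      where
      instance _ = nz
      q : ℕ
      q = a ℕ./ b
      a< : a ℕ.< (q ℕ.+ 1) ℕ.* b
      a< = begin-strict
        a                    ≡⟨ ℕ.m≡m%n+[m/n]*n a b ⟩
        a ℕ.% b ℕ.+ q ℕ.* b  <⟨ ℕ.+-monoˡ-< (q ℕ.* b) (ℕ.m%n<n a b) ⟩
        suc q ℕ.* b          ≡⟨ cong (ℕ._* b) (ℕ.+-comm 1 q) ⟩
        (q ℕ.+ 1) ℕ.* b      ∎
        where open ℕ.≤-Reasoning

  module _ (𝒯 : PrecomputedTerms) where
    open MiniGringo 𝒯 using (round)

    -- Both `m * n` and `round m n` attach the product of the signs to a natural number. A minus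
    -- sign with a nonnegative product occurs only when that product is 0, and then the quotient is
    -- 0 too; this is what the hypothesis on `a` and `q` records.
    ◃-nonneg : ∀ s a q → (a ≡ 0 → q ≡ 0) → + 0 ℤ.≤ s ◃ a → s ◃ q ≡ + q
    ◃-nonneg Sign.+ a q _ _ = ℤ.+◃n≡+n q
    ◃-nonneg Sign.- zero q h _ rewrite h refl = refl
    ◃-nonneg Sign.- (suc a) q _ ()

    ◃-neg : ∀ s a q → s ◃ a ℤ.< + 0 → s ◃ q ≡ + 0 ℤ.- + q
    ◃-neg Sign.+ zero q (ℤ.+<+ ())
    ◃-neg Sign.+ (suc a) q (ℤ.+<+ ())
    ◃-neg Sign.- a q _ = ≡.trans (ℤ.-◃n≡-n q) (≡.sym (ℤ.+-identityˡ (ℤ.- + q)))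

    module _ (m n : ℤ) (nz : ℤ.NonZero n) where
      instance _ = nz

      round-nonneg : + 0 ℤ.≤ m ℤ.* n → round m n ≡ + (ℤ.∣ m ∣ ℕ./ ℤ.∣ n ∣)
      round-nonneg = ◃-nonneg (sign m Sign.* sign n) (ℤ.∣ m ∣ ℕ.* ℤ.∣ n ∣) (ℤ.∣ m ∣ ℕ./ ℤ.∣ n ∣) λ e →
        ≡.trans (ℕ./-congˡ (ℕ.m*n≡0⇒m≡0 ℤ.∣ m ∣ ℤ.∣ n ∣ e)) (ℕ.0/n≡0 ℤ.∣ n ∣)

      round-neg : m ℤ.* n ℤ.< + 0 → round m n ≡ + 0 ℤ.- + (ℤ.∣ m ∣ ℕ./ ℤ.∣ n ∣)
      round-neg = ◃-neg (sign m Sign.* sign n) (ℤ.∣ m ∣ ℕ.* ℤ.∣ n ∣) (ℤ.∣ m ∣ ℕ./ ℤ.∣ n ∣)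

    remainder-neg : ∀ m n k → m ℤ.- n ℤ.* (+ 0 ℤ.- k) ≡ m ℤ.+ k ℤ.* n
    remainder-neg m n k = cong (λ j → m ℤ.+ j) (begin
      ℤ.- (n ℤ.* (+ 0 ℤ.- k))   ≡⟨ cong (λ j → ℤ.- (n ℤ.* j)) (ℤ.+-identityˡ (ℤ.- k)) ⟩
      ℤ.- (n ℤ.* (ℤ.- k))       ≡⟨ cong ℤ.-_ (ℤ.neg-distribʳ-* n k) ⟨
      ℤ.- (ℤ.- (n ℤ.* k))       ≡⟨ ℤ.neg-involutive (n ℤ.* k) ⟩
      n ℤ.* k                   ≡⟨ ℤ.*-comm n k ⟩
      k ℤ.* n                   ∎)
      where open ≡.≡-Reasoning

-- Terms and literals under the two translations

module Translation (em : ExcludedMiddle 0ℓ) (𝒯 : PrecomputedTerms)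
  (Ext : World → Pred (Atom (PrecomputedTerms.Symbol 𝒯) (MiniGringo.P 𝒯)) 0ℓ)
  (Ext-mono : ∀ {v w} → v ≼ w → Ext v ⊆ Ext w) where

  open PrecomputedTerms 𝒯
  open IsTotalOrder isTotalOrder using () renaming (refl to ≤-refl; trans to ≤-trans; antisym to ≤-antisym; total to ≤-total)
  open MiniGringo 𝒯
  open Semantics em
  open Model em 𝒯 Ext Ext-mono
  open Arithmetic
  module Inf = Infinitary (Atom Symbol P)
  open Inf using (InfFormula)

  Holds : World → InfFormula → Set
  Holds w (Inf.atom a)  = Ext w a
  Holds w Inf.⊥         = Empty
  Holds w (Inf.⋀ F)     = ∀ i → Holds w (F i)
  Holds w (Inf.⋁ F)     = ∃ λ i → Holds w (F i)
  Holds w (F Inf.⇒ G)   = ∀ v → w ≼ v → Holds v F → Holds v G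

  Holds-⋀ˡ-∷ : ∀ {w F Fs} → Holds w (Inf.⋀ˡ (F ∷ Fs)) ⇔ (Holds w F × Holds w (Inf.⋀ˡ Fs))
  Holds-⋀ˡ-∷ = mk⇔ (λ h → h zero , h ∘ suc) (λ { (h , hs) zero → h ; (h , hs) (suc i) → hs i })

  programValues : Env → Assignment
  programValues ρ x = ρ (gen , prog x)

  BySign : P → ℤ → ℤ → ℤ → ℤ → Set
  BySign r m n a b = (num (+ 0) ≤ num (m ℤ.* n) × r ≡ num a) ⊎
                     (⟦ lt ⟧ᵒ (num (m ℤ.* n)) (num (+ 0)) × r ≡ num b)

  QuotientMeaning : ℤ → ℤ → ℤ → Set
  QuotientMeaning m n k = num (k ℤ.* + ℤ.∣ n ∣) ≤ num (+ ℤ.∣ m ∣) ×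
                          ⟦ lt ⟧ᵒ (num (+ ℤ.∣ m ∣)) (num ((k ℤ.+ + 1) ℤ.* + ℤ.∣ n ∣))

  OpMeaning : Op → P → ℤ → ℤ → ℤ → Set
  OpMeaning add      r m n k = r ≡ num (m ℤ.+ n)
  OpMeaning sub      r m n k = r ≡ num (m ℤ.- n)
  OpMeaning mul      r m n k = r ≡ num (m ℤ.* n)
  OpMeaning div      r m n k = QuotientMeaning m n k × BySign r m n k (+ 0 ℤ.- k)
  OpMeaning mod      r m n k = QuotientMeaning m n k × BySign r m n (m ℤ.- k ℤ.* n) (m ℤ.+ k ℤ.* n)
  OpMeaning interval r m n k = (num m ≤ num k × num k ≤ num n) × r ≡ num k

  Force-val-op : ∀ {w ρ} op {Z I J K} →
    Force₀ w ρ (val-op op Z I J K) ⇔ OpMeaning op (⟦ Z ⟧ ρ) (⟦ I ⟧ ρ) (⟦ J ⟧ ρ) (⟦ K ⟧ ρ)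
  Force-val-op add      = ⇔-id _
  Force-val-op sub      = ⇔-id _
  Force-val-op mul      = ⇔-id _
  Force-val-op div      = ⇔-id _
  Force-val-op mod      = ⇔-id _
  Force-val-op interval = ⇔-id _

  OpMeaning-cong : ∀ op {r r′ m m′ n n′ k k′} → r ≡ r′ → m ≡ m′ → n ≡ n′ → k ≡ k′ →
                   OpMeaning op r m n k ⇔ OpMeaning op r′ m′ n′ k′
  OpMeaning-cong op refl refl refl refl = ⇔-id _

  bySign⇔ : ∀ {r} m n {a b q} → (+ 0 ℤ.≤ m ℤ.* n → q ≡ a) → (m ℤ.* n ℤ.< + 0 → q ≡ b) →
            BySign r m n a b ⇔ r ≡ num q
  bySign⇔ {r} m n {a} {b} {q} nonneg neg = mk⇔
    (λ { (inj₁ (h , refl)) → cong num (≡.sym (nonneg (num-≤⁻ h)))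
       ; (inj₂ (h , refl)) → cong num (≡.sym (neg (to num-< h))) })
    bwd
    where
    bwd : r ≡ num q → BySign r m n a b
    bwd e with + 0 ℤ.≤? m ℤ.* n
    ... | yes h = inj₁ (num-≤⁺ h , ≡.trans e (cong num (nonneg h)))
    ... | no h  = inj₂ (from num-< (ℤ.≰⇒> h) , ≡.trans e (cong num (neg (ℤ.≰⇒> h))))

  quotientMeaning⇔ : ∀ m n k → QuotientMeaning m n k ⇔ Σ (ℤ.NonZero n) λ nz → k ≡ + (ℕ._/_ ℤ.∣ m ∣ ℤ.∣ n ∣ {{nz}})
  quotientMeaning⇔ m n k = quotient⇔ m n k ∘⇔ (num-order _ _ ×-⇔ num-<)

  div⇔ : ∀ r m n → (∃ λ k → OpMeaning div r m n k) ⇔ OpValue div m n r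
  div⇔ r m n = mk⇔ fwd λ (nz , e) →
    + (ℕ._/_ ℤ.∣ m ∣ ℤ.∣ n ∣ {{nz}}) , from (quotientMeaning⇔ m n _) (nz , refl) , from (rounded nz) e
    where
    rounded : ∀ nz → let q = + (ℕ._/_ ℤ.∣ m ∣ ℤ.∣ n ∣ {{nz}}) in
              BySign r m n q (+ 0 ℤ.- q) ⇔ r ≡ num (round m n {{nz}})
    rounded nz = bySign⇔ m n (round-nonneg 𝒯 m n nz) (round-neg 𝒯 m n nz)
    fwd : (∃ λ k → OpMeaning div r m n k) → OpValue div m n r
    fwd (k , q , s) with to (quotientMeaning⇔ m n k) q
    ... | nz , refl = nz , to (rounded nz) s

  mod⇔ : ∀ r m n → (∃ λ k → OpMeaning mod r m n k) ⇔ OpValue mod m n r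
  mod⇔ r m n = mk⇔ fwd λ (nz , e) →
    + (ℕ._/_ ℤ.∣ m ∣ ℤ.∣ n ∣ {{nz}}) , from (quotientMeaning⇔ m n _) (nz , refl) , from (rounded nz) e
    where
    rounded : ∀ nz → let q = + (ℕ._/_ ℤ.∣ m ∣ ℤ.∣ n ∣ {{nz}}) in
              BySign r m n (m ℤ.- q ℤ.* n) (m ℤ.+ q ℤ.* n) ⇔ r ≡ num (m ℤ.- n ℤ.* round m n {{nz}})
    rounded nz = bySign⇔ m n
      (λ h → cong (λ j → m ℤ.- j) (≡.trans (cong (n ℤ.*_) (round-nonneg 𝒯 m n nz h)) (ℤ.*-comm n q)))
      (λ h → ≡.trans (cong (λ j → m ℤ.- n ℤ.* j) (round-neg 𝒯 m n nz h)) (remainder-neg 𝒯 m n q))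
      where
      q : ℤ
      q = + (ℕ._/_ ℤ.∣ m ∣ ℤ.∣ n ∣ {{nz}})
    fwd : (∃ λ k → OpMeaning mod r m n k) → OpValue mod m n r
    fwd (k , q , s) with to (quotientMeaning⇔ m n k) q
    ... | nz , refl = nz , to (rounded nz) s

  interval⇔ : ∀ r m n → (∃ λ k → OpMeaning interval r m n k) ⇔ OpValue interval m n r
  interval⇔ r m n = ∃-⇔ λ k → mk⇔
    (λ ((m≤k , k≤n) , e) → num-≤⁻ m≤k , num-≤⁻ k≤n , e)
    (λ (m≤k , k≤n , e) → (num-≤⁺ m≤k , num-≤⁺ k≤n) , e)

  -- `val n` binds integer variables only from index `n` on, so under this condition its quantifiers
  -- leave the value of `Z` alone.
  Below : ℕ → Tm gen → Set
  Below n Z = ∀ k → n ℕ.≤ k → (int , ivar k) ∉ fvᵗ Z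

  below-ivar : ∀ {n k} → k ℕ.< n → Below n (↑ var (ivar k))
  below-ivar k<n j n≤j (here refl) = ℕ.<⇒≱ k<n n≤j

  ⟦⟧-below : ∀ {n k ρ d} Z → Below n Z → n ℕ.≤ k → ⟦ Z ⟧ (ρ [ ivar k ↦ d ]) ≡ ⟦ Z ⟧ ρ
  ⟦⟧-below {k = k} {ρ} {d} Z b n≤k = ⟦⟧-cong Z λ y∈ → update-other ρ (ivar k) d λ { refl → b k n≤k y∈ }

  ivar-≢ : ∀ {j k} → j ≢ k → _≢_ {A = AnyVar} (int , ivar j) (int , ivar k)
  ivar-≢ j≢k refl = j≢k refl

  Force-val : ∀ {w} n t {Z ρ} → Below n Z →
              Force₀ w ρ (val n t Z) ⇔ [ inst (programValues ρ) t ] (⟦ Z ⟧ ρ)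
  Force-val n (pre (num _))   b = ⇔-id _
  Force-val n (pre (sym _))   b = ⇔-id _
  Force-val n (pre (other _)) b = ⇔-id _
  Force-val n (var x)         b = ⇔-id _
  Force-val n (abs t) {Z} {ρ} b = ∃-⇔ λ d →
    let i≡d = update-same ρ (ivar n) d in
    ≡⇒⇔ (cong [ inst (programValues ρ) t ] (cong num i≡d)) ∘⇔ Force-val (1 ℕ.+ n) t (below-ivar ℕ.≤-refl)
    ×-⇔ ≡⇒⇔ (cong₂ (λ r j → r ≡ num (+ ℤ.∣ j ∣)) (⟦⟧-below Z b ℕ.≤-refl) i≡d)
  Force-val {w} n (bin op t u) {Z} {ρ} b = byOp op
    where
    i j k : Var int
    i = ivar n
    j = ivar (1 ℕ.+ n)
    k = ivar (2 ℕ.+ n)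

    ρ₂ : ℤ → ℤ → Env
    ρ₂ p q = (ρ [ i ↦ p ]) [ j ↦ q ]

    ρ₃ : ℤ → ℤ → ℤ → Env
    ρ₃ p q r = ρ₂ p q [ k ↦ r ]

    i₂ : ∀ p q → ρ₂ p q (int , i) ≡ p
    i₂ p q = ≡.trans (update-other (ρ [ i ↦ p ]) j q (ivar-≢ (ℕ.<⇒≢ ℕ.≤-refl))) (update-same ρ i p)

    j₂ : ∀ p q → ρ₂ p q (int , j) ≡ q
    j₂ p q = update-same (ρ [ i ↦ p ]) j q

    Z₂ : ∀ p q → ⟦ Z ⟧ (ρ₂ p q) ≡ ⟦ Z ⟧ ρ
    Z₂ p q = ≡.trans (⟦⟧-below Z b (ℕ.n≤1+n n)) (⟦⟧-below Z b ℕ.≤-refl)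

    i₃ : ∀ p q r → ρ₃ p q r (int , i) ≡ p
    i₃ p q r = ≡.trans (update-other (ρ₂ p q) k r (ivar-≢ (ℕ.<⇒≢ (ℕ.n≤1+n (suc n))))) (i₂ p q)

    j₃ : ∀ p q r → ρ₃ p q r (int , j) ≡ q
    j₃ p q r = ≡.trans (update-other (ρ₂ p q) k r (ivar-≢ (ℕ.<⇒≢ ℕ.≤-refl))) (j₂ p q)

    k₃ : ∀ p q r → ρ₃ p q r (int , k) ≡ r
    k₃ p q r = update-same (ρ₂ p q) k r

    Z₃ : ∀ p q r → ⟦ Z ⟧ (ρ₃ p q r) ≡ ⟦ Z ⟧ ρ
    Z₃ p q r = ≡.trans (⟦⟧-below Z b (ℕ.m≤n+m n 2)) (Z₂ p q)

    left : ∀ ρ′ {p} → ρ′ (int , i) ≡ p →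
           Force₀ w ρ′ (val (3 ℕ.+ n) t (↑ var i)) ⇔ [ inst (programValues ρ′) t ] (num p)
    left ρ′ refl = Force-val (3 ℕ.+ n) t (below-ivar (ℕ.m≤n+m (suc n) 2))

    right : ∀ ρ′ {q} → ρ′ (int , j) ≡ q →
            Force₀ w ρ′ (val (3 ℕ.+ n) u (↑ var j)) ⇔ [ inst (programValues ρ′) u ] (num q)
    right ρ′ refl = Force-val (3 ℕ.+ n) u (below-ivar (ℕ.m≤n+m (2 ℕ.+ n) 1))

    Body : Op → Formula σ₀
    Body op = val (3 ℕ.+ n) t (↑ var i) ∧ val (3 ℕ.+ n) u (↑ var j) ∧ val-op op Z (var i) (var j) (var k)

    binary : ∀ op → (∀ r p q k → OpMeaning op r p q k ⇔ OpValue op p q r) →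
      Force₀ w ρ (ex i (ex j (Body op))) ⇔ [ inst (programValues ρ) (bin op t u) ] (⟦ Z ⟧ ρ)
    binary op e = ∃-⇔ λ p → ∃-⇔ λ q →
      left (ρ₂ p q) (i₂ p q) ×-⇔ right (ρ₂ p q) (j₂ p q) ×-⇔
      (e _ _ _ _ ∘⇔ OpMeaning-cong op (Z₂ p q) (i₂ p q) (j₂ p q) refl ∘⇔ Force-val-op {ρ = ρ₂ p q} op)

    ternary : ∀ op → (∀ r p q → (∃ λ k → OpMeaning op r p q k) ⇔ OpValue op p q r) →
      Force₀ w ρ (ex i (ex j (ex k (Body op)))) ⇔ [ inst (programValues ρ) (bin op t u) ] (⟦ Z ⟧ ρ)
    ternary op e = ∃-⇔ λ p → ∃-⇔ λ q → (⇔-id _ ×-⇔ (⇔-id _ ×-⇔ e _ p q))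
      -- The values of the two operands do not depend on the third bound variable, so its quantifier
      -- moves inward to the operation.
      ∘⇔ mk⇔ (λ (r , x , y , z) → x , y , r , z) (λ (x , y , r , z) → r , x , y , z)
      ∘⇔ ∃-⇔ λ r →
        left (ρ₃ p q r) (i₃ p q r) ×-⇔ right (ρ₃ p q r) (j₃ p q r) ×-⇔
        (OpMeaning-cong op (Z₃ p q r) (i₃ p q r) (j₃ p q r) (k₃ p q r) ∘⇔ Force-val-op {ρ = ρ₃ p q r} op)

    byOp : ∀ op → Force₀ w ρ (val n (bin op t u) Z) ⇔ [ inst (programValues ρ) (bin op t u) ] (⟦ Z ⟧ ρ)
    byOp add      = binary add λ _ _ _ _ → ⇔-id _
    byOp sub      = binary sub λ _ _ _ _ → ⇔-id _
    byOp mul      = binary mul λ _ _ _ _ → ⇔-id _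
    byOp div      = ternary div div⇔
    byOp mod      = ternary mod mod⇔
    byOp interval = ternary interval interval⇔

  below-var : ∀ {n} (z : Var gen) → Below n (var z)
  below-var z k _ (here ())
  below-var z k _ (there ())

  Force-valⱽ : ∀ {w n} (ts : Vec (Term ProgVar) n) (zs : Vec (Var gen) n) {ρ} →
    Force₀ w ρ (valⱽ ts (Vec.map var zs)) ⇔ [ Vec.map (inst (programValues ρ)) ts ]ⱽ (valuesⱽ zs ρ)
  Force-valⱽ []       []       = mk⇔ (λ _ → []) (λ _ _ _ ())
  Force-valⱽ (t ∷ ts) (z ∷ zs) =
    mk⇔ (λ (h , hs) → h ∷ hs) (λ { (h ∷ hs) → h , hs })
    ∘⇔ (Force-val 0 t (below-var z) ×-⇔ Force-valⱽ ts zs)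

  module _ {α β : Assignment} where

    inst-cong : ∀ t → (∀ {x} → x ∈ vars t → α x ≡ β x) → inst α t ≡ inst β t
    inst-cong (pre _)      e = refl
    inst-cong (var x)      e = cong pre (e (here refl))
    inst-cong (abs t)      e = cong abs (inst-cong t e)
    inst-cong (bin op t u) e =
      cong₂ (bin op) (inst-cong t (e ∘ ∈-++⁺ˡ)) (inst-cong u (e ∘ ∈-++⁺ʳ (vars t)))

    instⱽ-cong : ∀ {n} (ts : Vec (Term ProgVar) n) → (∀ {x} → x ∈ varsⱽ ts → α x ≡ β x) →
                 Vec.map (inst α) ts ≡ Vec.map (inst β) ts
    instⱽ-cong []       e = refl
    instⱽ-cong (t ∷ ts) e = cong₂ _∷_ (inst-cong t (e ∘ ∈-++⁺ˡ)) (instⱽ-cong ts (e ∘ ∈-++⁺ʳ (vars t)))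

    instᴮ-cong : ∀ B → (∀ {x} → x ∈ varsᴮ B → α x ≡ β x) → instᴮ α B ≡ instᴮ β B
    instᴮ-cong (lit s (p ⟨ ts ⟩)) e = cong (λ us → lit s (p ⟨ us ⟩)) (instⱽ-cong ts e)
    instᴮ-cong (cmp c t u)        e =
      cong₂ (cmp c) (inst-cong t (e ∘ ∈-++⁺ˡ)) (inst-cong u (e ∘ ∈-++⁺ʳ (vars t)))

    instᴸ-cong : ∀ L → (∀ {x} → x ∈ varsᴸ L → α x ≡ β x) → List.map (instᴮ α) L ≡ List.map (instᴮ β) L
    instᴸ-cong []      e = refl
    instᴸ-cong (B ∷ L) e = cong₂ _∷_ (instᴮ-cong B (e ∘ ∈-++⁺ˡ)) (instᴸ-cong L (e ∘ ∈-++⁺ʳ (varsᴮ B)))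

  auxs-unique : ∀ n → Unique (Vec.toList (auxs n))
  auxs-unique n = subst Unique (tabulate-toList (aux ∘ toℕ)) (Unique.tabulate⁺ (λ e → toℕ-injective (aux-injective e)))
    where
    aux-injective : ∀ {i j} → aux i ≡ aux j → i ≡ j
    aux-injective refl = refl
    tabulate-toList : ∀ {n} (f : Fin n → Var gen) → List.tabulate f ≡ Vec.toList (Vec.tabulate f)
    tabulate-toList {zero}  f = refl
    tabulate-toList {suc n} f = cong (f zero ∷_) (tabulate-toList (f ∘ suc))

  prog∉auxs : ∀ n {x} → (gen , prog x) ∉ List.map anyVar (Vec.toList (auxs n))
  prog∉auxs n = go (aux ∘ toℕ) λ _ ()
    where
    go : ∀ {n} (f : Fin n → Var gen) → (∀ i {x} → f i ≢ prog x) → ∀ {x} →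
         (gen , prog x) ∉ List.map anyVar (Vec.toList (Vec.tabulate f))
    go {suc n} f ≢ (here e)   = ≢ zero (≡.sym (var-injective e))
      where
      var-injective : ∀ {x y : Var gen} → _≡_ {A = AnyVar} (gen , x) (gen , y) → x ≡ y
      var-injective refl = refl
    go {suc n} f ≢ (there x∈) = go (f ∘ suc) (≢ ∘ suc) x∈

  Force-negated : ∀ {w ρ} s p {n} (zs : Vec (Var gen) n) →
    Force₀ w ρ (negatedᶠ s (atom (p / n) (Vec.map var zs) [])) ⇔
    Holds w (negated s (Inf.atom (p ⟨ valuesⱽ zs ρ ⟩)))
  Force-negated {ρ = ρ} none   p zs rewrite eval-vars zs ρ = ⇔-id _
  Force-negated {ρ = ρ} not    p zs rewrite eval-vars zs ρ = ⇔-id _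
  Force-negated {ρ = ρ} notnot p zs rewrite eval-vars zs ρ = ⇔-id _

  Holds-decided : ∀ {w} {A : Set} (A? : Dec A) → Holds w (if does A? then Inf.⊤ else Inf.⊥) ⇔ A
  Holds-decided (yes a) = mk⇔ (λ _ → a) (λ _ _ _ ())
  Holds-decided (no ¬a) = mk⇔ (λ ()) ¬a

  -- The `aux` variables carry the tuple of values over which the infinitary disjunction ranges;
  -- being no program variables, they do not affect the ground instance. A comparison has the same
  -- value at both worlds, and `em` has already replaced it by `⊤` or `⊥` in `τ`.
  Force-τᴮ : ∀ {w} B {ρ} → Force₀ w ρ (τᴮ B) ⇔ Holds w (τ-basic (instᴮ (programValues ρ) B))
  Force-τᴮ {w} (lit s (_⟨_⟩ p {n} ts)) {ρ} = mk⇔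
      (λ (ρ′ , off , h , l) →
        (valuesⱽ (auxs n) ρ′ , subst (λ us → [ us ]ⱽ _) (same ρ′ off) (to (Force-valⱽ ts (auxs n)) h)) ,
        to (Force-negated s p (auxs n)) l)
      bwd
    ∘⇔ K₀.Force-ex* (Vec.toList (auxs n)) _
    where
    same : ∀ ρ′ → AgreeOff (List.map anyVar (Vec.toList (auxs n))) ρ ρ′ →
           Vec.map (inst (programValues ρ′)) ts ≡ Vec.map (inst (programValues ρ)) ts
    same ρ′ off = instⱽ-cong ts λ _ → ≡.sym (off _ (prog∉auxs n))

    bwd : Holds w (τ-basic (instᴮ (programValues ρ) (lit s (p ⟨ ts ⟩)))) →
          ∃ λ ρ′ → AgreeOff (List.map anyVar (Vec.toList (auxs n))) ρ ρ′ ×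
            Force₀ w ρ′ (valⱽ ts (Vec.map var (auxs n)) ∧ negatedᶠ s (atom (p / n) (Vec.map var (auxs n)) []))
    bwd ((r , r∈) , l) with extendⱽ (auxs-unique n) r ρ
    ... | ρ′ , off , refl = ρ′ , off ,
      from (Force-valⱽ ts (auxs n)) (subst (λ us → [ us ]ⱽ _) (≡.sym (same ρ′ off)) r∈) ,
      from (Force-negated s p (auxs n)) l
  Force-τᴮ (cmp c t u) {ρ} = ⇔-sym (Holds-decided em) ∘⇔ ∃-⇔ λ a → ∃-⇔ λ b →
    Force-val 0 t (below-var (aux 0)) ×-⇔ Force-val 0 u (below-var (aux 1)) ×-⇔ comparison c a b
    where
    comparison : ∀ {w} c a b → let ρ′ = (ρ [ aux 0 ↦ a ]) [ aux 1 ↦ b ] in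
                 Force₀ w ρ′ (compare c (var (aux 0)) (var (aux 1))) ⇔ ⟦ c ⟧ᶜ a b
    comparison eq      a b = ⇔-id _
    comparison (ord r) a b = ⇔-id _

  Force-τᴸ : ∀ {w} L {ρ} → Force₀ w ρ (τᴸ L) ⇔ Holds w (τ-conj (List.map (instᴮ (programValues ρ)) L))
  Force-τᴸ []      = mk⇔ (λ _ ()) (λ _ _ _ ())
  Force-τᴸ (B ∷ L) = ⇔-sym Holds-⋀ˡ-∷ ∘⇔ (Force-τᴮ B ×-⇔ Force-τᴸ L)

  -- Aggregate elements: chains against finite sets

  withProgramValues : Assignment → Env → Env
  withProgramValues α ρ (gen , prog x) = α x
  withProgramValues α ρ (gen , aux i)  = ρ (gen , aux i)
  withProgramValues α ρ (int , x)      = ρ (int , x)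

  module _ {A B : Set} {b c : B} (A? : Dec A) where

    if-true : A → (if does A? then b else c) ≡ b
    if-true p = cong (if_then b else c) (dec-true A? p)

    if-false : ¬ A → (if does A? then b else c) ≡ c
    if-false ¬p = cong (if_then b else c) (dec-false A? ¬p)

  module _ {α : Assignment} where

    assign-other : ∀ xs cs {y} → y ∉ xs → (α [ xs ≔ cs ]) y ≡ α y
    assign-other []       []           y∉ = refl
    assign-other (x ∷ xs) (c ∷ cs) {y} y∉ =
      ≡.trans (if-false (y ℕ.≟ x) (y∉ ∘ here)) (assign-other xs cs (y∉ ∘ there))

    assign-map : ∀ xs cs {β : Assignment} {y} → Vec.toList cs ≡ List.map β xs → y ∈ xs →
                 (α [ xs ≔ cs ]) y ≡ β y
    assign-map (x ∷ xs) (c ∷ cs) {y = y} e y∈ with y ℕ.≟ x | y∈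
    ... | yes refl | _         = ≡.trans (if-true (y ℕ.≟ x) refl) (List.∷-injectiveˡ e)
    ... | no y≢x   | here y≡x  = contradiction y≡x y≢x
    ... | no y≢x   | there y∈′ =
      ≡.trans (if-false (y ℕ.≟ x) y≢x) (assign-map xs cs (List.∷-injectiveʳ e) y∈′)

    assign-values : ∀ {xs} → Unique xs → ∀ cs → List.map (α [ xs ≔ cs ]) xs ≡ Vec.toList cs
    assign-values []                []       = refl
    assign-values {x ∷ xs} (x∉ ∷ u) (c ∷ cs) = cong₂ _∷_ (if-true (x ℕ.≟ x) refl)
      (≡.trans (List.map-cong-local (All.map (λ {y} x≢y → if-false (y ℕ.≟ x) (x≢y ∘ ≡.sym)) x∉))
               (assign-values u cs))

  values-prog : ∀ xs ρ → values (List.map prog xs) ρ ≡ List.map (programValues ρ) xs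
  values-prog xs ρ = ≡.sym (List.map-∘ xs)

  prog∈⁻ : ∀ {x xs} → (gen , prog x) ∈ List.map anyVar (List.map prog xs) → x ∈ xs
  prog∈⁻ x∈ with ∈-map⁻ prog (gen∈⁻ x∈)
  ... | _ , x∈xs , refl = x∈xs

  module _ (G : List ProgVar) (a : AggregateAtom) (pure : PureIn G (count a)) where
    open AggregateAtom a using (L) renaming (X to Xs; distinct to Xs-unique)
    open import Data.List.Membership.DecPropositional ℕ._≟_ using (_∈?_)

    private
      c  = countIndex G a pure
      Vs = 𝐕 G a
      Ws = 𝐖 G a

    𝐕⊆G : ∀ {x} → x ∈ Vs → x ∈ G
    𝐕⊆G x∈ = proj₂ (∈-filter⁻ (_∈? G) {xs = deduplicate ℕ._≟_ (varsᴸ L)} x∈)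

    -- Each variable of `L` is in `X`, valued by the tuple, in `𝐖`, valued by the existential
    -- witness, or in `𝐕`, valued by `ρ`. Purity keeps `X` apart from the globals, so writing the
    -- tuple into `X` does not disturb `𝐕`. The tuples `x` and `x′` differ in type: their lengths
    -- are those of `map prog X` and `X`.
    instance⇔holdsFor : ∀ {w ρ x x′} → Vec.toList x ≡ Vec.toList x′ →
      Instance w c (valuesˡ (List.map prog Vs) ρ) x ⇔ Holds w (holdsFor G (programValues ρ) a x′)
    instance⇔holdsFor {w} {ρ} {x} {x′} x≡x′ = mk⇔ fwd bwd
      where
      α : Assignment
      α = programValues ρ

      fwd : Instance w c (valuesˡ (List.map prog Vs) ρ) x → Holds w (holdsFor G α a x′)
      fwd (ρ₁ , eˣ , eᵛ , f) with to (K₀.Force-ex* (List.map prog Ws) (τᴸ L)) f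
      ... | ρ₂ , off , h = ws , subst (λ L′ → Holds w (τ-conj L′)) (instᴸ-cong L agree) (to (Force-τᴸ L) h)
        where
        ws : Vec P (List.length Ws)
        ws = Vec.map (programValues ρ₂) (Vec.fromList Ws)

        ws-values : Vec.toList ws ≡ List.map (programValues ρ₂) Ws
        ws-values = ≡.trans (toList-map _ (Vec.fromList Ws)) (cong (List.map _) (toList∘fromList Ws))

        x′-values : Vec.toList x′ ≡ List.map (programValues ρ₁) Xs
        x′-values = ≡.trans (≡.sym x≡x′) (≡.trans (≡.sym eˣ) (values-prog Xs ρ₁))

        ρ₁≡ρ₂ : ∀ {y} → y ∉ Ws → programValues ρ₁ y ≡ programValues ρ₂ y
        ρ₁≡ρ₂ y∉ = off _ (y∉ ∘ prog∈⁻)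

        agree-local : ∀ {y} → y ∈ varsᴸ L → y ∉ Ws → programValues ρ₁ y ≡ (α [ Xs ≔ x′ ]) y
        agree-local {y} y∈ y∉W with y ∈? Xs | Scoping.split G a y∈
        ... | yes y∈X | _        = ≡.sym (assign-map Xs x′ x′-values y∈X)
        ... | no _    | inj₁ y∈W = contradiction y∈W y∉W
        ... | no y∉X  | inj₂ y∈XV with ∈-++⁻ Xs y∈XV
        ...   | inj₁ y∈X = contradiction y∈X y∉X
        ...   | inj₂ y∈V = ≡.trans
          (values-injective (List.map prog Vs) ρ₁ ρ (≡.trans eᵛ (toList-valuesˡ (List.map prog Vs) ρ))
            (∈-map⁺ anyVar (∈-map⁺ prog y∈V)))
          (≡.sym (assign-other Xs x′ y∉X))

        agree : ∀ {y} → y ∈ varsᴸ L → programValues ρ₂ y ≡ ((α [ Xs ≔ x′ ]) [ Ws ≔ ws ]) y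
        agree {y} y∈ with y ∈? Ws
        ... | yes y∈W = ≡.sym (assign-map Ws ws ws-values y∈W)
        ... | no y∉W  = ≡.trans (≡.sym (ρ₁≡ρ₂ y∉W))
          (≡.trans (agree-local y∈ y∉W) (≡.sym (assign-other Ws ws y∉W)))

      bwd : Holds w (holdsFor G α a x′) → Instance w c (valuesˡ (List.map prog Vs) ρ) x
      bwd (ws , h) = ρ₁ , eˣ , eᵛ , from (K₀.Force-ex* (List.map prog Ws) (τᴸ L)) (ρ₂ , off , from (Force-τᴸ L) h)
        where
        ρ₁ ρ₂ : Env
        ρ₁ = withProgramValues (α [ Xs ≔ x′ ]) ρ
        ρ₂ = withProgramValues ((α [ Xs ≔ x′ ]) [ Ws ≔ ws ]) ρ

        eˣ : values (List.map prog Xs) ρ₁ ≡ Vec.toList x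
        eˣ = ≡.trans (values-prog Xs ρ₁) (≡.trans (assign-values Xs-unique x′) (≡.sym x≡x′))

        eᵛ : values (List.map prog Vs) ρ₁ ≡ Vec.toList (valuesˡ (List.map prog Vs) ρ)
        eᵛ = ≡.trans (≡.trans (values-prog Vs ρ₁) (≡.trans (List.map-cong-local (All.tabulate λ y∈ →
            assign-other Xs x′ λ y∈X → All.lookup pure y∈X (𝐕⊆G y∈)))
          (≡.sym (values-prog Vs ρ)))) (≡.sym (toList-valuesˡ (List.map prog Vs) ρ))

        off : AgreeOff (List.map anyVar (List.map prog Ws)) ρ₁ ρ₂
        off (gen , prog y) y∉ = ≡.sym (assign-other Ws ws λ y∈ → y∉ (∈-map⁺ anyVar (∈-map⁺ prog y∈)))
        off (gen , aux i)  _  = refl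
        off (int , y)      _  = refl

  module _ {n : ℕ} (Q : Vec P n → Set) (y : P) where

    -- The members of a chain form a set of the same size, and sorting turns a set into a chain. The
    -- bound `y` may be any precomputed term, so it is compared with sizes through the order only.
    atleast⇔ : (∃ λ x → ∃ λ k → Chain Q x k × y ≤ num k) ⇔
               (Σ (∃ λ (Δ : FiniteSet (Vec P n)) → y ≤ num (+ List.length (proj₁ Δ))) λ ((Δ , _) , _) →
                  ∀ ((x , _) : ∃ (_∈ Δ)) → Q x)
    atleast⇔ = mk⇔ fwd bwd
      where
      fwd : _ → _
      fwd (x , + k , h , y≤k) with chain⇒set Q k h
      ... | Δ , u , refl , qs = ((Δ , u) , y≤k) , λ (x , x∈) → All.lookup qs x∈
      -- Chains of negative length hold trivially; `y` is then below 0, the size of the empty set.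
      fwd (x , -[1+ k ] , h , y≤k) =
        (([] , []) , ≤-trans y≤k (num-≤⁺ ℤ.-≤+)) , λ { (_ , ()) }
      bwd : _ → _
      bwd (((Δ , u) , y≤k) , qs) =
        let (x , h) = set⇒chain Q u (All.tabulate λ x∈ → qs (_ , x∈)) in x , _ , h , y≤k

    atmost⇔ : (∀ x k → Chain Q x k → num k ≤ y) ⇔
              (∀ (((Δ , _) , _) : ∃ λ (Δ : FiniteSet (Vec P n)) → ⟦ gt ⟧ᵒ (num (+ List.length (proj₁ Δ))) y) →
                 (∀ ((x , _) : ∃ (_∈ Δ)) → Q x) → Empty)
    atmost⇔ = mk⇔ fwd bwd
      where
      fwd : _ → _
      fwd h ((Δ , u) , y≤k , y≢k) qs =
        let (x , c) = set⇒chain Q u (All.tabulate λ x∈ → qs (_ , x∈)) in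
        y≢k (≤-antisym y≤k (h x _ c))

      exceeds : ∀ {k} → ¬ (num k ≤ y) → ⟦ gt ⟧ᵒ (num k) y
      exceeds {k} k≰y with ≤-total y (num k)
      ... | inj₁ y≤k = y≤k , λ { refl → k≰y ≤-refl }
      ... | inj₂ k≤y = contradiction k≤y k≰y

      bwd : _ → _
      bwd h x (+ k) c = decidable-stable em λ k≰y →
        let (Δ , u , l , qs) = chain⇒set Q k c in
        h ((Δ , u) , exceeds (subst (λ j → ¬ (num (+ j) ≤ y)) (≡.sym l) k≰y)) λ (x , x∈) → All.lookup qs x∈
      -- The hypothesis at the empty set excludes `y < 0`, so `y` lies above every negative numeral.
      bwd h x -[1+ k ] c = ≤-trans (num-≤⁺ ℤ.-≤+)
        (decidable-stable em λ 0≰y → h (([] , []) , exceeds 0≰y) λ { (_ , ()) })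

  chain-cong : ∀ {m n} → m ≡ n → {Q : Vec P m → Set} {R : Vec P n → Set} →
    (∀ {x x′} → Vec.toList x ≡ Vec.toList x′ → Q x ⇔ R x′) →
    ∀ {x x′} k → Vec.toList x ≡ Vec.toList x′ → Chain Q x k ⇔ Chain R x′ k
  chain-cong refl Q⇔R {x} {x′} k x≡x′ with toList-cancel {as = x} {x′} x≡x′
  ... | refl = mk⇔ (chain-map (to (Q⇔R refl)) k) (chain-map (from (Q⇔R refl)) k)

  module _ {m n : ℕ} (m≡n : m ≡ n) {Q : Vec P m → Set} {R : Vec P n → Set}
           (Q⇔R : ∀ {x x′} → Vec.toList x ≡ Vec.toList x′ → Q x ⇔ R x′) where

    atleast-cong : ∀ {y} → (∃ λ x → ∃ λ k → Chain Q x k × y ≤ num k) ⇔ (∃ λ x → ∃ λ k → Chain R x k × y ≤ num k)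
    atleast-cong = mk⇔
      (λ (x , k , h , y≤k) → Vec.cast m≡n x , k , to (chain-cong m≡n Q⇔R k (≡.sym (toList-cast m≡n x))) h , y≤k)
      (λ (x , k , h , y≤k) → Vec.cast (≡.sym m≡n) x , k , from (chain-cong m≡n Q⇔R k (toList-cast (≡.sym m≡n) x)) h , y≤k)

    atmost-cong : ∀ {y} → (∀ x k → Chain Q x k → num k ≤ y) ⇔ (∀ x k → Chain R x k → num k ≤ y)
    atmost-cong = mk⇔
      (λ h x k c → h (Vec.cast (≡.sym m≡n) x) k (from (chain-cong m≡n Q⇔R k (toList-cast (≡.sym m≡n) x)) c))
      (λ h x k c → h (Vec.cast m≡n x) k (to (chain-cong m≡n Q⇔R k (≡.sym (toList-cast m≡n x))) c))

  Force-boundPred-count : ∀ {w} G a (pure : PureIn G (count a)) b Y {ρ} →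
    Force w ρ (boundPred b (countIndex G a pure) Y) ⇔ Holds w (τ-count G (programValues ρ) a b (⟦ Y ⟧ ρ))
  Force-boundPred-count {w} G a pure b Y {ρ} = bound b ∘⇔ ≡⇒⇔ (Force-boundPred b (countIndex G a pure) Y)
    where
    c : CountIndex
    c = countIndex G a pure

    holds : World → Tuple G (programValues ρ) a → Set
    holds u x = Holds u (holdsFor G (programValues ρ) a x)

    lengths : List.length (CountIndex.X c) ≡ List.length (AggregateAtom.X a)
    lengths = List.length-map prog (AggregateAtom.X a)

    bound : ∀ b → BoundHolds b w c (valuesˡ (CountIndex.V c) ρ) (⟦ Y ⟧ ρ) ⇔
                  Holds w (τ-count G (programValues ρ) a b (⟦ Y ⟧ ρ))
    bound atleast = atleast⇔ (holds w) (⟦ Y ⟧ ρ) ∘⇔ atleast-cong lengths (instance⇔holdsFor G a pure {ρ = ρ})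
    bound atmost  =
      -- Both sides look at later worlds, one after choosing a chain, the other after choosing a
      -- set. With the world moved outermost, `atmost⇔` applies at a fixed world.
      mk⇔ (λ h i u w≼u → h u w≼u i) (λ h u w≼u i → h i u w≼u)
      ∘⇔ (Π-⇔ λ u → Π-⇔ λ _ →
            atmost⇔ (holds u) (⟦ Y ⟧ ρ) ∘⇔ atmost-cong lengths (instance⇔holdsFor G a pure {ρ = ρ}))
      ∘⇔ mk⇔ (λ h u w≼u x k → h x k u w≼u) (λ h x k u w≼u → h u w≼u x k)

  -- Rules and programs

  Force-element : ∀ {w} G B (pure : PureIn G B) {ρ} →
    Force w ρ (τ*-element G B pure) ⇔ Holds w (τ-element G (programValues ρ) B)
  Force-element G (basic B) _    = Force-τᴮ B ∘⇔ Force-⌈⌉ (τᴮ B)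
  Force-element G (count a) pure {ρ} =
    mk⇔ (λ (r , v , h) → (r , v) , h) (λ ((r , v) , h) → r , v , h)
    ∘⇔ ∃-⇔ λ r →
      (Force-val 0 bound (below-var (aux 0)) ∘⇔ Force-⌈⌉ (val 0 bound (var (aux 0))))
      ×-⇔ Force-boundPred-count G a pure (AggregateAtom.rel a) (var (aux 0)) {ρ [ aux 0 ↦ r ]}
    where open AggregateAtom a using (bound)

  Force-body : ∀ {w} G Bs (pure : All (PureIn G) Bs) {ρ} →
    Force w ρ (τ*-body G Bs pure) ⇔ Holds w (τ-body G (programValues ρ) Bs)
  Force-body G []       []       = mk⇔ (λ _ ()) (λ _ _ _ ())
  Force-body G (B ∷ Bs) (p ∷ ps) = ⇔-sym Holds-⋀ˡ-∷ ∘⇔ (Force-element G B p ×-⇔ Force-body G Bs ps)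

  -- An environment must value every `aux` variable, but a head of arity `n` mentions only the first
  -- `n`; the value 0 beyond them is filler.
  nth : ∀ {n} → Vec P n → ℕ → P
  nth []       _       = num (+ 0)
  nth (r ∷ rs) zero    = r
  nth (r ∷ rs) (suc i) = nth rs i

  nth-toℕ : ∀ {n} (rs : Vec P n) i → nth rs (toℕ i) ≡ Vec.lookup rs i
  nth-toℕ (r ∷ rs) zero    = refl
  nth-toℕ (r ∷ rs) (suc i) = nth-toℕ rs i

  instanceEnv : ∀ {n} → Assignment → Vec P n → Env
  instanceEnv α rs (gen , prog x) = α x
  instanceEnv α rs (gen , aux i)  = nth rs i
  instanceEnv α rs (int , _)      = + 0

  values-instanceEnv : ∀ {n} α (rs : Vec P n) → valuesⱽ (auxs n) (instanceEnv α rs) ≡ rs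
  values-instanceEnv α rs = ≡.trans (≡.sym (tabulate-∘ _ _))
    (≡.trans (tabulate-cong (nth-toℕ rs)) (tabulate∘lookup rs))

  -- The program variables of an environment select the rule instance, its aux variables
  -- the value of the head.
  instances⇔ : ∀ {w n} (ts : Vec (Term ProgVar) n) (Body Goal : Formula σ₂)
    (body : Assignment → InfFormula) (head : Vec P n → InfFormula) →
    (∀ {v ρ} → Force v ρ Body ⇔ Holds v (body (programValues ρ))) →
    (∀ {v ρ} → Force v ρ Goal ⇔ Holds v (head (valuesⱽ (auxs n) ρ))) →
    (∀ ρ → Force w ρ (Body ∧ ⌈ valⱽ ts (Vec.map var (auxs n)) ⌉ ⇒ Goal)) ⇔
    (∀ α → Holds w (body α Inf.⇒ Inf.⋀ {∃ [ Vec.map (inst α) ts ]ⱽ} λ (r , _) → head r))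
  instances⇔ {w} {n} ts Body Goal body head Body⇔ Goal⇔ = mk⇔ fwd
    λ h ρ v w≼v (b , z) → from Goal⇔ (h (programValues ρ) v w≼v (to Body⇔ b) (_ , to value⇔ z))
    where
    value⇔ : ∀ {v ρ} → Force v ρ ⌈ valⱽ ts (Vec.map var (auxs n)) ⌉ ⇔
                       [ Vec.map (inst (programValues ρ)) ts ]ⱽ (valuesⱽ (auxs n) ρ)
    value⇔ = Force-valⱽ ts (auxs n) ∘⇔ Force-⌈⌉ (valⱽ ts (Vec.map var (auxs n)))

    fwd : _ → _
    fwd h α v w≼v b (r , r∈) = subst (λ r → Holds v (head r)) e
      (to Goal⇔ (h ρ v w≼v (from Body⇔ b , from value⇔ (subst [ Vec.map (inst α) ts ]ⱽ (≡.sym e) r∈))))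
      where
      ρ : Env
      ρ = instanceEnv α r
      e : valuesⱽ (auxs n) ρ ≡ r
      e = values-instanceEnv α r

  Force-atom : ∀ {w ρ} p {n} (zs : Vec (Var gen) n) →
               Force w ρ (atom (base (p / n)) (Vec.map var zs) []) ⇔ Ext w (p ⟨ valuesⱽ zs ρ ⟩)
  Force-atom {w} {ρ} p zs = ≡⇒⇔ (cong (λ rs → Ext w (p ⟨ rs ⟩)) (eval-vars zs ρ))

  Holds-∨ : ∀ {w F G} → (Holds w F ⊎ Holds w G) ⇔ Holds w (F Inf.∨ G)
  Holds-∨ = mk⇔ (λ { (inj₁ f) → zero , f ; (inj₂ g) → suc zero , g })
                (λ { (zero , f) → inj₁ f ; (suc zero , g) → inj₂ g })

  Force-rule : ∀ {w ρ} R → Force w ρ (τ*-rule R) ⇔ Holds w (τᴿ (PureRule.rule R))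
  Force-rule record { rule = R@(record { head = basic (_⟨_⟩ p {n} ts) ; body = Bs }) ; pure = pure } =
    instances⇔ ts Body Goal (λ α → τ-body (globals R) α Bs) (λ r → Inf.atom (p ⟨ r ⟩))
      (Force-body (globals R) Bs pure) (Force-atom p (auxs n))
    ∘⇔ Force-closure (Body ∧ ⌈ valⱽ ts (Vec.map var (auxs n)) ⌉ ⇒ Goal)
    where
    Body = τ*-body (globals R) Bs pure
    Goal = atom (base (p / n)) (Vec.map var (auxs n)) []
  Force-rule record { rule = R@(record { head = choice (_⟨_⟩ p {n} ts) ; body = Bs }) ; pure = pure } =
    instances⇔ ts Body (Goal ∨ (¬ᶠ Goal)) (λ α → τ-body (globals R) α Bs)
      (λ r → Inf.atom (p ⟨ r ⟩) Inf.∨ (Inf.¬ Inf.atom (p ⟨ r ⟩)))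
      (Force-body (globals R) Bs pure)
      (Holds-∨ ∘⇔ (Force-atom p (auxs n) ⊎-⇔ Π-⇔ λ v → Π-⇔ λ _ → →-⇔ (Force-atom p (auxs n)) (⇔-id _)))
    ∘⇔ Force-closure (Body ∧ ⌈ valⱽ ts (Vec.map var (auxs n)) ⌉ ⇒ Goal ∨ (¬ᶠ Goal))
    where
    Body = τ*-body (globals R) Bs pure
    Goal : Formula σ₂
    Goal = atom (base (p / n)) (Vec.map var (auxs n)) []
  Force-rule record { rule = R@(record { head = constraint ; body = Bs }) ; pure = pure } =
    mk⇔ (λ h α v w≼v b → h (instanceEnv α []) v w≼v (from (Force-body (globals R) Bs pure) b))
        (λ h ρ v w≼v b → h (programValues ρ) v w≼v (to (Force-body (globals R) Bs pure) b))
    ∘⇔ Force-closure (¬ᶠ τ*-body (globals R) Bs pure)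

  Force-τ* : ∀ {w ρ} Π → Force w ρ (τ* Π) ⇔ Holds w (τ Π)
  Force-τ* []      = mk⇔ (λ _ ()) (λ _ _ _ ())
  Force-τ* (R ∷ Π) = ⇔-sym Holds-⋀ˡ-∷ ∘⇔ (Force-rule R ×-⇔ Force-τ* Π)

  provable⇒equivalent : ∀ Π₁ Π₂ → HT#⊢ (τ* Π₁ ⇔ᶠ τ* Π₂) → ∀ w → Holds w (τ Π₁) ⇔ Holds w (τ Π₂)
  provable⇒equivalent Π₁ Π₂ p w =
    Force-τ* Π₂ ∘⇔ mk⇔ (proj₁ forced w ≼-refl) (proj₂ forced w ≼-refl) ∘⇔ ⇔-sym (Force-τ* Π₁)
    where
    ρ : Env
    ρ (s , _) = default s

    forced : Force w ρ (τ* Π₁ ⇔ᶠ τ* Π₂)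
    forced = soundness p w ρ []

-- Reducts and strong equivalence

module Reducts (em : ExcludedMiddle 0ℓ) (𝒯 : PrecomputedTerms)
  {H T : Pred (Atom (PrecomputedTerms.Symbol 𝒯) (MiniGringo.P 𝒯)) 0ℓ} (H⊆T : H ⊆ T) where

  open PrecomputedTerms 𝒯 using (Symbol)
  open MiniGringo 𝒯 using (P; module Semantics; τ*; HT#⊢_; _⇔ᶠ_)
  open Semantics em using (τ)
  open Infinitary (Atom Symbol P)
  open Stable em

  extent : World → Pred (Atom Symbol P) 0ℓ
  extent here  = H
  extent there = T

  extent-mono : ∀ {v w} → v ≼ w → extent v ⊆ extent w
  extent-mono ≼-refl     h = h
  extent-mono here≼there h = H⊆T h

  open Translation em 𝒯 extent extent-mono

  -- No world lies above `there`, so its implication is the classical one.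
  ⊨⇔holds-there : ∀ F → T ⊨ F ⇔ Holds there F
  ⊨⇔holds-there (atom a) = ⇔-id _
  ⊨⇔holds-there ⊥        = ⇔-id _
  ⊨⇔holds-there (⋀ F)    = Π-⇔ λ i → ⊨⇔holds-there (F i)
  ⊨⇔holds-there (⋁ F)    = ∃-⇔ λ i → ⊨⇔holds-there (F i)
  ⊨⇔holds-there (F ⇒ G)  =
    mk⇔ (λ { h _ ≼-refl → h }) (λ h → h there ≼-refl) ∘⇔ →-⇔ (⊨⇔holds-there F) (⊨⇔holds-there G)

  -- The reduct keeps an implication exactly when `T` satisfies it, which is the demand that forcing
  -- at `here` makes at `there`; the kept implication is the demand at `here`. An atom that the
  -- reduct deletes is outside `T`, hence outside `H`.
  ⊨reduct⇔holds-here : ∀ F → H ⊨ reduct T F ⇔ Holds here F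
  ⊨reduct⇔holds-here (atom a) with em {T a}
  ... | yes _ = ⇔-id _
  ... | no ¬t = mk⇔ (λ ()) (¬t ∘ H⊆T)
  ⊨reduct⇔holds-here ⊥     = ⇔-id _
  ⊨reduct⇔holds-here (⋀ F) = Π-⇔ λ i → ⊨reduct⇔holds-here (F i)
  ⊨reduct⇔holds-here (⋁ F) = ∃-⇔ λ i → ⊨reduct⇔holds-here (F i)
  ⊨reduct⇔holds-here (F ⇒ G) with em {T ⊨ (F ⇒ G)}
  ... | yes t = mk⇔
    (λ { h _ ≼-refl → to (→-⇔ (⊨reduct⇔holds-here F) (⊨reduct⇔holds-here G)) h
       ; h _ here≼there → to (→-⇔ (⊨⇔holds-there F) (⊨⇔holds-there G)) t })
    (λ h → from (→-⇔ (⊨reduct⇔holds-here F) (⊨reduct⇔holds-here G)) (h here ≼-refl))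
  ... | no ¬t = mk⇔ (λ ())
    (λ h → ¬t (from (→-⇔ (⊨⇔holds-there F) (⊨⇔holds-there G)) (h there here≼there)))

  reducts-equivalent : ∀ Π₁ Π₂ → HT#⊢ (τ* Π₁ ⇔ᶠ τ* Π₂) → H ⊨ reduct T (τ Π₁) ⇔ H ⊨ reduct T (τ Π₂)
  reducts-equivalent Π₁ Π₂ p =
    ⇔-sym (⊨reduct⇔holds-here (τ Π₂)) ∘⇔ provable⇒equivalent Π₁ Π₂ p here ∘⇔ ⊨reduct⇔holds-here (τ Π₁)

module _ {A : Set} (em : ExcludedMiddle 0ℓ) where

  open Infinitary A
  open Stable em

  -- Stability of `I` tests reducts by `I` only at `I` itself and at its subsets, and the reducts of
  -- members of `Φ` are common to both theories.
  stable-transfer : ∀ (Φ : InfTheory) F G {I} → (∀ {J} → J ⊆ I → J ⊨ reduct I F ⇔ J ⊨ reduct I G) →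
                    IsStableModel (｛ F ｝ ∪ Φ) I → IsStableModel (｛ G ｝ ∪ Φ) I
  stable-transfer Φ F G {I} e (model , minimal) =
    transfer (to (e id)) model , λ J J⊆I h → minimal J J⊆I (transfer (from (e J⊆I)) h)
    where
    transfer : ∀ {F G J} → (J ⊨ reduct I F → J ⊨ reduct I G) →
               SatisfiesReduct (｛ F ｝ ∪ Φ) I J → SatisfiesReduct (｛ G ｝ ∪ Φ) I J
    transfer f h _ (inj₁ refl) = f (h _ (inj₁ refl))
    transfer f h H (inj₂ φ)    = h H (inj₂ φ)

theorem1 : (em : ExcludedMiddle 0ℓ) (𝒯 : PrecomputedTerms) →
    let open MiniGringo 𝒯 in
    let open Semantics em in
    (Π₁ Π₂ : Program) → HT#⊢ (τ* Π₁ ⇔ᶠ τ* Π₂) → StronglyEquivalent Π₁ Π₂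
theorem1 em 𝒯 Π₁ Π₂ p Φ I = mk⇔
  (stable-transfer em Φ (τ Π₁) (τ Π₂) equivalent)
  (stable-transfer em Φ (τ Π₂) (τ Π₁) λ J⊆I → ⇔-sym (equivalent J⊆I))
  where
  open MiniGringo 𝒯 using (P; module Semantics)
  open Semantics em using (τ)
  open Infinitary (Atom (PrecomputedTerms.Symbol 𝒯) P)
  open Stable em

  equivalent : ∀ {J} → J ⊆ I → J ⊨ reduct I (τ Π₁) ⇔ J ⊨ reduct I (τ Π₂)
  -- Each subset `J` of the candidate `I` yields its own model, with `J` at `here` and `I` at
  -- `there`.
  equivalent J⊆I = Reducts.reducts-equivalent em 𝒯 J⊆I Π₁ Π₂ p
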